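{- Let $n\ge2$ and $2\le k\le2n-2$. The set consisting of the polynomials $E_iE_i\Delta_n$ for integers $1\le i\le n-2$ with $2i=k$, $E_iE_{i+1}\Delta_n$ for integers $1\le i\le n-3$ with $2i+1=k$, and $(E_jE_i-E_{j-1}E_{i+1})\Delta_n$ for integers $1\le i\le n-4$, $i+2\le j\le n-2$ with $i+j=k$, is a basis of $A_n^{k,2}$. For all other integers $k$, $\dim A_n^{k,2}=0$.
   Context: $A_n$ is the space of $P\in\mathbb{Q}[x_1,\dots,x_n,y_1,\dots,y_n]$ with $\sum_{i=1}^n\partial_{x_i}^a\partial_{y_i}^bP=0$ for all $a,b\ge0$ with $a+b>0$, which are alternating under the diagonal action of $S_n$. $A_n^{k,l}$ is the subspace of elements bihomogeneous of degree $\frac{n(n-1)}2-k$ in the $x$'s and $l$ in the $y$'s. $\Delta_n=\det\big(x_i^{n-j}/(n-j)!\big)_{i,j=1}^n$ and $E_a=\sum_{i=1}^ny_i\partial_{x_i}^a$ for $a>0$. (In the paper's notation these polynomials are $F_T\Delta_n$ for the tableaux $T$ given by a row $(i,i)$, a row $(i,i+1)$, or a column with $i$ below $j$.) -}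

module Defs where

open import Data.Nat as ℕ using (ℕ; zero; suc; _∸_; _!)
open import Data.Nat.Properties using (_!≢0)
import Data.Nat.DivMod as ℕD
open import Data.Integer as ℤ using (ℤ; +_)
open import Data.Rational as ℚ using (ℚ; 0ℚ; 1ℚ)
import Data.Rational.Properties as ℚP
open import Data.Fin as Fin using (Fin; toℕ; punchIn)
open import Data.Fin.Permutation using (Permutation′; _⟨$⟩ʳ_; _⟨$⟩ˡ_)
open import Data.Vec as Vec using (Vec; lookup; tabulate; zipWith; updateAt; replicate)
import Data.Vec.Properties as VecP
open import Data.List as List using (List; []; _∷_; _++_; concatMap; map; length; upTo; allFin; foldr)
open import Data.List.Relation.Unary.All using (All)
open import Data.Product using (_×_; _,_; ∃)
open import Data.Bool using (Bool; true; false; if_then_else_)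
open import Relation.Nullary using (Dec; yes; no; ¬_)
open import Relation.Nullary.Decidable using (⌊_⌋)
open import Relation.Binary.PropositionalEquality using (_≡_; _≢_)

-- Polynomials in Q[x_1..x_n, y_1..y_n], as formal finite sums of terms.
-- A term is (coefficient, x-exponent vector, y-exponent vector).
-- Two polynomials are equal (≈) iff all their coefficients agree.

Term : ℕ → Set
Term n = ℚ × Vec ℕ n × Vec ℕ n

Poly : ℕ → Set
Poly n = List (Term n)

coeff : ∀ {n} → Poly n → Vec ℕ n → Vec ℕ n → ℚ
coeff [] a b = 0ℚ
coeff ((c , a' , b') ∷ p) a b =
  (if ⌊ VecP.≡-dec ℕ._≟_ a' a ⌋ then (if ⌊ VecP.≡-dec ℕ._≟_ b' b ⌋ then c else 0ℚ) else 0ℚ)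
  ℚ.+ coeff p a b

infix 4 _≈_
_≈_ : ∀ {n} → Poly n → Poly n → Set
P ≈ Q = ∀ a b → coeff P a b ≡ coeff Q a b

zeroP : ∀ {n} → Poly n
zeroP = []

oneP : ∀ {n} → Poly n
oneP = (1ℚ , replicate _ 0 , replicate _ 0) ∷ []

infixl 6 _+P_ _-P_
infixl 7 _*P_
infixr 8 _•_

_+P_ : ∀ {n} → Poly n → Poly n → Poly n
_+P_ = _++_

_•_ : ∀ {n} → ℚ → Poly n → Poly n
c • p = map (λ { (d , a , b) → (c ℚ.* d , a , b) }) p

_-P_ : ∀ {n} → Poly n → Poly n → Poly n
p -P q = p +P ((ℚ.- 1ℚ) • q)

_*P_ : ∀ {n} → Poly n → Poly n → Poly n
p *P q = concatMap (λ { (c , a , b) →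
           map (λ { (d , a' , b') → (c ℚ.* d , zipWith ℕ._+_ a a' , zipWith ℕ._+_ b b') }) q }) p

nℚ : ℕ → ℚ
nℚ m = (+ m) ℚ./ 1

∂x : ∀ {n} → Fin n → Poly n → Poly n
∂x i = map (λ { (c , a , b) → (c ℚ.* nℚ (lookup a i) , updateAt a i (_∸ 1) , b) })

∂y : ∀ {n} → Fin n → Poly n → Poly n
∂y i = map (λ { (c , a , b) → (c ℚ.* nℚ (lookup b i) , a , updateAt b i (_∸ 1)) })

iter : ∀ {A : Set} → ℕ → (A → A) → A → A
iter zero f x = x
iter (suc m) f x = f (iter m f x)

sumP : ∀ {n} → List (Poly n) → Poly n
sumP = foldr _+P_ zeroP

mulY : ∀ {n} → Fin n → Poly n → Poly n
mulY i = map (λ { (c , a , b) → (c , a , updateAt b i suc) })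

E : ∀ {n} → ℕ → Poly n → Poly n
E {n} a P = sumP (map (λ i → mulY i (iter a (∂x i) P)) (allFin n))

sign : ℕ → ℚ
sign zero = 1ℚ
sign (suc m) = ℚ.- sign m

det : ∀ {n} m → (Fin m → Fin m → Poly n) → Poly n
det zero M = oneP
det (suc m) M =
  sumP (map (λ j → sign (toℕ j) • (M Fin.zero j *P det m (λ r c → M (Fin.suc r) (punchIn j c))))
            (allFin (suc m)))

xpow/fact : ∀ {n} → Fin n → ℕ → Poly n
xpow/fact {n} i e =
  (((+ 1) ℚ./ (e !)) {{e !≢0}} , updateAt (replicate n 0) i (λ _ → e) , replicate n 0) ∷ []

-- Δ_n = det ( x_i^{n-j} / (n-j)! )_{i,j=1..n}   (0-indexed: exponent n-1-j)
Δ : (n : ℕ) → Poly n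
Δ n = det n (λ i j → xpow/fact i (n ∸ 1 ∸ toℕ j))

-- diagonal action of a permutation σ: x_i ↦ x_{σ i}, y_i ↦ y_{σ i}
act : ∀ {n} → Permutation′ n → Poly n → Poly n
act σ = map (λ { (c , a , b) → (c , tabulate (λ j → lookup a (σ ⟨$⟩ˡ j))
                                    , tabulate (λ j → lookup b (σ ⟨$⟩ˡ j))) })

inversions : ∀ {n} → Permutation′ n → ℕ
inversions {n} σ = length (List.filter (λ { (i , j) → Fin._<?_ (σ ⟨$⟩ʳ j) (σ ⟨$⟩ʳ i) })
  (concatMap (λ j → map (λ i → (i , j)) (List.filter (λ i → Fin._<?_ i j) (allFin n))) (allFin n)))

sgn : ∀ {n} → Permutation′ n → ℚ
sgn σ = sign (inversions σ)

Alternating : ∀ {n} → Poly n → Set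
Alternating P = ∀ σ → act σ P ≈ sgn σ • P

Harmonic : ∀ {n} → Poly n → Set
Harmonic {n} P = ∀ a b → 0 ℕ.< a ℕ.+ b →
  sumP (map (λ i → iter a (∂x i) (iter b (∂y i) P)) (allFin n)) ≈ zeroP

vsum : ∀ {n} → Vec ℕ n → ℕ
vsum = Vec.sum

Bihom : ∀ {n} → ℤ → ℕ → Poly n → Set
Bihom {n} k l P = ∀ a b → coeff P a b ≢ 0ℚ →
  ((+ vsum a) ℤ.+ k ≡ + ((n ℕ.* (n ∸ 1)) ℕD./ 2)) × vsum b ≡ l

InA : (n : ℕ) → ℤ → ℕ → Poly n → Set
InA n k l P = Harmonic P × Alternating P × Bihom k l P

lincomb : ∀ {n} → List ℚ → List (Poly n) → Poly n
lincomb cs bs = sumP (List.zipWith _•_ cs bs)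

LinIndep : ∀ {n} → List (Poly n) → Set
LinIndep bs = ∀ (cs : List ℚ) → length cs ≡ length bs → lincomb cs bs ≈ zeroP → All (_≡ 0ℚ) cs

Spans : ∀ {n} → (Poly n → Set) → List (Poly n) → Set
Spans S bs = ∀ P → S P → ∃ λ (cs : List ℚ) → length cs ≡ length bs × P ≈ lincomb cs bs

IsBasis : ∀ {n} → (Poly n → Set) → List (Poly n) → Set
IsBasis S bs = All S bs × LinIndep bs × Spans S bs

range : ℕ → ℕ → List ℕ
range lo hi = List.map (lo ℕ.+_) (upTo (suc hi ∸ lo))

family : (n k : ℕ) → List (Poly n)
family n k =
     concatMap (λ i → if ⌊ 2 ℕ.* i ℕ.≟ k ⌋ then E i (E i (Δ n)) ∷ [] else [])
               (range 1 (n ∸ 2))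
  ++ concatMap (λ i → if ⌊ 2 ℕ.* i ℕ.+ 1 ℕ.≟ k ⌋ then E i (E (suc i) (Δ n)) ∷ [] else [])
               (range 1 (n ∸ 3))
  ++ concatMap (λ i → concatMap (λ j →
         if ⌊ i ℕ.+ j ℕ.≟ k ⌋ then (E j (E i (Δ n)) -P E (j ∸ 1) (E (suc i) (Δ n))) ∷ [] else [])
         (range (i ℕ.+ 2) (n ∸ 2)))
       (range 1 (n ∸ 4))

{-# OPTIONS --safe #-}
-- In divided-power coefficients ∂xᵢᵃ∂yᵢᵇ merely shifts the exponents (the cell)
-- of the i-th variable pair, so an element of A_n^{k,2} is an antisymmetric function
-- C on n-tuples of cells.  The y-derivative conditions determine the coefficients at
-- yᵢ² from those at yᵢyⱼ, so C is given by its values c(p, q; e) at y₁y₂x₁ᵖx₂^q x^e.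
--
-- Put m = n − 2.  Newton's identities show that a harmonic function antisymmetric
-- in m variables is determined by its value at the exponents 0, 1, …, m − 1.  By
-- descending induction on p + q, C is determined by the numbers c(p, q; 0, 1, …, m−1),
-- which are antisymmetric in p and q.  The conditions Σᵢ ∂xᵢᵃ∂yᵢ P = 0 combine by
-- Lagrange interpolation to n ∂x₁ⁿ⁻¹ f = 0 for the part f of P at y₁y₂, so that
-- only q < p ≤ m matter.  With p = m + 1 − i and q = m − j these are the pairs
-- 1 ≤ i ≤ j ≤ m with i + j = k.  The given family is triangular for these
-- functionals in the order of increasing i.
module Submission where

-- Spanning and independence come out of one elimination, without a dimension count. Each
-- functional, the value at a `point` i j, is non-zero at one member of the family and splits it
-- off, leaving its kernel to the remaining members (`basis-∷`); when all pairs are used up,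
-- uniqueness says that the space left is zero.
--
-- Triangularity rests on one fact about Δ: its coefficient at the x-exponents u, w, 0, ..., m - 1
-- is non-zero only if u and w are m and m + 1, since the exponents must be 0, ..., m + 1 in some
-- order. At y₁y₂ the product E_a E_b adds a to one of the first two exponents and b to the other.
-- From (m + 1 - i, m - j) the shifts i and j lead exactly to (m + 1, m), whereas any shift larger
-- than i takes the first exponent beyond m + 1. On the line i + j = k a smaller i means a larger
-- difference j - i, so the pairs with j ≥ i + 2 are eliminated first and the at most one pair with
-- j - i ≤ 1 last.
--
-- Antisymmetry is handled through adjacent transpositions; the passage to all permutations and to
-- the inversion sign of `sgn` goes through the single function `vandermonde`.

open import Defs
open import Data.Nat as ℕ using (ℕ; zero; suc; _≤_; _<_; _*_; _∸_; _!)
import Data.Nat.Properties as ℕP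
import Data.Nat.DivMod as ℕD
open import Data.Integer as ℤ using (ℤ; +_)
import Data.Integer.Properties as ℤP
import Algebra.Properties.AbelianGroup ℤP.+-0-abelianGroup as ℤG
open import Data.Rational as ℚ using (ℚ; 0ℚ; 1ℚ) renaming (_+_ to _⊕_; _*_ to _⊛_; -_ to ⊖_)
import Data.Rational.Properties as ℚP
open import Data.Rational.Solver using (module +-*-Solver)
open +-*-Solver using (solve; _:=_; _:+_; _:*_; :-_; con)
import Data.Rational.Unnormalised as ℚᵘ
import Data.Rational.Unnormalised.Properties as ℚᵘP
open import Data.Bool using (true; false; if_then_else_)
open import Data.Fin as Fin using (Fin; zero; suc; toℕ; punchIn)
import Data.Fin.Properties as FinP
open import Data.Fin.Permutation as Perm using (Permutation′; _⟨$⟩ʳ_; _⟨$⟩ˡ_)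
open import Data.List as List using (List; []; _∷_; length; allFin; _++_; map; concatMap; filter; applyUpTo)
import Data.List.Properties as ListP
open import Data.List.Membership.Propositional using (_∈_)
open import Data.List.Relation.Unary.Any using (here; there)
open import Data.List.Relation.Unary.All as ListAll using (All; []; _∷_)
open import Data.List.Relation.Binary.Permutation.Propositional using (_↭_; ↭-sym; ↭-trans; ↭-reflexive)
import Data.List.Relation.Binary.Permutation.Propositional.Properties as ↭P
open import Data.Vec as Vec using (Vec; []; _∷_; lookup; updateAt; tabulate; zipWith; replicate)
import Data.Vec.Properties as VecP
open import Data.Vec.Relation.Unary.All as VecAll using ([]; _∷_)
open import Data.Product using (_×_; _,_; ∃; proj₁; proj₂)
open import Data.Sum using (_⊎_; inj₁; inj₂)
open import Function using (_∘_; id; Injective)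
open import Function.Bundles using (module Injection)
open import Function.Properties.Inverse using (↔⇒↣)
open import Relation.Nullary using (¬_; Dec; yes; no; contradiction; does)
open import Relation.Nullary.Decidable using (⌊_⌋; dec-true; dec-false)
open import Relation.Binary.Construct.Closure.ReflexiveTransitive using (Star; ε; _◅_; _◅◅_; gmap)
open import Relation.Binary.Definitions using (tri<; tri≈; tri>)
open import Relation.Binary.PropositionalEquality
open ≡-Reasoning

-- Rational arithmetic and finite sums

infix 4 _≢0
_≢0 : ℚ → Set
q ≢0 = q ≢ 0ℚ

nℚ-+ : ∀ m n → nℚ (m ℕ.+ n) ≡ nℚ m ⊕ nℚ n
nℚ-+ m n = ℚP.toℚᵘ-injective (ℚᵘP.≃-trans (ℚP.toℚᵘ-fromℚᵘ (ℚᵘ.mkℚᵘ (+ (m ℕ.+ n)) 0))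
  (ℚᵘP.≃-trans (ℚᵘ.*≡* (cong (ℤ._* + 1) (sym (cong₂ ℤ._+_ (ℤP.*-identityʳ (+ m)) (ℤP.*-identityʳ (+ n))))))
  (ℚᵘP.≃-sym (ℚᵘP.≃-trans (ℚP.toℚᵘ-homo-+ (nℚ m) (nℚ n))
    (ℚᵘP.+-cong (ℚP.toℚᵘ-fromℚᵘ (ℚᵘ.mkℚᵘ (+ m) 0)) (ℚP.toℚᵘ-fromℚᵘ (ℚᵘ.mkℚᵘ (+ n) 0)))))))

nℚ-suc : ∀ n → nℚ (suc n) ≡ 1ℚ ⊕ nℚ n
nℚ-suc = nℚ-+ 1

nℚ-* : ∀ m n → nℚ (m * n) ≡ nℚ m ⊛ nℚ n
nℚ-* zero n = sym (ℚP.*-zeroˡ (nℚ n))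
nℚ-* (suc m) n = begin
  nℚ (n ℕ.+ m * n)        ≡⟨ nℚ-+ n (m * n) ⟩
  nℚ n ⊕ nℚ (m * n)       ≡⟨ cong (nℚ n ⊕_) (nℚ-* m n) ⟩
  nℚ n ⊕ nℚ m ⊛ nℚ n      ≡⟨ solve 2 (λ a b → b :+ a :* b := (con 1ℚ :+ a) :* b) refl (nℚ m) (nℚ n) ⟩
  (1ℚ ⊕ nℚ m) ⊛ nℚ n      ≡⟨ cong (_⊛ nℚ n) (nℚ-suc m) ⟨
  nℚ (suc m) ⊛ nℚ n ∎

nℚ-injective : ∀ {m n} → nℚ m ≡ nℚ n → m ≡ n
nℚ-injective {m} {n} eq with ℚP./-injective-≃ (ℚᵘ.mkℚᵘ (+ m) 0) (ℚᵘ.mkℚᵘ (+ n) 0) eq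
... | ℚᵘ.*≡* p = ℤP.+-injective (trans (sym (ℤP.*-identityʳ (+ m))) (trans p (ℤP.*-identityʳ (+ n))))

nℚ-suc≢0 : ∀ n → nℚ (suc n) ≢0
nℚ-suc≢0 n eq with nℚ-injective {suc n} {0} eq
... | ()

*-cancel-0 : ∀ {p q} → p ≢0 → p ⊛ q ≡ 0ℚ → q ≡ 0ℚ
*-cancel-0 {p} {q} p≢0 eq = begin
  q                    ≡⟨ ℚP.*-identityˡ q ⟨
  1ℚ ⊛ q               ≡⟨ cong (_⊛ q) (ℚP.*-inverseˡ p) ⟨
  (ℚ.1/ p) ⊛ p ⊛ q     ≡⟨ ℚP.*-assoc (ℚ.1/ p) p q ⟩
  (ℚ.1/ p) ⊛ (p ⊛ q)   ≡⟨ cong ((ℚ.1/ p) ⊛_) eq ⟩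
  (ℚ.1/ p) ⊛ 0ℚ        ≡⟨ ℚP.*-zeroʳ (ℚ.1/ p) ⟩
  0ℚ ∎
  where instance _ = ℚ.≢-nonZero p≢0

*-≢0 : ∀ {p q} → p ≢0 → q ≢0 → p ⊛ q ≢0
*-≢0 p≢0 q≢0 eq = q≢0 (*-cancel-0 p≢0 eq)

⊖-≡0 : ∀ {q} → ⊖ q ≡ 0ℚ → q ≡ 0ℚ
⊖-≡0 {q} eq = trans (solve 1 (λ a → a := :- (:- a)) refl q) (cong ⊖_ eq)

sign≢0 : ∀ n → sign n ≢0
sign≢0 zero ()
sign≢0 (suc n) eq = sign≢0 n (⊖-≡0 eq)

≡⊖⇒≡0 : ∀ {q} → q ≡ ⊖ q → q ≡ 0ℚ
≡⊖⇒≡0 {q} eq = *-cancel-0 {1ℚ ⊕ 1ℚ} (λ ()) (begin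
  (1ℚ ⊕ 1ℚ) ⊛ q ≡⟨ solve 1 (λ a → (con 1ℚ :+ con 1ℚ) :* a := a :+ a) refl q ⟩
  q ⊕ q         ≡⟨ cong (_⊕ q) eq ⟩
  ⊖ q ⊕ q       ≡⟨ ℚP.+-inverseˡ q ⟩
  0ℚ ∎)

0+ : ∀ {p q} → p ≡ 0ℚ → q ≡ 0ℚ → p ⊕ q ≡ 0ℚ
0+ refl refl = refl

sumL : ∀ {I : Set} → (I → ℚ) → List I → ℚ
sumL F []      = 0ℚ
sumL F (i ∷ l) = F i ⊕ sumL F l

sumL-cong : ∀ {I : Set} {F G : I → ℚ} → (∀ i → F i ≡ G i) → ∀ l → sumL F l ≡ sumL G l
sumL-cong eq []      = refl
sumL-cong eq (i ∷ l) = cong₂ _⊕_ (eq i) (sumL-cong eq l)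

sumL-0 : ∀ {I : Set} {F : I → ℚ} l → (∀ {i} → i ∈ l → F i ≡ 0ℚ) → sumL F l ≡ 0ℚ
sumL-0 []      h = refl
sumL-0 (i ∷ l) h = 0+ (h (here refl)) (sumL-0 l (h ∘ there))

sumL-+ : ∀ {I : Set} (F G : I → ℚ) l → sumL (λ i → F i ⊕ G i) l ≡ sumL F l ⊕ sumL G l
sumL-+ F G []      = refl
sumL-+ F G (i ∷ l) = trans (cong (F i ⊕ G i ⊕_) (sumL-+ F G l))
  (solve 4 (λ a b c d → (a :+ b) :+ (c :+ d) := (a :+ c) :+ (b :+ d)) refl (F i) (G i) (sumL F l) (sumL G l))

sumL-* : ∀ {I : Set} c (F : I → ℚ) l → sumL (λ i → c ⊛ F i) l ≡ c ⊛ sumL F l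
sumL-* c F []      = sym (ℚP.*-zeroʳ c)
sumL-* c F (i ∷ l) = trans (cong (c ⊛ F i ⊕_) (sumL-* c F l)) (sym (ℚP.*-distribˡ-+ c (F i) (sumL F l)))

sumL-⊖ : ∀ {I : Set} (F : I → ℚ) l → sumL (λ i → ⊖ F i) l ≡ ⊖ sumL F l
sumL-⊖ F []      = refl
sumL-⊖ F (i ∷ l) = trans (cong (⊖ F i ⊕_) (sumL-⊖ F l)) (sym (ℚP.neg-distrib-+ (F i) (sumL F l)))

-- Functions on X are acted on by the commuting operators f ↦ f ∘ s i, so that a
-- symmetric polynomial in the variables s i becomes an operator on functions.
module Newton {X I : Set} (s : I → X → X) (s-comm : ∀ i j x → s i (s j x) ≡ s j (s i x)) where

  iter-comm : ∀ i j a x → s j (iter a (s i) x) ≡ iter a (s i) (s j x)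
  iter-comm i j zero    x = refl
  iter-comm i j (suc a) x = trans (s-comm j i _) (cong (s i) (iter-comm i j a x))

  -- The action on f of the elementary symmetric polynomial e_r in the variables s k, k ∈ l; the
  -- recursion separates the monomials without and with the head variable.
  elem : List I → ℕ → (X → ℚ) → X → ℚ
  elem l       zero    f x = f x
  elem []      (suc r) f x = 0ℚ
  elem (k ∷ l) (suc r) f x = elem l (suc r) f x ⊕ elem l r f (s k x)

  power : ℕ → List I → (X → ℚ) → X → ℚ
  power a l f x = sumL (λ k → f (iter a (s k) x)) l

  -- The sum over k of s k ^ a times the r-th elementary symmetric polynomial in
  -- the variables other than s k.
  hook : List I → ℕ → ℕ → (X → ℚ) → X → ℚ
  hook []      a r       f x = 0ℚ
  hook (k ∷ l) a zero    f x = f (iter a (s k) x) ⊕ hook l a zero f x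
  hook (k ∷ l) a (suc r) f x = elem l (suc r) f (iter a (s k) x) ⊕ (hook l a (suc r) f x ⊕ hook l a r f (s k x))

  elem-cong : ∀ l r {f g : X → ℚ} → (∀ x → f x ≡ g x) → ∀ x → elem l r f x ≡ elem l r g x
  elem-cong l       zero    eq x = eq x
  elem-cong []      (suc r) eq x = refl
  elem-cong (k ∷ l) (suc r) eq x = cong₂ _⊕_ (elem-cong l (suc r) eq x) (elem-cong l r eq (s k x))

  elem-0 : ∀ l r x → elem l r (λ _ → 0ℚ) x ≡ 0ℚ
  elem-0 l       zero    x = refl
  elem-0 []      (suc r) x = refl
  elem-0 (k ∷ l) (suc r) x = 0+ (elem-0 l (suc r) x) (elem-0 l r (s k x))

  elem-+ : ∀ l r (f g : X → ℚ) x → elem l r (λ y → f y ⊕ g y) x ≡ elem l r f x ⊕ elem l r g x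
  elem-+ l       zero    f g x = refl
  elem-+ []      (suc r) f g x = refl
  elem-+ (k ∷ l) (suc r) f g x = trans (cong₂ _⊕_ (elem-+ l (suc r) f g x) (elem-+ l r f g (s k x)))
    (solve 4 (λ a b c d → (a :+ b) :+ (c :+ d) := (a :+ c) :+ (b :+ d)) refl
      (elem l (suc r) f x) (elem l (suc r) g x) (elem l r f (s k x)) (elem l r g (s k x)))

  elem-shift : ∀ l r k (f : X → ℚ) x → elem l r (f ∘ s k) x ≡ elem l r f (s k x)
  elem-shift l       zero    k f x = refl
  elem-shift []      (suc r) k f x = refl
  elem-shift (j ∷ l) (suc r) k f x = cong₂ _⊕_ (elem-shift l (suc r) k f x)
    (trans (elem-shift l r k f (s j x)) (cong (elem l r f) (s-comm k j x)))

  elem-iter : ∀ l r k a (f : X → ℚ) x → elem l r (f ∘ iter a (s k)) x ≡ elem l r f (iter a (s k) x)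
  elem-iter l r k zero    f x = refl
  elem-iter l r k (suc a) f x = trans (elem-iter l r k a (f ∘ s k) x) (elem-shift l r k f _)

  elem-power : ∀ l r a l′ f x → elem l r (power a l′ f) x ≡ power a l′ (elem l r f) x
  elem-power l r a []       f x = elem-0 l r x
  elem-power l r a (k ∷ l′) f x = trans (elem-+ l r _ _ x) (cong₂ _⊕_ (elem-iter l r k a f x) (elem-power l r a l′ f x))

  power-shift : ∀ a l k (f : X → ℚ) x → power a l (f ∘ s k) x ≡ power a l f (s k x)
  power-shift a l k f x = sumL-cong (λ i → cong f (iter-comm i k a x)) l

  hook-0 : ∀ l a f x → hook l a 0 f x ≡ power a l f x
  hook-0 []      a f x = refl
  hook-0 (k ∷ l) a f x = cong (f (iter a (s k) x) ⊕_) (hook-0 l a f x)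

  -- The product of the power sum p_a with e_(r+1): a monomial of e_(r+1) either omits s k, or
  -- contains it and then turns (s k)^a into (s k)^(a+1) times r other variables.
  hook-power : ∀ l a r f x → hook l a (suc r) f x ⊕ hook l (suc a) r f x ≡ power a l (elem l (suc r) f) x
  hook-power []      a r f x = refl
  hook-power (k ∷ l) a zero f x = begin
    (e₁ ⊕ (h₁ ⊕ h₀)) ⊕ (e₀ ⊕ h₀′)
      ≡⟨ solve 5 (λ e₁ h₁ h₀ e₀ h₀′ → (e₁ :+ (h₁ :+ h₀)) :+ (e₀ :+ h₀′) := (e₁ :+ e₀) :+ ((h₁ :+ h₀′) :+ h₀)) refl e₁ h₁ h₀ e₀ h₀′ ⟩
    (e₁ ⊕ e₀) ⊕ ((h₁ ⊕ h₀′) ⊕ h₀)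
      ≡⟨ cong (λ z → (e₁ ⊕ e₀) ⊕ z) (cong₂ _⊕_ (hook-power l a zero f x) (trans (hook-0 l a f (s k x)) (sym (power-shift a l k f x)))) ⟩
    (e₁ ⊕ e₀) ⊕ (power a l (elem l 1 f) x ⊕ power a l (f ∘ s k) x)
      ≡⟨ cong ((e₁ ⊕ e₀) ⊕_) (sumL-+ _ _ l) ⟨
    power a (k ∷ l) (elem (k ∷ l) 1 f) x ∎
    where
    e₁ = elem l 1 f (iter a (s k) x)
    h₁ = hook l a 1 f x
    h₀ = hook l a 0 f (s k x)
    e₀ = f (iter (suc a) (s k) x)
    h₀′ = hook l (suc a) 0 f x
  hook-power (k ∷ l) a (suc r) f x = begin
    (e₂ ⊕ (h₂ ⊕ h₁)) ⊕ (e₁ ⊕ (h₁′ ⊕ h₀))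
      ≡⟨ solve 6 (λ e₂ h₂ h₁ e₁ h₁′ h₀ → (e₂ :+ (h₂ :+ h₁)) :+ (e₁ :+ (h₁′ :+ h₀)) := (e₂ :+ e₁) :+ ((h₂ :+ h₁′) :+ (h₁ :+ h₀))) refl e₂ h₂ h₁ e₁ h₁′ h₀ ⟩
    (e₂ ⊕ e₁) ⊕ ((h₂ ⊕ h₁′) ⊕ (h₁ ⊕ h₀))
      ≡⟨ cong (λ z → (e₂ ⊕ e₁) ⊕ z) (cong₂ _⊕_ (hook-power l a (suc r) f x) (trans (hook-power l a r f (s k x)) (sym (power-shift a l k (elem l (suc r) f) x)))) ⟩
    (e₂ ⊕ e₁) ⊕ (power a l (elem l (2 ℕ.+ r) f) x ⊕ power a l (elem l (suc r) f ∘ s k) x)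
      ≡⟨ cong ((e₂ ⊕ e₁) ⊕_) (sumL-+ _ _ l) ⟨
    power a (k ∷ l) (elem (k ∷ l) (2 ℕ.+ r) f) x ∎
    where
    e₂ = elem l (2 ℕ.+ r) f (iter a (s k) x)
    h₂ = hook l a (2 ℕ.+ r) f x
    h₁ = hook l a (suc r) f (s k x)
    e₁ = elem l (suc r) f (iter (suc a) (s k) x)
    h₁′ = hook l (suc a) (suc r) f x
    h₀ = hook l (suc a) r f (s k x)

  -- Every squarefree monomial of degree r + 1 arises once from each of its r + 1 variables.
  -- Together with `hook-power` this is the content of Newton's identities.
  hook-elem : ∀ l r f x → hook l 1 r f x ≡ nℚ (suc r) ⊛ elem l (suc r) f x
  hook-elem []      r f x = sym (ℚP.*-zeroʳ (nℚ (suc r)))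
  hook-elem (k ∷ l) zero f x = begin
    f (s k x) ⊕ hook l 1 0 f x            ≡⟨ cong (f (s k x) ⊕_) (hook-elem l 0 f x) ⟩
    f (s k x) ⊕ 1ℚ ⊛ elem l 1 f x         ≡⟨ solve 2 (λ a b → a :+ con 1ℚ :* b := con 1ℚ :* (b :+ a)) refl (f (s k x)) (elem l 1 f x) ⟩
    1ℚ ⊛ (elem l 1 f x ⊕ f (s k x)) ∎
  hook-elem (k ∷ l) (suc r) f x = begin
    e ⊕ (hook l 1 (suc r) f x ⊕ hook l 1 r f (s k x))
      ≡⟨ cong (e ⊕_) (cong₂ _⊕_ (hook-elem l (suc r) f x) (hook-elem l r f (s k x))) ⟩
    e ⊕ (nℚ (2 ℕ.+ r) ⊛ e′ ⊕ nℚ (suc r) ⊛ e)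
      ≡⟨ solve 4 (λ e e′ n n′ → e :+ (n′ :* e′ :+ n :* e) := n′ :* e′ :+ (con 1ℚ :+ n) :* e) refl e e′ (nℚ (suc r)) (nℚ (2 ℕ.+ r)) ⟩
    nℚ (2 ℕ.+ r) ⊛ e′ ⊕ (1ℚ ⊕ nℚ (suc r)) ⊛ e
      ≡⟨ cong (λ z → nℚ (2 ℕ.+ r) ⊛ e′ ⊕ z ⊛ e) (nℚ-suc (suc r)) ⟨
    nℚ (2 ℕ.+ r) ⊛ e′ ⊕ nℚ (2 ℕ.+ r) ⊛ e
      ≡⟨ ℚP.*-distribˡ-+ (nℚ (2 ℕ.+ r)) e′ e ⟨
    nℚ (2 ℕ.+ r) ⊛ (e′ ⊕ e) ∎
    where
    e = elem l (suc r) f (s k x)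
    e′ = elem l (2 ℕ.+ r) f x

  -- A record instead of the bare equation, so that `l` and `f` can be inferred from a proof of it.
  record PowersKill (l : List I) (f : X → ℚ) : Set where
    constructor powersKill
    field kill : ∀ a x → power (suc a) l f x ≡ 0ℚ
  open PowersKill

  -- The operators commute, so a power sum times an elementary symmetric polynomial kills f as well.
  -- `hook-power` then trades r + 1 and exponent a + 1 for r and exponent a + 2, down to a pure
  -- power sum at r = 0.
  hook≡0 : ∀ {l f} → PowersKill l f → ∀ r a x → hook l (suc a) r f x ≡ 0ℚ
  hook≡0 {l} {f} h zero    a x = trans (hook-0 l (suc a) f x) (kill h a x)
  hook≡0 {l} {f} h (suc r) a x = begin
    hook l (suc a) (suc r) f x                               ≡⟨ ℚP.+-identityʳ _ ⟨
    hook l (suc a) (suc r) f x ⊕ 0ℚ                          ≡⟨ cong (hook l (suc a) (suc r) f x ⊕_) (hook≡0 h r (suc a) x) ⟨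
    hook l (suc a) (suc r) f x ⊕ hook l (suc (suc a)) r f x  ≡⟨ hook-power l (suc a) r f x ⟩
    power (suc a) l (elem l (suc r) f) x                     ≡⟨ elem-power l (suc r) (suc a) l f x ⟨
    elem l (suc r) (power (suc a) l f) x                     ≡⟨ elem-cong l (suc r) (kill h a) x ⟩
    elem l (suc r) (λ _ → 0ℚ) x                              ≡⟨ elem-0 l (suc r) x ⟩
    0ℚ ∎

  elem≡0 : ∀ {l f} → PowersKill l f → ∀ r x → elem l (suc r) f x ≡ 0ℚ
  elem≡0 {l} {f} h r x = *-cancel-0 (nℚ-suc≢0 r) (trans (sym (hook-elem l r f x)) (hook≡0 h r 0 x))

  shiftAll : List I → X → X
  shiftAll []      x = x
  shiftAll (k ∷ l) x = shiftAll l (s k x)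

  elem-high : ∀ l r f x → length l < r → elem l r f x ≡ 0ℚ
  elem-high []      (suc r) f x _           = refl
  elem-high (k ∷ l) (suc r) f x (ℕ.s≤s l<r) = 0+ (elem-high l (suc r) f x (ℕP.m<n⇒m<1+n l<r)) (elem-high l r f (s k x) l<r)

  elem-top : ∀ l f x → elem l (length l) f x ≡ f (shiftAll l x)
  elem-top []      f x = refl
  elem-top (k ∷ l) f x = trans (cong₂ _⊕_ (elem-high l (suc (length l)) f x ℕP.≤-refl) (elem-top l f (s k x))) (ℚP.+-identityˡ _)

  -- `shiftAll` is the product of all variables, which is the top elementary symmetric polynomial.
  shiftAll≡0 : ∀ {k l f} → PowersKill (k ∷ l) f → ∀ x → f (shiftAll (k ∷ l) x) ≡ 0ℚ
  shiftAll≡0 {k} {l} {f} h x = trans (sym (elem-top (k ∷ l) f x)) (elem≡0 h (length l) x)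

  -- On f the product ∏ (1 + s j t) over k ∷ l acts as 1, so the product over l alone acts as 1 / (1
  -- + s k t), whose coefficients are (-s k)^r.
  elem-tail : ∀ {k l f} → PowersKill (k ∷ l) f → ∀ r x → elem l r f x ≡ sign r ⊛ f (iter r (s k) x)
  elem-tail {k} {l} {f} h zero    x = sym (ℚP.*-identityˡ (f x))
  elem-tail {k} {l} {f} h (suc r) x = begin
    e                                         ≡⟨ solve 2 (λ a b → a := (a :+ b) :+ (:- b)) refl e e′ ⟩
    (e ⊕ e′) ⊕ ⊖ e′                           ≡⟨ cong (_⊕ (⊖ e′)) (elem≡0 h r x) ⟩
    0ℚ ⊕ ⊖ e′                                 ≡⟨ ℚP.+-identityˡ (⊖ e′) ⟩
    ⊖ e′                                      ≡⟨ cong ⊖_ (elem-tail h r (s k x)) ⟩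
    ⊖ (sign r ⊛ f (iter r (s k) (s k x)))     ≡⟨ ℚP.neg-distribˡ-* (sign r) _ ⟩
    (⊖ sign r) ⊛ f (iter r (s k) (s k x))     ≡⟨ cong (λ y → (⊖ sign r) ⊛ f y) (iter-comm k k r x) ⟨
    (⊖ sign r) ⊛ f (s k (iter r (s k) x)) ∎
    where
    e = elem l (suc r) f x
    e′ = elem l r f (s k x)

  -- ∏_{j ∈ l} (s i − s j)
  lagrange : List I → I → (X → ℚ) → X → ℚ
  lagrange []      i f x = f x
  lagrange (j ∷ l) i f x = lagrange l i f (s i x) ⊕ ⊖ lagrange l i f (s j x)

  lagrange-∈ : ∀ {l i} → i ∈ l → ∀ f x → lagrange l i f x ≡ 0ℚ
  lagrange-∈ {j ∷ l} (here refl) f x = ℚP.+-inverseʳ (lagrange l j f (s j x))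
  lagrange-∈ {j ∷ l} {i} (there i∈l) f x = cong₂ (λ a b → a ⊕ ⊖ b) (lagrange-∈ i∈l f (s i x)) (lagrange-∈ i∈l f (s j x))

  -- The product is expanded one factor at a time: s i raises the exponent under the sum, while s j
  -- is independent of i and comes out of the sum. The offset t is 0 for the family in `power-bound`
  -- and 1 for power sums, which vanish only in positive degree.
  sum-lagrange : ∀ t L (c : I → X → ℚ) → (∀ a x → sumL (λ i → c i (iter (a ℕ.+ t) (s i) x)) L ≡ 0ℚ) →
    ∀ l a x → sumL (λ i → lagrange l i (c i) (iter (a ℕ.+ t) (s i) x)) L ≡ 0ℚ
  sum-lagrange t L c h []      a x = h a x
  sum-lagrange t L c h (j ∷ l) a x = begin
    sumL (λ i → lagrange l i (c i) (iter (suc a ℕ.+ t) (s i) x) ⊕ ⊖ lagrange l i (c i) (s j (iter (a ℕ.+ t) (s i) x))) L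
      ≡⟨ sumL-+ _ _ L ⟩
    sumL (λ i → lagrange l i (c i) (iter (suc a ℕ.+ t) (s i) x)) L ⊕ sumL (λ i → ⊖ lagrange l i (c i) (s j (iter (a ℕ.+ t) (s i) x))) L
      ≡⟨ cong₂ _⊕_ (sum-lagrange t L c h l (suc a) x) (trans (sumL-⊖ _ L) (cong ⊖_ (sumL-cong (λ i → cong (lagrange l i (c i)) (iter-comm i j (a ℕ.+ t) x)) L))) ⟩
    0ℚ ⊕ ⊖ sumL (λ i → lagrange l i (c i) (iter (a ℕ.+ t) (s i) (s j x))) L
      ≡⟨ cong (λ z → 0ℚ ⊕ ⊖ z) (sum-lagrange t L c h l a (s j x)) ⟩
    0ℚ ∎

  -- For a single f, every term of ∏ (s i - s j) with a positive power of s i sums to 0 over i. The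
  -- term ∏ (-s j) is left, once for each element of L.
  sum-lagrange-const : ∀ {L f} → PowersKill L f → ∀ l x →
    sumL (λ i → lagrange l i f x) L ≡ nℚ (length L) ⊛ (sign (length l) ⊛ f (shiftAll l x))
  sum-lagrange-const {L} {f} h [] x = trans (const L) (cong (nℚ (length L) ⊛_) (sym (ℚP.*-identityˡ (f x))))
    where
    const : ∀ L → sumL (λ _ → f x) L ≡ nℚ (length L) ⊛ f x
    const []      = sym (ℚP.*-zeroˡ (f x))
    const (_ ∷ L) = trans (cong (f x ⊕_) (const L)) (trans
      (solve 2 (λ a n → a :+ n :* a := (con 1ℚ :+ n) :* a) refl (f x) (nℚ (length L)))
      (cong (_⊛ f x) (sym (nℚ-suc (length L)))))
  sum-lagrange-const {L} {f} h (j ∷ l) x = begin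
    sumL (λ i → lagrange l i f (s i x) ⊕ ⊖ lagrange l i f (s j x)) L
      ≡⟨ sumL-+ _ _ L ⟩
    sumL (λ i → lagrange l i f (s i x)) L ⊕ sumL (λ i → ⊖ lagrange l i f (s j x)) L
      ≡⟨ cong₂ _⊕_ (sum-lagrange 1 L (λ _ → f) h′ l 0 x) (sumL-⊖ _ L) ⟩
    0ℚ ⊕ ⊖ sumL (λ i → lagrange l i f (s j x)) L
      ≡⟨ cong (λ z → 0ℚ ⊕ ⊖ z) (sum-lagrange-const h l (s j x)) ⟩
    0ℚ ⊕ ⊖ (nℚ (length L) ⊛ (sign (length l) ⊛ f (shiftAll l (s j x))))
      ≡⟨ solve 3 (λ n e v → con 0ℚ :+ :- (n :* (e :* v)) := n :* ((:- e) :* v)) refl (nℚ (length L)) (sign (length l)) _ ⟩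
    nℚ (length L) ⊛ (⊖ sign (length l) ⊛ f (shiftAll l (s j x))) ∎
    where
    h′ : ∀ a x → power (a ℕ.+ 1) L f x ≡ 0ℚ
    h′ a x = trans (cong (λ b → power b L f x) (ℕP.+-comm a 1)) (kill h a x)

  -- In the ring where every power sum vanishes ∏_j (t − s j) = tⁿ, whose derivative
  -- at s k is n (s k)ⁿ⁻¹; Lagrange interpolation isolates that derivative.
  power-bound : ∀ k l (c : I → X → ℚ) → PowersKill (k ∷ l) (c k) →
    (∀ a x → sumL (λ i → c i (iter a (s i) x)) (k ∷ l) ≡ 0ℚ) →
    ∀ x → c k (iter (length l) (s k) x) ≡ 0ℚ
  power-bound k l c harm h x = *-cancel-0 (sign≢0 (length l)) (begin
    sign (length l) ⊛ c k (iter (length l) (s k) x)  ≡⟨ elem-tail harm (length l) x ⟨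
    elem l (length l) (c k) x                        ≡⟨ elem-top l (c k) x ⟩
    c k (shiftAll l x)                               ≡⟨ *-cancel-0 (sign≢0 (length l)) (*-cancel-0 (nℚ-suc≢0 (length l)) combined) ⟩
    0ℚ ∎)
    where
    h′ : ∀ a x → sumL (λ i → c i (iter (a ℕ.+ 0) (s i) x)) (k ∷ l) ≡ 0ℚ
    h′ a x = trans (cong (λ b → sumL (λ i → c i (iter b (s i) x)) (k ∷ l)) (ℕP.+-identityʳ a)) (h a x)

    isolate : (f : I → X → ℚ) → sumL (λ i → lagrange l i (f i) x) (k ∷ l) ≡ lagrange l k (f k) x
    isolate f = trans (cong (lagrange l k (f k) x ⊕_) (sumL-0 l (λ {i} i∈l → lagrange-∈ i∈l (f i) x))) (ℚP.+-identityʳ _)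

    -- The factor s i - s i removes every summand with i ∈ l from both sums, so the constant family
    -- `c k` and the family `c` have the same Lagrange sum; the first is known in closed form and
    -- the second is 0.
    combined : nℚ (suc (length l)) ⊛ (sign (length l) ⊛ c k (shiftAll l x)) ≡ 0ℚ
    combined = begin
      nℚ (suc (length l)) ⊛ (sign (length l) ⊛ c k (shiftAll l x)) ≡⟨ sum-lagrange-const harm l x ⟨
      sumL (λ i → lagrange l i (c k) x) (k ∷ l)                    ≡⟨ isolate (λ _ → c k) ⟩
      lagrange l k (c k) x                                         ≡⟨ isolate c ⟨
      sumL (λ i → lagrange l i (c i) x) (k ∷ l)                    ≡⟨ sum-lagrange 0 (k ∷ l) c h′ l 0 x ⟩
      0ℚ ∎

-- Alternating functions on vectors

infix 4 _⇄_ _⇄*_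

data _⇄_ {A : Set} : ∀ {n} → Vec A n → Vec A n → Set where
  swap : ∀ {n} x y (v : Vec A n) → x ∷ y ∷ v ⇄ y ∷ x ∷ v
  skip : ∀ {n} x {u v : Vec A n} → u ⇄ v → x ∷ u ⇄ x ∷ v

_⇄*_ : {A : Set} {n : ℕ} → Vec A n → Vec A n → Set
_⇄*_ = Star _⇄_

⇄*-skip : ∀ {A : Set} {n} (x : A) {u v : Vec A n} → u ⇄* v → x ∷ u ⇄* x ∷ v
⇄*-skip x = gmap (x ∷_) (skip x)

⇄-map : ∀ {A B : Set} (h : A → B) {n} {u v : Vec A n} → u ⇄ v → Vec.map h u ⇄ Vec.map h v
⇄-map h (swap x y v) = swap (h x) (h y) (Vec.map h v)
⇄-map h (skip x u⇄v) = skip (h x) (⇄-map h u⇄v)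

⇄*-map : ∀ {A B : Set} (h : A → B) {n} {u v : Vec A n} → u ⇄* v → Vec.map h u ⇄* Vec.map h v
⇄*-map h = gmap (Vec.map h) (⇄-map h)

Antisym : {A : Set} {n : ℕ} → (Vec A n → ℚ) → Set
Antisym C = ∀ {u v} → u ⇄ v → C u ≡ ⊖ C v

-- The sign belongs to the chain of transpositions; for the chain that comes from a permutation,
-- `antisym-permute` identifies it with `sgn`.
parity : ∀ {A : Set} {n} {u v : Vec A n} → u ⇄* v → ℚ
parity ε       = 1ℚ
parity (_ ◅ p) = ⊖ parity p

antisym-⇄* : ∀ {A : Set} {n} {C : Vec A n → ℚ} → Antisym C → ∀ {u v} (p : u ⇄* v) → C u ≡ parity p ⊛ C v
antisym-⇄* anti {u}         ε       = sym (ℚP.*-identityˡ _)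
antisym-⇄* {C = C} anti {u} {v} (s ◅ p) =
  trans (anti s) (trans (cong ⊖_ (antisym-⇄* anti p)) (ℚP.neg-distribˡ-* (parity p) (C v)))

antisym-≡0 : ∀ {A : Set} {n} {C : Vec A n → ℚ} → Antisym C → ∀ {u v} → u ⇄* v → C v ≡ 0ℚ → C u ≡ 0ℚ
antisym-≡0 anti p eq = trans (antisym-⇄* anti p) (trans (cong (parity p ⊛_) eq) (ℚP.*-zeroʳ (parity p)))

antisym-repeat : ∀ {A : Set} {n} {C : Vec A (2 ℕ.+ n) → ℚ} → Antisym C → ∀ {x} {u v} → u ⇄* x ∷ v →
  C (x ∷ u) ≡ 0ℚ
antisym-repeat anti {x} {v = v} p = antisym-≡0 anti (⇄*-skip x p) (≡⊖⇒≡0 (anti (swap x x v)))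

-- In exterior-algebra terms this is the derivation moving one factor x to w x · g x.
moves : ∀ {A : Set} {n} → (A → ℚ) → (A → A) → (Vec A n → ℚ) → Vec A n → ℚ
moves w g C []      = 0ℚ
moves w g C (x ∷ v) = w x ⊛ C (g x ∷ v) ⊕ moves w g (λ u → C (x ∷ u)) v

one : {A : Set} → A → ℚ
one _ = 1ℚ

module _ {A : Set} {w : A → ℚ} {g : A → A} where

  moves-cong : ∀ {n} {C D : Vec A n → ℚ} → (∀ u → C u ≡ D u) → ∀ v → moves w g C v ≡ moves w g D v
  moves-cong eq []      = refl
  moves-cong eq (x ∷ v) = cong₂ (λ a b → w x ⊛ a ⊕ b) (eq (g x ∷ v)) (moves-cong (λ u → eq (x ∷ u)) v)

  moves-+ : ∀ {n} (C D : Vec A n → ℚ) v → moves w g (λ u → C u ⊕ D u) v ≡ moves w g C v ⊕ moves w g D v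
  moves-+ C D []      = refl
  moves-+ C D (x ∷ v) = trans (cong (w x ⊛ (C (g x ∷ v) ⊕ D (g x ∷ v)) ⊕_) (moves-+ _ _ v))
    (solve 5 (λ w a b c d → w :* (a :+ b) :+ (c :+ d) := (w :* a :+ c) :+ (w :* b :+ d)) refl (w x) (C (g x ∷ v)) (D (g x ∷ v)) _ _)

  moves-* : ∀ {n} c (C : Vec A n → ℚ) v → moves w g (λ u → c ⊛ C u) v ≡ c ⊛ moves w g C v
  moves-* c C []      = sym (ℚP.*-zeroʳ c)
  moves-* c C (x ∷ v) = trans (cong (w x ⊛ (c ⊛ C (g x ∷ v)) ⊕_) (moves-* c _ v))
    (solve 4 (λ w c a d → w :* (c :* a) :+ c :* d := c :* (w :* a :+ d)) refl (w x) c (C (g x ∷ v)) _)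

  moves-⊖ : ∀ {n} (C : Vec A n → ℚ) v → moves w g (λ u → ⊖ C u) v ≡ ⊖ moves w g C v
  moves-⊖ C []      = refl
  moves-⊖ C (x ∷ v) = trans (cong (w x ⊛ (⊖ C (g x ∷ v)) ⊕_) (moves-⊖ _ v))
    (solve 3 (λ w a d → w :* (:- a) :+ (:- d) := :- (w :* a :+ d)) refl (w x) (C (g x ∷ v)) _)

  moves-≡0 : ∀ {n} {C : Vec A n → ℚ} → (∀ u → C u ≡ 0ℚ) → ∀ v → moves w g C v ≡ 0ℚ
  moves-≡0 eq []      = refl
  moves-≡0 eq (x ∷ v) = 0+ (trans (cong (w x ⊛_) (eq (g x ∷ v))) (ℚP.*-zeroʳ (w x))) (moves-≡0 (λ u → eq (x ∷ u)) v)

  moves-antisym : ∀ {n} {C : Vec A n → ℚ} → Antisym C → Antisym (moves w g C)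
  moves-antisym {C = C} anti (swap x y v) = begin
    w x ⊛ C (g x ∷ y ∷ v) ⊕ (w y ⊛ C (x ∷ g y ∷ v) ⊕ moves w g (λ u → C (x ∷ y ∷ u)) v)
      ≡⟨ cong₂ (λ a b → w x ⊛ a ⊕ b) (anti (swap _ _ v)) (cong₂ (λ a b → w y ⊛ a ⊕ b) (anti (swap _ _ v))
           (trans (moves-cong (λ u → anti (swap x y u)) v) (moves-⊖ _ v))) ⟩
    w x ⊛ (⊖ C (y ∷ g x ∷ v)) ⊕ (w y ⊛ (⊖ C (g y ∷ x ∷ v)) ⊕ (⊖ moves w g (λ u → C (y ∷ x ∷ u)) v))
      ≡⟨ solve 5 (λ p q a b c → p :* (:- a) :+ (q :* (:- b) :+ (:- c)) := :- (q :* b :+ (p :* a :+ c))) refl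
           (w x) (w y) (C (y ∷ g x ∷ v)) (C (g y ∷ x ∷ v)) (moves w g (λ u → C (y ∷ x ∷ u)) v) ⟩
    ⊖ (w y ⊛ C (g y ∷ x ∷ v) ⊕ (w x ⊛ C (y ∷ g x ∷ v) ⊕ moves w g (λ u → C (y ∷ x ∷ u)) v)) ∎
  moves-antisym {C = C} anti (skip x {u} {v} u⇄v) = begin
    w x ⊛ C (g x ∷ u) ⊕ moves w g (λ t → C (x ∷ t)) u
      ≡⟨ cong₂ (λ a b → w x ⊛ a ⊕ b) (anti (skip (g x) u⇄v)) (moves-antisym (λ s → anti (skip x s)) u⇄v) ⟩
    w x ⊛ (⊖ C (g x ∷ v)) ⊕ (⊖ moves w g (λ t → C (x ∷ t)) v)
      ≡⟨ solve 3 (λ w a d → w :* (:- a) :+ (:- d) := :- (w :* a :+ d)) refl (w x) (C (g x ∷ v)) _ ⟩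
    ⊖ (w x ⊛ C (g x ∷ v) ⊕ moves w g (λ t → C (x ∷ t)) v) ∎

  moves-map : ∀ {B : Set} {w′ : B → ℚ} {g′ : B → B} (h : A → B) → (∀ x → w′ (h x) ≡ w x) → (∀ x → g′ (h x) ≡ h (g x)) →
    ∀ {n} (C : Vec B n → ℚ) v → moves w′ g′ C (Vec.map h v) ≡ moves w g (C ∘ Vec.map h) v
  moves-map h weq geq C []      = refl
  moves-map h weq geq C (x ∷ v) = cong₂ _⊕_ (cong₂ (λ a b → a ⊛ C (b ∷ Vec.map h v)) (weq x) (geq x)) (moves-map h weq geq _ v)

  total : (A → ℕ) → ∀ {n} → Vec A n → ℕ
  total μ v = Vec.sum (Vec.map μ v)

  -- Wherever its weight is non-zero a move changes the degree μ by b - a, so only the values of C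
  -- in one degree enter. The two naturals a and b express the change without subtraction.
  moves-degree : ∀ (μ : A → ℕ) a b → (∀ x → w x ≡ 0ℚ ⊎ μ (g x) ℕ.+ a ≡ μ x ℕ.+ b) →
    ∀ {n} {C : Vec A n → ℚ} v → (∀ u → total μ u ℕ.+ a ≡ total μ v ℕ.+ b → C u ≡ 0ℚ) → moves w g C v ≡ 0ℚ
  moves-degree μ a b h []      eq = refl
  moves-degree μ a b h {C = C} (x ∷ v) eq = 0+ (head (h x)) (moves-degree μ a b h v tail)
    where
    head : w x ≡ 0ℚ ⊎ μ (g x) ℕ.+ a ≡ μ x ℕ.+ b → w x ⊛ C (g x ∷ v) ≡ 0ℚ
    head (inj₁ w0)  = trans (cong (_⊛ C (g x ∷ v)) w0) (ℚP.*-zeroˡ (C (g x ∷ v)))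
    head (inj₂ deg) = trans (cong (w x ⊛_) (eq (g x ∷ v) degree)) (ℚP.*-zeroʳ (w x))
      where
      shuffle : ∀ p q r → (p ℕ.+ q) ℕ.+ r ≡ (p ℕ.+ r) ℕ.+ q
      shuffle p q r = trans (ℕP.+-assoc p q r) (trans (cong (p ℕ.+_) (ℕP.+-comm q r)) (sym (ℕP.+-assoc p r q)))
      degree : (μ (g x) ℕ.+ total μ v) ℕ.+ a ≡ (μ x ℕ.+ total μ v) ℕ.+ b
      degree = trans (shuffle (μ (g x)) (total μ v) a) (trans (cong (ℕ._+ total μ v) deg) (sym (shuffle (μ x) (total μ v) b)))
    tail : ∀ u → total μ u ℕ.+ a ≡ total μ v ℕ.+ b → C (x ∷ u) ≡ 0ℚ
    tail u e = eq (x ∷ u) (trans (ℕP.+-assoc (μ x) _ a) (trans (cong (μ x ℕ.+_) e) (sym (ℕP.+-assoc (μ x) _ b))))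

sumL-allFin : ∀ {n} (F : Fin (suc n) → ℚ) → sumL F (allFin (suc n)) ≡ F zero ⊕ sumL (F ∘ suc) (allFin n)
sumL-allFin {n} F = cong (F zero ⊕_) (go n id)
  where
  go : ∀ m (f : Fin m → Fin n) → sumL F (List.tabulate (suc ∘ f)) ≡ sumL (F ∘ suc) (List.tabulate f)
  go zero    f = refl
  go (suc m) f = cong (F (suc (f zero)) ⊕_) (go m (f ∘ suc))

moves-updateAt : ∀ {A : Set} {w : A → ℚ} {g : A → A} {n} (C : Vec A n → ℚ) v →
  moves w g C v ≡ sumL (λ i → w (lookup v i) ⊛ C (updateAt v i g)) (allFin n)
moves-updateAt C []      = refl
moves-updateAt {w = w} {g} C (x ∷ v) = trans (cong (w x ⊛ C (g x ∷ v) ⊕_) (moves-updateAt _ v))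
  (sym (sumL-allFin (λ i → w (lookup (x ∷ v) i) ⊛ C (updateAt (x ∷ v) i g))))

moves-one : ∀ {A : Set} {g : A → A} {n} (C : Vec A n → ℚ) v →
  moves one g C v ≡ sumL (λ i → C (updateAt v i g)) (allFin n)
moves-one {n = n} C v = trans (moves-updateAt C v) (sumL-cong (λ i → ℚP.*-identityˡ _) (allFin n))

-- The operators on the two sides commute up to the one-cell correction w₃, g₃.
moves-commute : ∀ {A : Set} {w₁ w₂ w₃ : A → ℚ} {g₁ g₂ g₃ : A → A} →
  (∀ x (K : A → ℚ) → w₁ x ⊛ (w₂ (g₁ x) ⊛ K (g₂ (g₁ x))) ≡ w₂ x ⊛ (w₁ (g₂ x) ⊛ K (g₁ (g₂ x))) ⊕ w₃ x ⊛ K (g₃ x)) →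
  ∀ {n} (C : Vec A n → ℚ) v →
  moves w₁ g₁ (moves w₂ g₂ C) v ≡ moves w₂ g₂ (moves w₁ g₁ C) v ⊕ moves w₃ g₃ C v
moves-commute local C [] = refl
moves-commute {w₁ = w₁} {w₂} {w₃} {g₁} {g₂} {g₃} local C (x ∷ v) = begin
  w₁ x ⊛ (c₁₂ ⊕ m₂) ⊕ moves w₁ g₁ (λ u → w₂ x ⊛ C (g₂ x ∷ u) ⊕ moves w₂ g₂ (λ t → C (x ∷ t)) u) v
    ≡⟨ cong (w₁ x ⊛ (c₁₂ ⊕ m₂) ⊕_) (trans (moves-+ _ _ v) (cong₂ _⊕_ (moves-* (w₂ x) _ v) (moves-commute local _ v))) ⟩
  w₁ x ⊛ (c₁₂ ⊕ m₂) ⊕ (w₂ x ⊛ m₁ ⊕ (m₂₁ ⊕ m₃))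
    ≡⟨ solve 7 (λ w₁ w₂ c m₁ m₂ m₂₁ m₃ → w₁ :* (c :+ m₂) :+ (w₂ :* m₁ :+ (m₂₁ :+ m₃)) := (w₁ :* c) :+ (w₂ :* m₁ :+ (w₁ :* m₂ :+ (m₂₁ :+ m₃)))) refl
        (w₁ x) (w₂ x) c₁₂ m₁ m₂ m₂₁ m₃ ⟩
  w₁ x ⊛ c₁₂ ⊕ (w₂ x ⊛ m₁ ⊕ (w₁ x ⊛ m₂ ⊕ (m₂₁ ⊕ m₃)))
    ≡⟨ cong (_⊕ (w₂ x ⊛ m₁ ⊕ (w₁ x ⊛ m₂ ⊕ (m₂₁ ⊕ m₃)))) (local x (λ y → C (y ∷ v))) ⟩
  (w₂ x ⊛ c₂₁ ⊕ c₃) ⊕ (w₂ x ⊛ m₁ ⊕ (w₁ x ⊛ m₂ ⊕ (m₂₁ ⊕ m₃)))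
    ≡⟨ solve 8 (λ w₁ w₂ c₂₁ c₃ m₁ m₂ m₂₁ m₃ → (w₂ :* c₂₁ :+ c₃) :+ (w₂ :* m₁ :+ (w₁ :* m₂ :+ (m₂₁ :+ m₃))) :=
          (w₂ :* (c₂₁ :+ m₁) :+ (w₁ :* m₂ :+ m₂₁)) :+ (c₃ :+ m₃)) refl (w₁ x) (w₂ x) c₂₁ c₃ m₁ m₂ m₂₁ m₃ ⟩
  (w₂ x ⊛ (c₂₁ ⊕ m₁) ⊕ (w₁ x ⊛ m₂ ⊕ m₂₁)) ⊕ (c₃ ⊕ m₃)
    ≡⟨ cong (λ z → (w₂ x ⊛ (c₂₁ ⊕ m₁) ⊕ z) ⊕ (c₃ ⊕ m₃)) (trans (moves-+ _ _ v) (cong (_⊕ m₂₁) (moves-* (w₁ x) _ v))) ⟨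
  (w₂ x ⊛ (c₂₁ ⊕ m₁) ⊕ moves w₂ g₂ (λ u → w₁ x ⊛ C (g₁ x ∷ u) ⊕ moves w₁ g₁ (λ t → C (x ∷ t)) u) v) ⊕ (c₃ ⊕ m₃) ∎
  where
  c₁₂ = w₂ (g₁ x) ⊛ C (g₂ (g₁ x) ∷ v)
  c₂₁ = w₁ (g₂ x) ⊛ C (g₁ (g₂ x) ∷ v)
  c₃ = w₃ x ⊛ C (g₃ x ∷ v)
  m₁ = moves w₁ g₁ (λ u → C (g₂ x ∷ u)) v
  m₂ = moves w₂ g₂ (λ u → C (g₁ x ∷ u)) v
  m₂₁ = moves w₂ g₂ (moves w₁ g₁ (λ t → C (x ∷ t))) v
  m₃ = moves w₃ g₃ (λ t → C (x ∷ t)) v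

-- Functions of exponent vectors killed by all power sums

incr : ∀ {n} → Fin n → Vec ℕ n → Vec ℕ n
incr i v = updateAt v i suc

incr-comm : ∀ {n} (i j : Fin n) v → incr i (incr j v) ≡ incr j (incr i v)
incr-comm i j v with i Fin.≟ j
... | yes refl = refl
... | no i≢j   = VecP.updateAt-commutes i j i≢j v

open module Incr {n} = Newton (incr {n}) incr-comm

iter-updateAt : ∀ {A : Set} {n} (i : Fin n) a {h : A → A} (v : Vec A n) →
  iter a (λ u → updateAt u i h) v ≡ updateAt v i (iter a h)
iter-updateAt i zero    v = sym (VecP.updateAt-id i v)
iter-updateAt i (suc a) {h} v = trans (cong (λ u → updateAt u i h) (iter-updateAt i a v)) (VecP.updateAt-updateAt i v)

iter-suc : ∀ a x → iter a suc x ≡ a ℕ.+ x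
iter-suc zero    x = refl
iter-suc (suc a) x = cong suc (iter-suc a x)

iter-incr : ∀ {n} a (i : Fin n) v → iter a (incr i) v ≡ updateAt v i (a ℕ.+_)
iter-incr a i v = trans (iter-updateAt i a v) (VecP.updateAt-cong i (iter-suc a) v)

HarmonicX : ∀ {n} → (Vec ℕ n → ℚ) → Set
HarmonicX f = ∀ a v → moves one (suc a ℕ.+_) f v ≡ 0ℚ

harmonic-powers : ∀ {n} {f : Vec ℕ n → ℚ} → HarmonicX f → PowersKill (allFin n) f
harmonic-powers {n} {f} h = powersKill λ a v → trans (sumL-cong (λ i → cong f (iter-incr (suc a) i v)) (allFin n))
  (trans (sym (moves-one f v)) (h a v))

shiftAll-allFin : ∀ {n} (v : Vec ℕ n) → shiftAll (allFin n) v ≡ Vec.map suc v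
shiftAll-allFin []      = refl
shiftAll-allFin {suc n} (x ∷ v) = trans (tabulate-suc n (λ i → i) v) (cong (suc x ∷_) (shiftAll-allFin v))
  where
  tabulate-suc : ∀ m (f : Fin m → Fin n) v → shiftAll (List.tabulate (suc ∘ f)) (suc x ∷ v) ≡ suc x ∷ shiftAll (List.tabulate f) v
  tabulate-suc zero    f v = refl
  tabulate-suc (suc m) f v = tabulate-suc m (f ∘ suc) (incr (f zero) v)

-- The product ∂x₁ ⋯ ∂xₙ is the top elementary symmetric polynomial in the derivatives, hence kills
-- f; on exponents it raises every entry by one.
harmonic-positive : ∀ {n} {f : Vec ℕ (suc n) → ℚ} → HarmonicX f → ∀ v → f (Vec.map suc v) ≡ 0ℚ
harmonic-positive {f = f} h v = trans (cong f (sym (shiftAll-allFin v))) (shiftAll≡0 (harmonic-powers h) v)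

staircase : ∀ m → Vec ℕ m
staircase zero    = []
staircase (suc m) = 0 ∷ Vec.map suc (staircase m)

staircase-∋ : ∀ {m x} → x ≤ m → ∃ λ v → staircase (suc m) ⇄* x ∷ v
staircase-∋ {m}     {zero}  _         = Vec.map suc (staircase m) , ε
staircase-∋ {suc m} {suc x} (ℕ.s≤s h) with staircase-∋ h
... | v , p = 0 ∷ Vec.map suc v , ⇄*-skip 0 (⇄*-map suc p) ◅◅ (swap 0 (suc x) (Vec.map suc v) ◅ ε)

positive-or-zero : ∀ {n} (v : Vec ℕ (suc n)) → (∃ λ u → v ≡ Vec.map suc u) ⊎ (∃ λ u → v ⇄* 0 ∷ u)
positive-or-zero (zero ∷ v)           = inj₂ (v , ε)
positive-or-zero (suc x ∷ [])         = inj₁ (x ∷ [] , refl)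
positive-or-zero (suc x ∷ v@(_ ∷ _))  with positive-or-zero v
... | inj₁ (u , eq) = inj₁ (x ∷ u , cong (suc x ∷_) eq)
... | inj₂ (u , p)  = inj₂ (suc x ∷ u , ⇄*-skip (suc x) p ◅◅ (swap (suc x) 0 u ◅ ε))

-- A non-zero value needs an entry 0, by `harmonic-positive`, and only one, by antisymmetry.
-- Removing it and lowering the other entries by one gives a function of one variable fewer that is
-- again harmonic: in the power sum of f, the summand that moves the 0 has only positive entries and
-- vanishes. The staircase loses its 0 in the same way and becomes the next smaller staircase.
antisym-harmonic≡0 : ∀ {m} {f : Vec ℕ m → ℚ} → Antisym f → HarmonicX f → f (staircase m) ≡ 0ℚ → ∀ v → f v ≡ 0ℚ
antisym-harmonic≡0 {zero}  anti harm eq [] = eq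
antisym-harmonic≡0 {suc m} {f} anti harm eq v with positive-or-zero v
... | inj₁ (u , refl) = harmonic-positive harm u
... | inj₂ (u , p)    = antisym-≡0 anti p (zero-head anti ih u)
  where
  peeled : Vec ℕ m → ℚ
  peeled u = f (0 ∷ Vec.map suc u)
  peeled-harm : HarmonicX peeled
  peeled-harm a u = begin
    moves one (suc a ℕ.+_) peeled u
      ≡⟨ moves-map suc (λ _ → refl) (ℕP.+-suc (suc a)) (λ t → f (0 ∷ t)) u ⟨
    moves one (suc a ℕ.+_) (λ t → f (0 ∷ t)) (Vec.map suc u)
      ≡⟨ ℚP.+-identityˡ _ ⟨
    0ℚ ⊕ moves one (suc a ℕ.+_) (λ t → f (0 ∷ t)) (Vec.map suc u)
      ≡⟨ cong (_⊕ moves one (suc a ℕ.+_) (λ t → f (0 ∷ t)) (Vec.map suc u)) (trans (ℚP.*-identityˡ _) (harmonic-positive harm (a ℕ.+ 0 ∷ u))) ⟨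
    moves one (suc a ℕ.+_) f (0 ∷ Vec.map suc u)
      ≡⟨ harm a (0 ∷ Vec.map suc u) ⟩
    0ℚ ∎
  ih : ∀ u → peeled u ≡ 0ℚ
  ih = antisym-harmonic≡0 {m} (λ s → anti (skip 0 (⇄-map suc s))) peeled-harm eq
  zero-head : ∀ {k} {g : Vec ℕ (suc k) → ℚ} → Antisym g → (∀ u → g (0 ∷ Vec.map suc u) ≡ 0ℚ) → ∀ u → g (0 ∷ u) ≡ 0ℚ
  zero-head anti ih [] = ih []
  zero-head {g = g} anti ih u@(_ ∷ _) with positive-or-zero u
  ... | inj₁ (t , u≡) = trans (cong (λ z → g (0 ∷ z)) u≡) (ih t)
  ... | inj₂ (t , p)  = antisym-repeat anti p

-- Coefficient functions of alternating harmonic polynomials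

Cell : Set
Cell = ℕ × ℕ

shift : ℕ → ℕ → Cell → Cell
shift a b (p , q) = a ℕ.+ p , b ℕ.+ q

lower : ℕ → Cell → Cell
lower a (p , q) = a ℕ.+ p , q ∸ 1

yWeight : Cell → ℚ
yWeight (p , q) = nℚ q

-- E_a on divided-power coefficients: multiplication by yᵢ carries the coefficient at exponent q - 1
-- to exponent q and multiplies it by q. At q = 0 the weight vanishes, so the truncation in `lower`
-- does no harm.
polarize : ∀ {n} → ℕ → (Vec Cell n → ℚ) → Vec Cell n → ℚ
polarize a = moves yWeight (lower a)

xDegree yDegree : ∀ {n} → Vec Cell n → ℕ
xDegree v = Vec.sum (Vec.map proj₁ v)
yDegree v = Vec.sum (Vec.map proj₂ v)

flat : ℕ → Cell
flat x = x , 0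

triangle : ℕ → ℕ
triangle n = Vec.sum (staircase n)

-- The coefficient functions of the elements of A_n^{k,l}.
record Alternant {n : ℕ} (k l : ℕ) (C : Vec Cell n → ℚ) : Set where
  field
    harmonic : ∀ a b → 0 < a ℕ.+ b → ∀ v → moves one (shift a b) C v ≡ 0ℚ
    antisym  : Antisym C
    x-degree : ∀ v → k ℕ.+ xDegree v ≢ triangle n → C v ≡ 0ℚ
    y-degree : ∀ v → yDegree v ≢ l → C v ≡ 0ℚ
open Alternant

moves-constant : ∀ {A : Set} {g : A → A} c {n} (C : Vec A n → ℚ) v → moves (λ _ → c) g C v ≡ c ⊛ moves one g C v
moves-constant c C []      = sym (ℚP.*-zeroʳ c)
moves-constant {g = g} c C (x ∷ v) = trans (cong (c ⊛ C (g x ∷ v) ⊕_) (moves-constant c _ v))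
  (solve 3 (λ c a m → c :* a :+ c :* m := c :* (con 1ℚ :* a :+ m)) refl c (C (g x ∷ v)) _)

+-left-comm : ∀ a b c → a ℕ.+ (b ℕ.+ c) ≡ b ℕ.+ (a ℕ.+ c)
+-left-comm a b c = trans (sym (ℕP.+-assoc a b c)) (trans (cong (ℕ._+ c) (ℕP.+-comm a b)) (ℕP.+-assoc b a c))

-- The commutator of Σ ∂x^c ∂y^d with E_(a+1) is d Σ ∂x^(c+a+1) ∂y^(d-1), again one of the operators
-- that kill C: its order in x is positive, even for c = 0 and d = 1.
polarize-harmonic : ∀ {n} a {C : Vec Cell n → ℚ} → (∀ c d → 0 < c ℕ.+ d → ∀ v → moves one (shift c d) C v ≡ 0ℚ) →
  ∀ c d → 0 < c ℕ.+ d → ∀ v → moves one (shift c d) (polarize (suc a) C) v ≡ 0ℚ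
polarize-harmonic a {C} harm c zero c>0 v = trans
  (moves-commute {w₃ = λ _ → 0ℚ} {g₃ = id} local C v)
  (0+ (moves-≡0 (harm c 0 c>0) v) (trans (moves-constant 0ℚ C v) (ℚP.*-zeroˡ (moves one id C v))))
  where
  local : ∀ x K → one x ⊛ (yWeight (shift c 0 x) ⊛ K (lower (suc a) (shift c 0 x))) ≡
    yWeight x ⊛ (one (lower (suc a) x) ⊛ K (shift c 0 (lower (suc a) x))) ⊕ 0ℚ ⊛ K x
  local x@(p , q) K = trans
    (cong (λ r → 1ℚ ⊛ (nℚ q ⊛ K (r , q ∸ 1))) (+-left-comm (suc a) c p))
    (solve 3 (λ w k j → con 1ℚ :* (w :* k) := w :* (con 1ℚ :* k) :+ con 0ℚ :* j) refl (nℚ q) (K (c ℕ.+ (suc a ℕ.+ p) , q ∸ 1)) (K x))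
polarize-harmonic a {C} harm c (suc d) _ v = trans
  (moves-commute {w₃ = λ _ → nℚ (suc d)} {g₃ = shift (c ℕ.+ suc a) d} local C v)
  (0+ (moves-≡0 (harm c (suc d) (ℕP.<-≤-trans (ℕ.s≤s ℕ.z≤n) (ℕP.m≤n+m (suc d) c))) v)
      (trans (moves-constant (nℚ (suc d)) C v)
        (trans (cong (nℚ (suc d) ⊛_) (harm (c ℕ.+ suc a) d positive v)) (ℚP.*-zeroʳ (nℚ (suc d))))))
  where
  positive : 0 < c ℕ.+ suc a ℕ.+ d
  positive = ℕP.<-≤-trans (ℕ.s≤s ℕ.z≤n) (ℕP.≤-trans (ℕP.m≤n+m (suc a) c) (ℕP.m≤m+n _ d))
  x-eq : ∀ p → suc a ℕ.+ (c ℕ.+ p) ≡ c ℕ.+ suc a ℕ.+ p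
  x-eq p = trans (+-left-comm (suc a) c p) (sym (ℕP.+-assoc c (suc a) p))
  local : ∀ x K → one x ⊛ (yWeight (shift c (suc d) x) ⊛ K (lower (suc a) (shift c (suc d) x))) ≡
    yWeight x ⊛ (one (lower (suc a) x) ⊛ K (shift c (suc d) (lower (suc a) x))) ⊕ nℚ (suc d) ⊛ K (shift (c ℕ.+ suc a) d x)
  local (p , zero) K = begin
    1ℚ ⊛ (nℚ (suc d ℕ.+ 0) ⊛ K (suc a ℕ.+ (c ℕ.+ p) , d ℕ.+ 0))
      ≡⟨ cong₂ (λ w r → 1ℚ ⊛ (w ⊛ K (r , d ℕ.+ 0))) (cong nℚ (ℕP.+-identityʳ (suc d))) (x-eq p) ⟩
    1ℚ ⊛ (nℚ (suc d) ⊛ k)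
      ≡⟨ solve 3 (λ w k j → con 1ℚ :* (w :* k) := con 0ℚ :* (con 1ℚ :* j) :+ w :* k) refl (nℚ (suc d)) k (K (shift c (suc d) (lower (suc a) (p , 0)))) ⟩
    0ℚ ⊛ (1ℚ ⊛ K (shift c (suc d) (lower (suc a) (p , 0)))) ⊕ nℚ (suc d) ⊛ k ∎
    where k = K (c ℕ.+ suc a ℕ.+ p , d ℕ.+ 0)
  local (p , suc q) K = begin
    1ℚ ⊛ (nℚ (suc d ℕ.+ suc q) ⊛ K (suc a ℕ.+ (c ℕ.+ p) , d ℕ.+ suc q))
      ≡⟨ cong₂ (λ w r → 1ℚ ⊛ (w ⊛ K (r , d ℕ.+ suc q))) (nℚ-+ (suc d) (suc q)) (x-eq p) ⟩
    1ℚ ⊛ ((nℚ (suc d) ⊕ nℚ (suc q)) ⊛ k)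
      ≡⟨ solve 3 (λ w w′ k → con 1ℚ :* ((w :+ w′) :* k) := w′ :* (con 1ℚ :* k) :+ w :* k) refl (nℚ (suc d)) (nℚ (suc q)) k ⟩
    nℚ (suc q) ⊛ (1ℚ ⊛ k) ⊕ nℚ (suc d) ⊛ k
      ≡⟨ cong (λ z → nℚ (suc q) ⊛ (1ℚ ⊛ K z) ⊕ nℚ (suc d) ⊛ k) (cong₂ _,_ (ℕP.+-assoc c (suc a) p) (ℕP.+-suc d q)) ⟩
    nℚ (suc q) ⊛ (1ℚ ⊛ K (c ℕ.+ (suc a ℕ.+ p) , suc d ℕ.+ q)) ⊕ nℚ (suc d) ⊛ k ∎
    where k = K (c ℕ.+ suc a ℕ.+ p , d ℕ.+ suc q)

polarize-alternant : ∀ {n k l} a {C : Vec Cell n → ℚ} → Alternant k l C → Alternant (suc a ℕ.+ k) (suc l) (polarize (suc a) C)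
polarize-alternant {k = k} a {C} A = record
  { harmonic = polarize-harmonic a (A .harmonic)
  ; antisym  = moves-antisym (A .antisym)
  ; x-degree = λ v ≢d → moves-degree proj₁ 0 (suc a)
      (λ (p , q) → inj₂ (trans (ℕP.+-identityʳ _) (ℕP.+-comm (suc a) p))) v
      (λ u eq → A .x-degree u λ u≡ → ≢d (trans (ℕP.+-comm (suc a ℕ.+ k) _) (trans (cong (xDegree v ℕ.+_) (ℕP.+-comm (suc a) k))
        (trans (+-left-comm (xDegree v) k (suc a)) (trans (cong (k ℕ.+_) (sym (trans (sym (ℕP.+-identityʳ _)) eq))) u≡)))))
  ; y-degree = λ v ≢l → moves-degree proj₂ 1 0 y-step v
      (λ u eq → A .y-degree u λ u≡ → ≢l (trans (sym (ℕP.+-identityʳ _)) (trans (sym eq) (trans (ℕP.+-comm _ 1) (cong suc u≡)))))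
  }
  where
  y-step : ∀ (x : Cell) → yWeight x ≡ 0ℚ ⊎ proj₂ (lower (suc a) x) ℕ.+ 1 ≡ proj₂ x ℕ.+ 0
  y-step (p , zero)  = inj₁ refl
  y-step (p , suc q) = inj₂ (trans (ℕP.+-comm q 1) (sym (ℕP.+-identityʳ (suc q))))

polarize-flat : ∀ {n} a (C : Vec Cell n → ℚ) e → polarize a C (Vec.map flat e) ≡ 0ℚ
polarize-flat a C []      = refl
polarize-flat a C (x ∷ e) = 0+ (ℚP.*-zeroˡ (C ((a ℕ.+ x , 0) ∷ Vec.map flat e))) (polarize-flat a (λ u → C (flat x ∷ u)) e)

-- The y-exponents 1, 1, 0, ... force the two operators to act on different ones of the first two
-- cells; every other summand has weight 0.
polarize-twice : ∀ {m} a b (C : Vec Cell (2 ℕ.+ m) → ℚ) p q e → let z = Vec.map flat e in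
  polarize a (polarize b C) ((p , 1) ∷ (q , 1) ∷ z) ≡
    C ((a ℕ.+ p , 0) ∷ (b ℕ.+ q , 0) ∷ z) ⊕ C ((b ℕ.+ p , 0) ∷ (a ℕ.+ q , 0) ∷ z)
polarize-twice a b C p q e = begin
  1ℚ ⊛ (0ℚ ⊛ i ⊕ (1ℚ ⊛ j ⊕ polarize b _ z)) ⊕ (1ℚ ⊛ (1ℚ ⊛ k ⊕ (0ℚ ⊛ l ⊕ polarize b _ z)) ⊕ polarize a _ z)
    ≡⟨ cong₂ (λ s t → 1ℚ ⊛ (0ℚ ⊛ i ⊕ (1ℚ ⊛ j ⊕ s)) ⊕ t) (polarize-flat b _ e)
        (cong₂ (λ s t → 1ℚ ⊛ (1ℚ ⊛ k ⊕ (0ℚ ⊛ l ⊕ s)) ⊕ t) (polarize-flat b _ e) (polarize-flat a _ e)) ⟩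
  1ℚ ⊛ (0ℚ ⊛ i ⊕ (1ℚ ⊛ j ⊕ 0ℚ)) ⊕ (1ℚ ⊛ (1ℚ ⊛ k ⊕ (0ℚ ⊛ l ⊕ 0ℚ)) ⊕ 0ℚ)
    ≡⟨ solve 4 (λ i j k l → con 1ℚ :* (con 0ℚ :* i :+ (con 1ℚ :* j :+ con 0ℚ)) :+ (con 1ℚ :* (con 1ℚ :* k :+ (con 0ℚ :* l :+ con 0ℚ)) :+ con 0ℚ) := j :+ k) refl i j k l ⟩
  j ⊕ k ∎
  where
  z = Vec.map flat e
  i = C ((b ℕ.+ (a ℕ.+ p) , 0) ∷ (q , 1) ∷ z)
  j = C ((a ℕ.+ p , 0) ∷ (b ℕ.+ q , 0) ∷ z)
  k = C ((b ℕ.+ p , 0) ∷ (a ℕ.+ q , 0) ∷ z)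
  l = C ((p , 1) ∷ (b ℕ.+ (a ℕ.+ q) , 0 ∸ 1) ∷ z)

-- In the harmonicity condition of f, the summands that move one of the first two entries have
-- larger p + q and vanish by the descending induction, which starts beyond the degree bound N. What
-- remains says that f (p ∷ q ∷ e) is harmonic in e, so `antisym-harmonic≡0` applies to it.
antisym-staircase : ∀ {m N} {f : Vec ℕ (2 ℕ.+ m) → ℚ} → HarmonicX f → (∀ p q → Antisym (λ e → f (p ∷ q ∷ e))) →
  (∀ v → N < Vec.sum v → f v ≡ 0ℚ) → (∀ p q → f (p ∷ q ∷ staircase m) ≡ 0ℚ) → ∀ v → f v ≡ 0ℚ
antisym-staircase {m} {N} {f} harm anti bounded stair (p ∷ q ∷ e) =
  descend (suc N) p q (ℕP.m≤n+m (suc N) (p ℕ.+ q)) e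
  where
  descend : ∀ t p q → N < p ℕ.+ q ℕ.+ t → ∀ e → f (p ∷ q ∷ e) ≡ 0ℚ
  descend zero p q N< e = bounded (p ∷ q ∷ e)
    (ℕP.<-≤-trans (subst (N <_) (ℕP.+-identityʳ (p ℕ.+ q)) N<) (ℕP.+-monoʳ-≤ p (ℕP.m≤m+n q (Vec.sum e))))
  descend (suc t) p q N< = antisym-harmonic≡0 (anti p q) tail-harmonic (stair p q)
    where
    N<₁ : ∀ a → N < (suc a ℕ.+ p) ℕ.+ q ℕ.+ t
    N<₁ a = ℕP.<-≤-trans (subst (N <_) (ℕP.+-suc (p ℕ.+ q) t) N<)
      (ℕ.s≤s (ℕP.+-monoˡ-≤ t (ℕP.+-monoˡ-≤ q (ℕP.m≤n+m p a))))
    N<₂ : ∀ a → N < p ℕ.+ (suc a ℕ.+ q) ℕ.+ t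
    N<₂ a = subst (N <_) (cong (ℕ._+ t) (trans (ℕP.+-assoc (suc a) p q) (+-left-comm (suc a) p q))) (N<₁ a)
    tail-harmonic : HarmonicX (λ e → f (p ∷ q ∷ e))
    tail-harmonic a e = begin
      rest
        ≡⟨ solve 1 (λ r → r := con 1ℚ :* con 0ℚ :+ (con 1ℚ :* con 0ℚ :+ r)) refl rest ⟩
      1ℚ ⊛ 0ℚ ⊕ (1ℚ ⊛ 0ℚ ⊕ rest)
        ≡⟨ cong₂ (λ i j → 1ℚ ⊛ i ⊕ (1ℚ ⊛ j ⊕ rest)) (descend t (suc a ℕ.+ p) q (N<₁ a) e) (descend t p (suc a ℕ.+ q) (N<₂ a) e) ⟨
      moves one (suc a ℕ.+_) f (p ∷ q ∷ e)
        ≡⟨ harm a (p ∷ q ∷ e) ⟩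
      0ℚ ∎
      where rest = moves one (suc a ℕ.+_) (λ e → f (p ∷ q ∷ e)) e

moves-zip : ∀ {n} a (C : Vec Cell n → ℚ) x y →
  moves one (a ℕ.+_) (λ u → C (Vec.zip u y)) x ≡ moves one (shift a 0) C (Vec.zip x y)
moves-zip a C []      []      = refl
moves-zip a C (p ∷ x) (q ∷ y) = cong (1ℚ ⊛ C ((a ℕ.+ p , q) ∷ Vec.zip x y) ⊕_) (moves-zip a _ x y)

updateAt-zip : ∀ {n} a b (i : Fin n) (x y : Vec ℕ n) →
  updateAt (Vec.zip x y) i (shift a b) ≡ Vec.zip (updateAt x i (a ℕ.+_)) (updateAt y i (b ℕ.+_))
updateAt-zip a b zero    (p ∷ x) (q ∷ y) = refl
updateAt-zip a b (suc i) (p ∷ x) (q ∷ y) = cong ((p , q) ∷_) (updateAt-zip a b i x y)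

zip-flat : ∀ {n} (e : Vec ℕ n) → Vec.zip e (Vec.replicate n 0) ≡ Vec.map flat e
zip-flat []      = refl
zip-flat (x ∷ e) = cong (flat x ∷_) (zip-flat e)

yDegree-extract : ∀ {n s} (v : Vec Cell (suc n)) → yDegree v ≡ suc s →
  ∃ λ p → ∃ λ q → ∃ λ u → (v ⇄* (p , suc q) ∷ u) × (q ℕ.+ yDegree u ≡ s)
yDegree-extract ((p , suc q) ∷ v) eq = p , q , v , ε , ℕP.suc-injective eq
yDegree-extract ((p , zero) ∷ v@(_ ∷ _)) eq with yDegree-extract v eq
... | p′ , q′ , u , path , eq′ = p′ , q′ , (p , 0) ∷ u , ⇄*-skip (p , 0) path ◅◅ (swap _ _ u ◅ ε) , eq′

yDegree-0 : ∀ {n} (v : Vec Cell n) → yDegree v ≡ 0 → v ≡ Vec.map flat (Vec.map proj₁ v)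
yDegree-0 []               eq = refl
yDegree-0 ((p , zero) ∷ v) eq = cong ((p , 0) ∷_) (yDegree-0 v eq)

yDegree-flat : ∀ {n} (e : Vec ℕ n) → yDegree (Vec.map flat e) ≡ 0
yDegree-flat []      = refl
yDegree-flat (x ∷ e) = yDegree-flat e

probe : ∀ {m} → (Vec Cell (2 ℕ.+ m) → ℚ) → ℕ → ℕ → ℚ
probe {m} C p q = C ((p , 1) ∷ (q , 1) ∷ Vec.map flat (staircase m))

module Uniqueness {m N} {C : Vec Cell (2 ℕ.+ m) → ℚ}
  (harm : ∀ a b → 0 < a ℕ.+ b → ∀ v → moves one (shift a b) C v ≡ 0ℚ) (anti : Antisym C)
  (bounded : ∀ v → N < xDegree v → C v ≡ 0ℚ) (y-deg : ∀ v → yDegree v ≢ 2 → C v ≡ 0ℚ) where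

  y₀ : Vec ℕ (2 ℕ.+ m)
  y₀ = 0 ∷ 1 ∷ Vec.replicate m 0

  -- The x-part of the coefficient of y₂ yᵢ, and of y₂² / 2 for i the second variable.
  part : Fin (2 ℕ.+ m) → Vec ℕ (2 ℕ.+ m) → ℚ
  part i x = C (Vec.zip x (incr i y₀))

  part-harmonic : ∀ i → HarmonicX (part i)
  part-harmonic i a x = trans (moves-zip (suc a) C x (incr i y₀)) (harm (suc a) 0 (ℕ.s≤s ℕ.z≤n) (Vec.zip x (incr i y₀)))

  part-zero : ∀ p q e → part zero (p ∷ q ∷ e) ≡ C ((p , 1) ∷ (q , 1) ∷ Vec.map flat e)
  part-zero p q e = cong (λ z → C ((p , 1) ∷ (q , 1) ∷ z)) (zip-flat e)

  -- The coefficient of y₂ in Σᵢ ∂xᵢᵃ∂yᵢ P = 0 is Σᵢ ∂xᵢᵃ (part i) = 0 for every a ≥ 0, as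
  -- `power-bound` asks. The exponent suc m = n - 1 is the number of variables other than the first.
  head-bound : ∀ p q e → C ((suc m ℕ.+ p , 1) ∷ (q , 1) ∷ Vec.map flat e) ≡ 0ℚ
  head-bound p q e = begin
    C ((suc m ℕ.+ p , 1) ∷ (q , 1) ∷ Vec.map flat e)   ≡⟨ part-zero (suc m ℕ.+ p) q e ⟨
    part zero (updateAt (p ∷ q ∷ e) zero (suc m ℕ.+_))  ≡⟨ cong (part zero) (iter-incr (suc m) zero (p ∷ q ∷ e)) ⟨
    part zero (iter (suc m) (incr zero) (p ∷ q ∷ e))    ≡⟨ cong (λ r → part zero (iter r (incr zero) (p ∷ q ∷ e))) (ListP.length-tabulate {n = suc m} suc) ⟨
    part zero (iter (length (List.tabulate {n = suc m} suc)) (incr zero) (p ∷ q ∷ e))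
      ≡⟨ power-bound zero (List.tabulate suc) part (harmonic-powers (part-harmonic zero)) sum-parts (p ∷ q ∷ e) ⟩
    0ℚ ∎
    where
    sum-parts : ∀ a x → sumL (λ i → part i (iter a (incr i) x)) (allFin (2 ℕ.+ m)) ≡ 0ℚ
    sum-parts a x = begin
      sumL (λ i → part i (iter a (incr i) x)) (allFin (2 ℕ.+ m))
        ≡⟨ sumL-cong (λ i → cong C (trans (cong (λ u → Vec.zip u (incr i y₀)) (iter-incr a i x)) (sym (updateAt-zip a 1 i x y₀)))) (allFin (2 ℕ.+ m)) ⟩
      sumL (λ i → C (updateAt (Vec.zip x y₀) i (shift a 1))) (allFin (2 ℕ.+ m))
        ≡⟨ moves-one C (Vec.zip x y₀) ⟨
      moves one (shift a 1) C (Vec.zip x y₀)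
        ≡⟨ harm a 1 (subst (0 <_) (ℕP.+-comm 1 a) (ℕ.s≤s ℕ.z≤n)) (Vec.zip x y₀) ⟩
      0ℚ ∎

  module _ (tests : ∀ p q → q < p → p ≤ m → probe C p q ≡ 0ℚ) where

    descending : ∀ p q → q < p → probe C p q ≡ 0ℚ
    descending p q q<p with p ℕ.≤? m
    ... | yes p≤m = tests p q q<p p≤m
    ... | no p≰m with ℕP.m≤n⇒∃[o]m+o≡n (ℕP.≰⇒> p≰m)
    ...   | o , refl = head-bound o q (staircase m)

    probes : ∀ p q → probe C p q ≡ 0ℚ
    probes p q with ℕP.<-cmp p q
    ... | tri< p<q _ _  = antisym-≡0 anti (swap _ _ _ ◅ ε) (descending q p p<q)
    ... | tri≈ _ refl _ = antisym-repeat anti ε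
    ... | tri> _ _ q<p  = descending p q q<p

    y₁y₂-part : ∀ p q e → C ((p , 1) ∷ (q , 1) ∷ Vec.map flat e) ≡ 0ℚ
    y₁y₂-part p q e = trans (sym (part-zero p q e)) (antisym-staircase {N = N} (part-harmonic zero)
      (λ p q {u} {v} s → trans (part-zero p q u) (trans (anti (skip _ (skip _ (⇄-map flat s)))) (cong ⊖_ (sym (part-zero p q v)))))
      (λ v N< → bounded _ (subst (N <_) (cong Vec.sum (sym (VecP.map-proj₁-zip v _))) N<))
      (λ p q → trans (part-zero p q (staircase m)) (probes p q)) (p ∷ q ∷ e))

    linear-head : ∀ p v → yDegree v ≡ 1 → C ((p , 1) ∷ v) ≡ 0ℚ
    linear-head p v eq with yDegree-extract v eq
    ... | p′ , zero , u , path , eq′ = antisym-≡0 anti (⇄*-skip _ path)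
      (trans (cong (λ z → C ((p , 1) ∷ (p′ , 1) ∷ z)) (yDegree-0 u eq′)) (y₁y₂-part p p′ _))

    square-head : ∀ p e → C ((p , 2) ∷ Vec.map flat e) ≡ 0ℚ
    square-head p e = begin
      C ((p , 2) ∷ Vec.map flat e)                 ≡⟨ solve 1 (λ a → a := con 1ℚ :* a :+ con 0ℚ) refl _ ⟩
      1ℚ ⊛ C ((p , 2) ∷ Vec.map flat e) ⊕ 0ℚ       ≡⟨ cong (1ℚ ⊛ C ((p , 2) ∷ Vec.map flat e) ⊕_) rest ⟨
      moves one (shift 0 1) C ((p , 1) ∷ Vec.map flat e) ≡⟨ harm 0 1 (ℕ.s≤s ℕ.z≤n) ((p , 1) ∷ Vec.map flat e) ⟩
      0ℚ ∎
      where
      rest : moves one (shift 0 1) (λ u → C ((p , 1) ∷ u)) (Vec.map flat e) ≡ 0ℚ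
      rest = moves-degree proj₂ 0 1 (λ (_ , q) → inj₂ (trans (ℕP.+-identityʳ (suc q)) (ℕP.+-comm 1 q))) (Vec.map flat e)
        (λ u eq → linear-head p u (trans (sym (ℕP.+-identityʳ _)) (trans eq (cong (ℕ._+ 1) (yDegree-flat e)))))

    unique : ∀ v → C v ≡ 0ℚ
    unique v with yDegree v ℕ.≟ 2
    ... | no ≢2 = y-deg v ≢2
    ... | yes ≡2 with yDegree-extract v ≡2
    ...   | p , zero        , u , path , eq = antisym-≡0 anti path (linear-head p u eq)
    ...   | p , suc zero    , u , path , eq = antisym-≡0 anti path
              (trans (cong (λ z → C ((p , 2) ∷ z)) (yDegree-0 u (ℕP.suc-injective eq))) (square-head p _))
    ...   | p , suc (suc q) , u , path , ()

-- Coefficients of polynomials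

termCoeff : ∀ {n} → Term n → Vec ℕ n → Vec ℕ n → ℚ
termCoeff (c , a′ , b′) a b = if ⌊ VecP.≡-dec ℕ._≟_ a′ a ⌋ then (if ⌊ VecP.≡-dec ℕ._≟_ b′ b ⌋ then c else 0ℚ) else 0ℚ

At : ∀ {n} → Term n → Vec ℕ n → Vec ℕ n → Set
At (_ , a′ , b′) a b = a′ ≡ a × b′ ≡ b

termCoeff-yes : ∀ {n} (t : Term n) {a b} → At t a b → termCoeff t a b ≡ proj₁ t
termCoeff-yes (c , a , b) (refl , refl) with VecP.≡-dec ℕ._≟_ a a | VecP.≡-dec ℕ._≟_ b b
... | yes _ | yes _ = refl
... | no a≢ | _     = contradiction refl a≢
... | yes _ | no b≢ = contradiction refl b≢

termCoeff-no : ∀ {n} (t : Term n) {a b} → ¬ At t a b → termCoeff t a b ≡ 0ℚ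
termCoeff-no (c , a′ , b′) {a} {b} no-at with VecP.≡-dec ℕ._≟_ a′ a
... | no _ = refl
... | yes refl with VecP.≡-dec ℕ._≟_ b′ b
...   | no _ = refl
...   | yes refl = contradiction (refl , refl) no-at

At? : ∀ {n} (t : Term n) a b → Dec (At t a b)
At? (_ , a′ , b′) a b with VecP.≡-dec ℕ._≟_ a′ a | VecP.≡-dec ℕ._≟_ b′ b
... | yes p | yes q = yes (p , q)
... | no ¬p | _     = no (¬p ∘ proj₁)
... | yes _ | no ¬q = no (¬q ∘ proj₂)

-- Serves the termwise operations on polynomials. The alternative with coefficient 0 is for the
-- derivative of a term with exponent 0: its truncated exponents may still match, but its
-- coefficient vanishes.
termCoeff-scale : ∀ {n m} (s : Term n) (t : Term m) k {a b a′ b′} →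
  (At s a b → proj₁ s ≡ 0ℚ ⊎ At t a′ b′) → (At t a′ b′ → At s a b × proj₁ s ≡ k ⊛ proj₁ t) →
  termCoeff s a b ≡ k ⊛ termCoeff t a′ b′
termCoeff-scale s t k {a} {b} {a′} {b′} to from with At? t a′ b′
... | yes at = trans (termCoeff-yes s (proj₁ (from at))) (trans (proj₂ (from at)) (cong (k ⊛_) (sym (termCoeff-yes t at))))
... | no no-at = trans zero-s (sym (trans (cong (k ⊛_) (termCoeff-no t no-at)) (ℚP.*-zeroʳ k)))
  where
  zero-s : termCoeff s a b ≡ 0ℚ
  zero-s with At? s a b
  ... | no no-s = termCoeff-no s no-s
  ... | yes at with to at
  ...   | inj₁ c≡0 = trans (termCoeff-yes s at) c≡0
  ...   | inj₂ at′ = contradiction at′ no-at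

coeff-++ : ∀ {n} (P Q : Poly n) a b → coeff (P ++ Q) a b ≡ coeff P a b ⊕ coeff Q a b
coeff-++ []      Q a b = sym (ℚP.+-identityˡ _)
coeff-++ (t ∷ P) Q a b = trans (cong (termCoeff t a b ⊕_) (coeff-++ P Q a b)) (sym (ℚP.+-assoc (termCoeff t a b) (coeff P a b) (coeff Q a b)))

coeff-map : ∀ {n m} (h : Term m → Term n) k {a b a′ b′} → (∀ t → termCoeff (h t) a b ≡ k ⊛ termCoeff t a′ b′) →
  ∀ P → coeff (map h P) a b ≡ k ⊛ coeff P a′ b′
coeff-map h k eq []      = sym (ℚP.*-zeroʳ k)
coeff-map h k eq (t ∷ P) = trans (cong₂ _⊕_ (eq t) (coeff-map h k eq P)) (sym (ℚP.*-distribˡ-+ k (termCoeff t _ _) (coeff P _ _)))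

coeff-• : ∀ {n} c (P : Poly n) a b → coeff (c • P) a b ≡ c ⊛ coeff P a b
coeff-• c P a b = coeff-map _ c (λ { t@(d , a′ , b′) → termCoeff-scale (c ⊛ d , a′ , b′) t c inj₂ (λ at → at , refl) }) P

coeff-sumP : ∀ {n} {I : Set} (F : I → Poly n) l a b → coeff (sumP (map F l)) a b ≡ sumL (λ i → coeff (F i) a b) l
coeff-sumP F []      a b = refl
coeff-sumP F (i ∷ l) a b = trans (coeff-++ (F i) _ a b) (cong (coeff (F i) a b ⊕_) (coeff-sumP F l a b))

pred-incr : ∀ {n} (i : Fin n) a → updateAt (incr i a) i (_∸ 1) ≡ a
pred-incr i a = trans (VecP.updateAt-updateAt i a) (VecP.updateAt-id i a)

incr-pred : ∀ {n} (i : Fin n) a → lookup a i ≡ 0 ⊎ a ≡ incr i (updateAt a i (_∸ 1))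
incr-pred zero    (zero ∷ a)  = inj₁ refl
incr-pred zero    (suc x ∷ a) = inj₂ refl
incr-pred (suc i) (x ∷ a) with incr-pred i a
... | inj₁ eq = inj₁ eq
... | inj₂ eq = inj₂ (cong (x ∷_) eq)

derivative-factor : ∀ {n} c i (a′ a : Vec ℕ n) → a′ ≡ incr i a → c ⊛ nℚ (lookup a′ i) ≡ nℚ (suc (lookup a i)) ⊛ c
derivative-factor c i a′ a refl = trans (cong (λ x → c ⊛ nℚ x) (VecP.lookup∘updateAt i a)) (ℚP.*-comm c _)

coeff-∂x : ∀ {n} (i : Fin n) P a b → coeff (∂x i P) a b ≡ nℚ (suc (lookup a i)) ⊛ coeff P (incr i a) b
coeff-∂x i P a b = coeff-map _ (nℚ (suc (lookup a i))) (λ { t@(c , a′ , b′) →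
  termCoeff-scale (c ⊛ nℚ (lookup a′ i) , updateAt a′ i (_∸ 1) , b′) t (nℚ (suc (lookup a i))) (to t) (from t) }) P
  where
  to : ∀ t → updateAt (proj₁ (proj₂ t)) i (_∸ 1) ≡ a × proj₂ (proj₂ t) ≡ b →
    proj₁ t ⊛ nℚ (lookup (proj₁ (proj₂ t)) i) ≡ 0ℚ ⊎ At t (incr i a) b
  to (c , a′ , b′) (eq , beq) with incr-pred i a′
  ... | inj₁ l≡0 = inj₁ (trans (cong (λ x → c ⊛ nℚ x) l≡0) (ℚP.*-zeroʳ c))
  ... | inj₂ a≡  = inj₂ (trans a≡ (cong (incr i) eq) , beq)
  from : ∀ t → At t (incr i a) b → (updateAt (proj₁ (proj₂ t)) i (_∸ 1) ≡ a × proj₂ (proj₂ t) ≡ b) ×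
    proj₁ t ⊛ nℚ (lookup (proj₁ (proj₂ t)) i) ≡ nℚ (suc (lookup a i)) ⊛ proj₁ t
  from (c , a′ , b′) (eq , beq) = (trans (cong (λ z → updateAt z i (_∸ 1)) eq) (pred-incr i a) , beq) , derivative-factor c i a′ a eq

coeff-∂y : ∀ {n} (i : Fin n) P a b → coeff (∂y i P) a b ≡ nℚ (suc (lookup b i)) ⊛ coeff P a (incr i b)
coeff-∂y i P a b = coeff-map _ (nℚ (suc (lookup b i))) (λ { t@(c , a′ , b′) →
  termCoeff-scale (c ⊛ nℚ (lookup b′ i) , a′ , updateAt b′ i (_∸ 1)) t (nℚ (suc (lookup b i))) (to t) (from t) }) P
  where
  to : ∀ t → proj₁ (proj₂ t) ≡ a × updateAt (proj₂ (proj₂ t)) i (_∸ 1) ≡ b →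
    proj₁ t ⊛ nℚ (lookup (proj₂ (proj₂ t)) i) ≡ 0ℚ ⊎ At t a (incr i b)
  to (c , a′ , b′) (aeq , eq) with incr-pred i b′
  ... | inj₁ l≡0 = inj₁ (trans (cong (λ x → c ⊛ nℚ x) l≡0) (ℚP.*-zeroʳ c))
  ... | inj₂ b≡  = inj₂ (aeq , trans b≡ (cong (incr i) eq))
  from : ∀ t → At t a (incr i b) → (proj₁ (proj₂ t) ≡ a × updateAt (proj₂ (proj₂ t)) i (_∸ 1) ≡ b) ×
    proj₁ t ⊛ nℚ (lookup (proj₂ (proj₂ t)) i) ≡ nℚ (suc (lookup b i)) ⊛ proj₁ t
  from (c , a′ , b′) (aeq , eq) = (aeq , trans (cong (λ z → updateAt z i (_∸ 1)) eq) (pred-incr i b)) , derivative-factor c i b′ b eq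

coeff-mulY-0 : ∀ {n} (i : Fin n) P a b → lookup b i ≡ 0 → coeff (mulY i P) a b ≡ 0ℚ
coeff-mulY-0 i P a b l≡0 = trans (coeff-map _ 0ℚ {a′ = a} {b} (λ { t@(c , a′ , b′) →
  trans (termCoeff-no (c , a′ , incr i b′) (λ at → absurd b′ (proj₂ at))) (sym (ℚP.*-zeroˡ (termCoeff t a b))) }) P) (ℚP.*-zeroˡ (coeff P a b))
  where
  absurd : ∀ b′ → incr i b′ ≢ b
  absurd b′ refl with trans (sym (VecP.lookup∘updateAt i b′)) l≡0
  ... | ()

coeff-mulY : ∀ {n} (i : Fin n) P a b → coeff (mulY i P) a (incr i b) ≡ coeff P a b
coeff-mulY i P a b = trans (coeff-map _ 1ℚ {a′ = a} {b} (λ { t@(c , a′ , b′) →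
  termCoeff-scale (c , a′ , incr i b′) t 1ℚ (λ at → inj₂ (proj₁ at , trans (sym (pred-incr i b′)) (trans (cong (λ z → updateAt z i (_∸ 1)) (proj₂ at)) (pred-incr i b))))
    (λ at → (proj₁ at , cong (incr i) (proj₂ at)) , sym (ℚP.*-identityˡ c)) }) P) (ℚP.*-identityˡ (coeff P a b))

-- Divided-power coordinates and the operators in them

facts : ∀ {n} → Vec ℕ n → ℚ
facts []      = 1ℚ
facts (x ∷ a) = nℚ (x !) ⊛ facts a

!≢0 : ∀ x → nℚ (x !) ≢0
!≢0 x eq = ℕ.≢-nonZero⁻¹ (x !) {{x ℕP.!≢0}} (nℚ-injective {x !} {0} eq)

facts≢0 : ∀ {n} (a : Vec ℕ n) → facts a ≢0
facts≢0 []      ()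
facts≢0 (x ∷ a) = *-≢0 (!≢0 x) (facts≢0 a)

facts-incr : ∀ {n} (i : Fin n) a → facts (incr i a) ≡ nℚ (suc (lookup a i)) ⊛ facts a
facts-incr zero    (x ∷ a) = trans (cong (_⊛ facts a) (nℚ-* (suc x) (x !))) (ℚP.*-assoc (nℚ (suc x)) (nℚ (x !)) (facts a))
facts-incr (suc i) (x ∷ a) = trans (cong (nℚ (x !) ⊛_) (facts-incr i a))
  (solve 3 (λ f k r → f :* (k :* r) := k :* (f :* r)) refl (nℚ (x !)) (nℚ (suc (lookup a i))) (facts a))

facts-⇄ : ∀ {n} {u v : Vec ℕ n} → u ⇄ v → facts u ≡ facts v
facts-⇄ (swap x y v) = solve 3 (λ f g r → f :* (g :* r) := g :* (f :* r)) refl (nℚ (x !)) (nℚ (y !)) (facts v)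
facts-⇄ (skip x s)   = cong (nℚ (x !) ⊛_) (facts-⇄ s)

weight : ∀ {n} → Vec Cell n → ℚ
weight v = facts (Vec.map proj₁ v) ⊛ facts (Vec.map proj₂ v)

weight≢0 : ∀ {n} (v : Vec Cell n) → weight v ≢0
weight≢0 v = *-≢0 (facts≢0 (Vec.map proj₁ v)) (facts≢0 (Vec.map proj₂ v))

-- The coefficients of P with respect to the divided-power monomials.
⟦_⟧ : ∀ {n} → Poly n → Vec Cell n → ℚ
⟦ P ⟧ v = weight v ⊛ coeff P (Vec.map proj₁ v) (Vec.map proj₂ v)

⟦⟧-cong : ∀ {n} {P Q : Poly n} → P ≈ Q → ∀ v → ⟦ P ⟧ v ≡ ⟦ Q ⟧ v
⟦⟧-cong P≈Q v = cong (weight v ⊛_) (P≈Q _ _)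

⟦⟧-zero : ∀ {n} {P : Poly n} {v} → coeff P (Vec.map proj₁ v) (Vec.map proj₂ v) ≡ 0ℚ → ⟦ P ⟧ v ≡ 0ℚ
⟦⟧-zero {v = v} eq = trans (cong (weight v ⊛_) eq) (ℚP.*-zeroʳ (weight v))

⟦⟧-coeff : ∀ {n} (P : Poly n) a b → ⟦ P ⟧ (Vec.zip a b) ≡ weight (Vec.zip a b) ⊛ coeff P a b
⟦⟧-coeff P a b = cong₂ (λ a′ b′ → weight (Vec.zip a b) ⊛ coeff P a′ b′) (VecP.map-proj₁-zip a b) (VecP.map-proj₂-zip a b)

⟦⟧-injective : ∀ {n} {P Q : Poly n} → (∀ v → ⟦ P ⟧ v ≡ ⟦ Q ⟧ v) → P ≈ Q
⟦⟧-injective {P = P} {Q} eq a b = begin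
  p                    ≡⟨ solve 2 (λ p q → p := (p :+ :- q) :+ q) refl p q ⟩
  (p ⊕ ⊖ q) ⊕ q        ≡⟨ cong (_⊕ q) (*-cancel-0 {w} (weight≢0 (Vec.zip a b)) diff) ⟩
  0ℚ ⊕ q               ≡⟨ ℚP.+-identityˡ q ⟩
  q ∎
  where
  p = coeff P a b
  q = coeff Q a b
  w = weight (Vec.zip a b)
  diff : w ⊛ (p ⊕ ⊖ q) ≡ 0ℚ
  diff = begin
    w ⊛ (p ⊕ ⊖ q)       ≡⟨ solve 3 (λ w p q → w :* (p :+ :- q) := w :* p :+ :- (w :* q)) refl w p q ⟩
    w ⊛ p ⊕ ⊖ (w ⊛ q)   ≡⟨ cong (_⊕ (⊖ (w ⊛ q))) (trans (sym (⟦⟧-coeff P a b)) (trans (eq (Vec.zip a b)) (⟦⟧-coeff Q a b))) ⟩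
    w ⊛ q ⊕ ⊖ (w ⊛ q)   ≡⟨ ℚP.+-inverseʳ (w ⊛ q) ⟩
    0ℚ ∎

⟦⟧-≈0 : ∀ {n} {P : Poly n} → (∀ v → ⟦ P ⟧ v ≡ 0ℚ) → P ≈ zeroP
⟦⟧-≈0 {P = P} eq = ⟦⟧-injective {P = P} {zeroP} (λ v → trans (eq v) (sym (ℚP.*-zeroʳ (weight v))))

⟦⟧-+ : ∀ {n} (P Q : Poly n) v → ⟦ P +P Q ⟧ v ≡ ⟦ P ⟧ v ⊕ ⟦ Q ⟧ v
⟦⟧-+ P Q v = trans (cong (weight v ⊛_) (coeff-++ P Q _ _)) (ℚP.*-distribˡ-+ (weight v) _ _)

⟦⟧-• : ∀ {n} c (P : Poly n) v → ⟦ c • P ⟧ v ≡ c ⊛ ⟦ P ⟧ v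
⟦⟧-• c P v = trans (cong (weight v ⊛_) (coeff-• c P _ _))
  (solve 3 (λ w c k → w :* (c :* k) := c :* (w :* k)) refl (weight v) c (coeff P _ _))

⟦⟧-sumP : ∀ {n} {I : Set} (F : I → Poly n) l v → ⟦ sumP (map F l) ⟧ v ≡ sumL (λ i → ⟦ F i ⟧ v) l
⟦⟧-sumP F l v = trans (cong (weight v ⊛_) (coeff-sumP F l _ _)) (sym (sumL-* (weight v) _ l))

module _ {n} (i : Fin n) (P : Poly n) (v : Vec Cell n) where
  private
    a = Vec.map proj₁ v
    b = Vec.map proj₂ v

  map-proj₁-updateAt : ∀ {h : Cell → Cell} {g} → proj₁ (h (lookup v i)) ≡ g (proj₁ (lookup v i)) → Vec.map proj₁ (updateAt v i h) ≡ updateAt a i g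
  map-proj₁-updateAt = VecP.map-updateAt v i

  map-proj₂-updateAt : ∀ {h : Cell → Cell} {g} → proj₂ (h (lookup v i)) ≡ g (proj₂ (lookup v i)) → Vec.map proj₂ (updateAt v i h) ≡ updateAt b i g
  map-proj₂-updateAt = VecP.map-updateAt v i

  ⟦⟧-∂x : ⟦ ∂x i P ⟧ v ≡ ⟦ P ⟧ (updateAt v i (shift 1 0))
  ⟦⟧-∂x = begin
    facts a ⊛ facts b ⊛ coeff (∂x i P) a b ≡⟨ cong (facts a ⊛ facts b ⊛_) (coeff-∂x i P a b) ⟩
    facts a ⊛ facts b ⊛ (k ⊛ c)            ≡⟨ solve 4 (λ f g k c → f :* g :* (k :* c) := (k :* f) :* g :* c) refl (facts a) (facts b) k c ⟩
    (k ⊛ facts a) ⊛ facts b ⊛ c            ≡⟨ cong (λ z → z ⊛ facts b ⊛ c) (facts-incr i a) ⟨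
    facts (incr i a) ⊛ facts b ⊛ c         ≡⟨ cong₂ (λ a b → facts a ⊛ facts b ⊛ coeff P a b) (map-proj₁-updateAt {shift 1 0} refl) (trans (map-proj₂-updateAt {shift 1 0} {id} refl) (VecP.updateAt-id i b)) ⟨
    ⟦ P ⟧ (updateAt v i (shift 1 0)) ∎
    where
    k = nℚ (suc (lookup a i))
    c = coeff P (incr i a) b

  ⟦⟧-∂y : ⟦ ∂y i P ⟧ v ≡ ⟦ P ⟧ (updateAt v i (shift 0 1))
  ⟦⟧-∂y = begin
    facts a ⊛ facts b ⊛ coeff (∂y i P) a b ≡⟨ cong (facts a ⊛ facts b ⊛_) (coeff-∂y i P a b) ⟩
    facts a ⊛ facts b ⊛ (k ⊛ c)            ≡⟨ solve 4 (λ f g k c → f :* g :* (k :* c) := f :* (k :* g) :* c) refl (facts a) (facts b) k c ⟩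
    facts a ⊛ (k ⊛ facts b) ⊛ c            ≡⟨ cong (λ z → facts a ⊛ z ⊛ c) (facts-incr i b) ⟨
    facts a ⊛ facts (incr i b) ⊛ c         ≡⟨ cong₂ (λ a b → facts a ⊛ facts b ⊛ coeff P a b) (trans (map-proj₁-updateAt {shift 0 1} {id} refl) (VecP.updateAt-id i a)) (map-proj₂-updateAt {shift 0 1} refl) ⟨
    ⟦ P ⟧ (updateAt v i (shift 0 1)) ∎
    where
    k = nℚ (suc (lookup b i))
    c = coeff P a (incr i b)

  ⟦⟧-mulY : ⟦ mulY i P ⟧ v ≡ yWeight (lookup v i) ⊛ ⟦ P ⟧ (updateAt v i (lower 0))
  ⟦⟧-mulY with incr-pred i b
  ... | inj₁ l≡0 = trans (⟦⟧-zero {P = mulY i P} {v} (coeff-mulY-0 i P a b l≡0))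
          (sym (trans (cong (λ x → nℚ x ⊛ ⟦ P ⟧ (updateAt v i (lower 0))) (trans (sym (VecP.lookup-map i proj₂ v)) l≡0)) (ℚP.*-zeroˡ (⟦ P ⟧ (updateAt v i (lower 0))))))
  ... | inj₂ b≡  = begin
    facts a ⊛ facts b ⊛ coeff (mulY i P) a b
      ≡⟨ cong₂ (λ f c → facts a ⊛ f ⊛ c) (trans (cong facts b≡) (trans (facts-incr i b⁻) (cong (λ x → nℚ x ⊛ facts b⁻) l≡)))
          (trans (cong (coeff (mulY i P) a) b≡) (coeff-mulY i P a b⁻)) ⟩
    facts a ⊛ (yWeight (lookup v i) ⊛ facts b⁻) ⊛ coeff P a b⁻
      ≡⟨ solve 4 (λ f k g c → f :* (k :* g) :* c := k :* (f :* g :* c)) refl (facts a) (yWeight (lookup v i)) (facts b⁻) (coeff P a b⁻) ⟩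
    yWeight (lookup v i) ⊛ (facts a ⊛ facts b⁻ ⊛ coeff P a b⁻)
      ≡⟨ cong (yWeight (lookup v i) ⊛_) (cong₂ (λ a b → facts a ⊛ facts b ⊛ coeff P a b) (trans (map-proj₁-updateAt {lower 0} {id} refl) (VecP.updateAt-id i a)) (map-proj₂-updateAt {lower 0} {_∸ 1} refl)) ⟨
    yWeight (lookup v i) ⊛ ⟦ P ⟧ (updateAt v i (lower 0)) ∎
    where
    b⁻ = updateAt b i (_∸ 1)
    l≡ : suc (lookup b⁻ i) ≡ proj₂ (lookup v i)
    l≡ = trans (sym (VecP.lookup∘updateAt i b⁻)) (trans (cong (λ z → lookup z i) (sym b≡)) (VecP.lookup-map i proj₂ v))

⟦⟧-iter-∂x : ∀ {n} (i : Fin n) a P v → ⟦ iter a (∂x i) P ⟧ v ≡ ⟦ P ⟧ (updateAt v i (shift a 0))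
⟦⟧-iter-∂x i zero    P v = cong ⟦ P ⟧ (sym (VecP.updateAt-id i v))
⟦⟧-iter-∂x i (suc a) P v = trans (⟦⟧-∂x i (iter a (∂x i) P) v) (trans (⟦⟧-iter-∂x i a P (updateAt v i (shift 1 0)))
  (cong ⟦ P ⟧ (trans (VecP.updateAt-updateAt i {shift a 0} {shift 1 0} v) (VecP.updateAt-cong i (λ (p , q) → cong (_, q) (ℕP.+-suc a p)) v))))

⟦⟧-iter-∂y : ∀ {n} (i : Fin n) b P v → ⟦ iter b (∂y i) P ⟧ v ≡ ⟦ P ⟧ (updateAt v i (shift 0 b))
⟦⟧-iter-∂y i zero    P v = cong ⟦ P ⟧ (sym (VecP.updateAt-id i v))
⟦⟧-iter-∂y i (suc b) P v = trans (⟦⟧-∂y i (iter b (∂y i) P) v) (trans (⟦⟧-iter-∂y i b P (updateAt v i (shift 0 1)))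
  (cong ⟦ P ⟧ (trans (VecP.updateAt-updateAt i {shift 0 b} {shift 0 1} v) (VecP.updateAt-cong i (λ (p , q) → cong (p ,_) (ℕP.+-suc b q)) v))))

⟦⟧-powerSum : ∀ {n} a b (P : Poly n) v →
  ⟦ sumP (map (λ i → iter a (∂x i) (iter b (∂y i) P)) (allFin n)) ⟧ v ≡ moves one (shift a b) ⟦ P ⟧ v
⟦⟧-powerSum {n} a b P v = begin
  ⟦ sumP (map (λ i → iter a (∂x i) (iter b (∂y i) P)) (allFin n)) ⟧ v
    ≡⟨ ⟦⟧-sumP _ (allFin n) v ⟩
  sumL (λ i → ⟦ iter a (∂x i) (iter b (∂y i) P) ⟧ v) (allFin n)
    ≡⟨ sumL-cong (λ i → trans (⟦⟧-iter-∂x i a (iter b (∂y i) P) v) (trans (⟦⟧-iter-∂y i b P (updateAt v i (shift a 0))) (cong ⟦ P ⟧ (VecP.updateAt-updateAt i {shift 0 b} {shift a 0} v)))) (allFin n) ⟩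
  sumL (λ i → ⟦ P ⟧ (updateAt v i (shift a b))) (allFin n)
    ≡⟨ moves-one ⟦ P ⟧ v ⟨
  moves one (shift a b) ⟦ P ⟧ v ∎

⟦⟧-E : ∀ {n} a (P : Poly n) v → ⟦ E a P ⟧ v ≡ polarize a ⟦ P ⟧ v
⟦⟧-E {n} a P v = begin
  ⟦ E a P ⟧ v
    ≡⟨ ⟦⟧-sumP (λ i → mulY i (iter a (∂x i) P)) (allFin n) v ⟩
  sumL (λ i → ⟦ mulY i (iter a (∂x i) P) ⟧ v) (allFin n)
    ≡⟨ sumL-cong (λ i → trans (⟦⟧-mulY i (iter a (∂x i) P) v) (cong (yWeight (lookup v i) ⊛_)
        (trans (⟦⟧-iter-∂x i a P (updateAt v i (lower 0))) (cong ⟦ P ⟧ (VecP.updateAt-updateAt i {shift a 0} {lower 0} v))))) (allFin n) ⟩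
  sumL (λ i → yWeight (lookup v i) ⊛ ⟦ P ⟧ (updateAt v i (lower a))) (allFin n)
    ≡⟨ moves-updateAt ⟦ P ⟧ v ⟨
  polarize a ⟦ P ⟧ v ∎

-- The alternation condition

permute : ∀ {A : Set} {n} → Permutation′ n → Vec A n → Vec A n
permute σ v = tabulate (λ i → lookup v (σ ⟨$⟩ʳ i))

map-permute : ∀ {A B : Set} {n} (f : A → B) (σ : Permutation′ n) v → Vec.map f (permute σ v) ≡ permute σ (Vec.map f v)
map-permute f σ v = trans (sym (VecP.tabulate-∘ f _)) (VecP.tabulate-cong (λ i → sym (VecP.lookup-map (σ ⟨$⟩ʳ i) f v)))

coeff-act : ∀ {n} (σ : Permutation′ n) P a b → coeff (act σ P) a b ≡ coeff P (permute σ a) (permute σ b)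
coeff-act σ P a b = trans (coeff-map _ 1ℚ {a′ = permute σ a} {permute σ b} (λ { t@(c , a′ , b′) →
  termCoeff-scale (c , unpermute a′ , unpermute b′) t 1ℚ
    (λ at → inj₂ (to (proj₁ at) , to (proj₂ at)))
    (λ at → (from (proj₁ at) , from (proj₂ at)) , sym (ℚP.*-identityˡ c)) }) P) (ℚP.*-identityˡ _)
  where
  unpermute : Vec ℕ _ → Vec ℕ _
  unpermute v = tabulate (λ j → lookup v (σ ⟨$⟩ˡ j))
  to : ∀ {u v} → unpermute u ≡ v → u ≡ permute σ v
  to {u} refl = sym (trans (VecP.tabulate-cong (λ i → trans (VecP.lookup∘tabulate _ (σ ⟨$⟩ʳ i)) (cong (lookup u) (Perm.inverseˡ σ)))) (VecP.tabulate∘lookup u))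
  from : ∀ {u v} → u ≡ permute σ v → unpermute u ≡ v
  from {v = v} refl = trans (VecP.tabulate-cong (λ i → trans (VecP.lookup∘tabulate _ (σ ⟨$⟩ˡ i)) (cong (lookup v) (Perm.inverseʳ σ)))) (VecP.tabulate∘lookup v)

lookup-to-front : ∀ {A : Set} {n} (i : Fin (suc n)) (f : Fin (suc n) → A) → f i ∷ tabulate (f ∘ punchIn i) ⇄* tabulate f
lookup-to-front zero    f = ε
lookup-to-front {n = suc n} (suc i) f = swap _ _ _ ◅ ⇄*-skip (f zero) (lookup-to-front i (f ∘ suc))

-- `remove` leaves a permutation of the entries other than f (σ 0); once these are in order, f (σ 0)
-- travels from the front to its own place.
permutation-⇄* : ∀ {A : Set} {n} (σ : Permutation′ n) (f : Fin n → A) → tabulate (λ i → f (σ ⟨$⟩ʳ i)) ⇄* tabulate f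
permutation-⇄* {n = zero}  σ f = ε
permutation-⇄* {n = suc n} σ f = subst (_⇄* tabulate f)
  (cong (f (σ ⟨$⟩ʳ zero) ∷_) (VecP.tabulate-cong (λ i → cong f (sym (Perm.punchIn-permute σ zero i)))))
  (⇄*-skip (f (σ ⟨$⟩ʳ zero)) (permutation-⇄* (Perm.remove zero σ) (f ∘ punchIn (σ ⟨$⟩ʳ zero))) ◅◅ lookup-to-front (σ ⟨$⟩ʳ zero) f)

facts-⇄* : ∀ {n} {u v : Vec ℕ n} → u ⇄* v → facts u ≡ facts v
facts-⇄* ε       = refl
facts-⇄* (s ◅ p) = trans (facts-⇄ s) (facts-⇄* p)

facts-permute : ∀ {n} (σ : Permutation′ n) a → facts (permute σ a) ≡ facts a
facts-permute σ a = trans (facts-⇄* (permutation-⇄* σ (lookup a))) (cong facts (VecP.tabulate∘lookup a))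

⟦⟧-act : ∀ {n} (σ : Permutation′ n) P v → ⟦ act σ P ⟧ v ≡ ⟦ P ⟧ (permute σ v)
⟦⟧-act σ P v = cong₂ _⊛_
  (cong₂ _⊛_ (factor proj₁) (factor proj₂))
  (trans (coeff-act σ P _ _) (cong₂ (coeff P) (sym (map-permute proj₁ σ v)) (sym (map-permute proj₂ σ v))))
  where
  factor : ∀ (f : Cell → ℕ) → facts (Vec.map f v) ≡ facts (Vec.map f (permute σ v))
  factor f = trans (sym (facts-permute σ (Vec.map f v))) (cong facts (sym (map-permute f σ v)))

-- 1, 0 or -1 according to the order of the two arguments, so that the product
-- over all pairs of entries is antisymmetric even when entries repeat.
order : ℕ → ℕ → ℚ
order x y with ℕP.<-cmp x y
... | tri< _ _ _ = 1ℚ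
... | tri≈ _ _ _ = 0ℚ
... | tri> _ _ _ = ⊖ 1ℚ

order-anti : ∀ x y → order x y ≡ ⊖ order y x
order-anti x y with ℕP.<-cmp x y | ℕP.<-cmp y x
... | tri< _ _ _   | tri> _ _ _   = refl
... | tri≈ _ _ _   | tri≈ _ _ _   = refl
... | tri> _ _ _   | tri< _ _ _   = refl
... | tri< p _ _   | tri< q _ _   = contradiction q (ℕP.<-asym p)
... | tri< _ ¬p _  | tri≈ _ q _   = contradiction (sym q) ¬p
... | tri≈ _ p _   | tri< _ ¬q _  = contradiction (sym p) ¬q
... | tri≈ _ p _   | tri> _ ¬q _  = contradiction (sym p) ¬q
... | tri> _ ¬p _  | tri≈ _ q _   = contradiction (sym q) ¬p
... | tri> _ _ p   | tri> _ _ q   = contradiction q (ℕP.<-asym p)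

orders : ∀ {n} → ℕ → Vec ℕ n → ℚ
orders x []      = 1ℚ
orders x (y ∷ v) = order x y ⊛ orders x v

vandermonde : ∀ {n} → Vec ℕ n → ℚ
vandermonde []      = 1ℚ
vandermonde (x ∷ v) = orders x v ⊛ vandermonde v

orders-⇄ : ∀ {n} x {u v : Vec ℕ n} → u ⇄ v → orders x u ≡ orders x v
orders-⇄ x (swap y z v) = solve 3 (λ a b c → a :* (b :* c) := b :* (a :* c)) refl (order x y) (order x z) (orders x v)
orders-⇄ x (skip y s)   = cong (order x y ⊛_) (orders-⇄ x s)

vandermonde-antisym : ∀ {n} → Antisym (vandermonde {n})
vandermonde-antisym (swap x y v) = trans
  (cong (λ o → (o ⊛ orders x v) ⊛ (orders y v ⊛ vandermonde v)) (order-anti x y))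
  (solve 4 (λ o a b d → ((:- o) :* a) :* (b :* d) := :- ((o :* b) :* (a :* d))) refl (order y x) (orders x v) (orders y v) (vandermonde v))
vandermonde-antisym (skip x {u} {v} s) = trans
  (cong₂ _⊛_ (orders-⇄ x s) (vandermonde-antisym s)) (sym (ℚP.neg-distribʳ-* (orders x v) (vandermonde v)))

prodL : ∀ {I : Set} → (I → ℚ) → List I → ℚ
prodL F []      = 1ℚ
prodL F (i ∷ l) = F i ⊛ prodL F l

prodL-cong : ∀ {I : Set} {F G : I → ℚ} → (∀ i → F i ≡ G i) → ∀ l → prodL F l ≡ prodL G l
prodL-cong eq []      = refl
prodL-cong eq (i ∷ l) = cong₂ _⊛_ (eq i) (prodL-cong eq l)

prodL-++ : ∀ {I : Set} (F : I → ℚ) k l → prodL F (k ++ l) ≡ prodL F k ⊛ prodL F l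
prodL-++ F []      l = sym (ℚP.*-identityˡ _)
prodL-++ F (i ∷ k) l = trans (cong (F i ⊛_) (prodL-++ F k l)) (sym (ℚP.*-assoc (F i) _ _))

prodL-concatMap : ∀ {I J : Set} (F : J → ℚ) (f : I → List J) l → prodL F (concatMap f l) ≡ prodL (λ i → prodL F (f i)) l
prodL-concatMap F f []      = refl
prodL-concatMap F f (i ∷ l) = trans (prodL-++ F (f i) _) (cong (prodL F (f i) ⊛_) (prodL-concatMap F f l))

prodL-map : ∀ {I J : Set} (F : J → ℚ) (f : I → J) l → prodL F (map f l) ≡ prodL (F ∘ f) l
prodL-map F f []      = refl
prodL-map F f (i ∷ l) = cong (F (f i) ⊛_) (prodL-map F f l)

prodL-* : ∀ {I : Set} (F G : I → ℚ) l → prodL (λ i → F i ⊛ G i) l ≡ prodL F l ⊛ prodL G l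
prodL-* F G []      = refl
prodL-* F G (i ∷ l) = trans (cong (F i ⊛ G i ⊛_) (prodL-* F G l))
  (solve 4 (λ a b c d → (a :* b) :* (c :* d) := (a :* c) :* (b :* d)) refl (F i) (G i) (prodL F l) (prodL G l))

prodL-1 : ∀ {I : Set} (l : List I) → prodL (λ _ → 1ℚ) l ≡ 1ℚ
prodL-1 []      = refl
prodL-1 (_ ∷ l) = trans (ℚP.*-identityˡ _) (prodL-1 l)

prodL-filter : ∀ {I : Set} {P : I → Set} (P? : ∀ i → Dec (P i)) (F : I → ℚ) l →
  prodL F (filter P? l) ≡ prodL (λ i → if does (P? i) then F i else 1ℚ) l
prodL-filter P? F []      = refl
prodL-filter P? F (i ∷ l) with does (P? i)
... | true  = cong (F i ⊛_) (prodL-filter P? F l)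
... | false = trans (prodL-filter P? F l) (sym (ℚP.*-identityˡ _))

sign-filter : ∀ {I : Set} {P : I → Set} (P? : ∀ i → Dec (P i)) l →
  sign (length (filter P? l)) ≡ prodL (λ i → if does (P? i) then ⊖ 1ℚ else 1ℚ) l
sign-filter P? []      = refl
sign-filter P? (i ∷ l) with does (P? i)
... | true  = trans (cong ⊖_ (sign-filter P? l)) (solve 1 (λ a → :- a := (:- con 1ℚ) :* a) refl (prodL (λ i → if does (P? i) then ⊖ 1ℚ else 1ℚ) l))
... | false = trans (sign-filter P? l) (sym (ℚP.*-identityˡ _))

prodL-allFin : ∀ {n} (F : Fin (suc n) → ℚ) → prodL F (allFin (suc n)) ≡ F zero ⊛ prodL (F ∘ suc) (allFin n)
prodL-allFin {n} F = cong (F zero ⊛_) (go n id)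
  where
  go : ∀ m (f : Fin m → Fin n) → prodL F (List.tabulate (suc ∘ f)) ≡ prodL (F ∘ suc) (List.tabulate f)
  go zero    f = refl
  go (suc m) f = cong (F (suc (f zero)) ⊛_) (go m (f ∘ suc))

pairSign : ∀ {n} → (Fin n → ℕ) → Fin n → Fin n → ℚ
pairSign f j i = if does (i Fin.<? j) then (if does (f j ℕ.<? f i) then ⊖ 1ℚ else 1ℚ) else 1ℚ

vandermonde-inversions : ∀ {n} (f : Fin n → ℕ) → Injective _≡_ _≡_ f →
  prodL (λ j → prodL (pairSign f j) (allFin n)) (allFin n) ≡ vandermonde (tabulate f)
vandermonde-inversions {zero}  f inj = refl
vandermonde-inversions {suc n} f inj = begin
  prodL (λ j → prodL (pairSign f j) (allFin (suc n))) (allFin (suc n))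
    ≡⟨ prodL-allFin (λ j → prodL (pairSign f j) (allFin (suc n))) ⟩
  prodL (λ i → 1ℚ) (allFin (suc n)) ⊛ prodL (λ j → prodL (pairSign f (suc j)) (allFin (suc n))) (allFin n)
    ≡⟨ cong₂ _⊛_ (prodL-1 (allFin (suc n))) (prodL-cong (λ j → prodL-allFin (pairSign f (suc j))) (allFin n)) ⟩
  1ℚ ⊛ prodL (λ j → pairSign f (suc j) zero ⊛ prodL (pairSign (f ∘ suc) j) (allFin n)) (allFin n)
    ≡⟨ trans (ℚP.*-identityˡ _) (prodL-* _ _ (allFin n)) ⟩
  prodL (λ j → pairSign f (suc j) zero) (allFin n) ⊛ prodL (λ j → prodL (pairSign (f ∘ suc) j) (allFin n)) (allFin n)
    ≡⟨ cong₂ _⊛_ (head (f ∘ suc) (f zero) (λ j eq → FinP.0≢1+n (inj eq))) (vandermonde-inversions (f ∘ suc) (FinP.suc-injective ∘ inj)) ⟩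
  vandermonde (tabulate f) ∎
  where
  order-sign : ∀ x y → x ≢ y → (if does (y ℕ.<? x) then ⊖ 1ℚ else 1ℚ) ≡ order x y
  order-sign x y x≢y with ℕP.<-cmp x y
  ... | tri< x<y _ _ rewrite dec-false (y ℕ.<? x) (ℕP.<-asym x<y) = refl
  ... | tri≈ _ x≡y _ = contradiction x≡y x≢y
  ... | tri> _ _ y<x rewrite dec-true (y ℕ.<? x) y<x = refl
  head : ∀ {m} (g : Fin m → ℕ) x → (∀ j → x ≢ g j) →
    prodL (λ j → if does (g j ℕ.<? x) then ⊖ 1ℚ else 1ℚ) (allFin m) ≡ orders x (tabulate g)
  head {zero}  g x ne = refl
  head {suc m} g x ne = trans (prodL-allFin (λ j → if does (g j ℕ.<? x) then ⊖ 1ℚ else 1ℚ))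
    (cong₂ _⊛_ (order-sign x (g zero) (ne zero)) (head (g ∘ suc) x (ne ∘ suc)))

-- Ties the inversion count in `sgn` to an antisymmetric function, so that the sign of a chain of
-- transpositions can be found by evaluating this function at the two ends.
sgn-vandermonde : ∀ {n} (σ : Permutation′ n) → sgn σ ≡ vandermonde (tabulate (λ i → toℕ (σ ⟨$⟩ʳ i)))
sgn-vandermonde {n} σ = begin
  sgn σ
    ≡⟨ sign-filter _ (concatMap (λ j → map (λ i → (i , j)) (filter (λ i → i Fin.<? j) (allFin n))) (allFin n)) ⟩
  prodL descent (concatMap (λ j → map (λ i → (i , j)) (filter (λ i → i Fin.<? j) (allFin n))) (allFin n))
    ≡⟨ prodL-concatMap descent _ (allFin n) ⟩
  prodL (λ j → prodL descent (map (λ i → (i , j)) (filter (λ i → i Fin.<? j) (allFin n)))) (allFin n)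
    ≡⟨ prodL-cong (λ j → trans (prodL-map descent _ (filter (λ i → i Fin.<? j) (allFin n))) (prodL-filter (λ i → i Fin.<? j) _ (allFin n))) (allFin n) ⟩
  prodL (λ j → prodL (pairSign f j) (allFin n)) (allFin n)
    ≡⟨ vandermonde-inversions f (λ eq → Injection.injective (↔⇒↣ σ) (FinP.toℕ-injective eq)) ⟩
  vandermonde (tabulate f) ∎
  where
  f : Fin n → ℕ
  f i = toℕ (σ ⟨$⟩ʳ i)
  descent : Fin n × Fin n → ℚ
  descent (i , j) = if does (f j ℕ.<? f i) then ⊖ 1ℚ else 1ℚ

vandermonde-sorted : ∀ n → vandermonde (tabulate {n = n} toℕ) ≡ 1ℚ
vandermonde-sorted n = sorted n toℕ (λ i<j → i<j)
  where
  below : ∀ m x (f : Fin m → ℕ) → (∀ i → x < f i) → orders x (tabulate f) ≡ 1ℚ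
  below zero    x f lt = refl
  below (suc m) x f lt with ℕP.<-cmp x (f zero)
  ... | tri< _ _ _  = trans (ℚP.*-identityˡ _) (below m x (f ∘ suc) (lt ∘ suc))
  ... | tri≈ ¬p _ _ = contradiction (lt zero) ¬p
  ... | tri> ¬p _ _ = contradiction (lt zero) ¬p
  sorted : ∀ m (f : Fin m → ℕ) → (∀ {i j} → i Fin.< j → f i < f j) → vandermonde (tabulate f) ≡ 1ℚ
  sorted zero    f mono = refl
  sorted (suc m) f mono = trans (cong₂ _⊛_ (below m (f zero) (f ∘ suc) (λ i → mono (ℕ.s≤s ℕ.z≤n))) (sorted m (f ∘ suc) (λ i<j → mono (ℕ.s≤s i<j)))) refl

-- The chain is built on the indices and only then mapped by `lookup v`, so its sign does not depend
-- on v, whose entries may repeat. The sign is found by evaluating `vandermonde` on the indices,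
-- which are distinct.
antisym-permute : ∀ {A : Set} {n} {C : Vec A n → ℚ} → Antisym C → ∀ σ v → C (permute σ v) ≡ sgn σ ⊛ C v
antisym-permute {n = n} {C} anti σ v = begin
  C (permute σ v)
    ≡⟨ cong C (VecP.tabulate-∘ (lookup v) (σ ⟨$⟩ʳ_)) ⟩
  C (Vec.map (lookup v) (tabulate (σ ⟨$⟩ʳ_)))
    ≡⟨ antisym-⇄* (λ s → anti (⇄-map (lookup v) s)) path ⟩
  parity path ⊛ C (Vec.map (lookup v) (tabulate id))
    ≡⟨ cong₂ (λ p u → p ⊛ C u) parity≡sgn (VecP.map-lookup-allFin v) ⟩
  sgn σ ⊛ C v ∎
  where
  path : tabulate (σ ⟨$⟩ʳ_) ⇄* tabulate id
  path = permutation-⇄* σ id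
  parity≡sgn : parity path ≡ sgn σ
  parity≡sgn = begin
    parity path                                       ≡⟨ ℚP.*-identityʳ _ ⟨
    parity path ⊛ 1ℚ                                  ≡⟨ cong (parity path ⊛_) (trans (cong vandermonde (sym (VecP.tabulate-∘ {n = n} toℕ id))) (vandermonde-sorted n)) ⟨
    parity path ⊛ vandermonde (Vec.map toℕ (tabulate {n = n} id)) ≡⟨ antisym-⇄* (λ s → vandermonde-antisym (⇄-map toℕ s)) path ⟨
    vandermonde (Vec.map toℕ (tabulate (σ ⟨$⟩ʳ_)))    ≡⟨ cong vandermonde (VecP.tabulate-∘ toℕ (σ ⟨$⟩ʳ_)) ⟨
    vandermonde (tabulate (λ i → toℕ (σ ⟨$⟩ʳ i)))     ≡⟨ sgn-vandermonde σ ⟨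
    sgn σ ∎

antisym⇒alternating : ∀ {n} {P : Poly n} → Antisym ⟦ P ⟧ → Alternating P
antisym⇒alternating {P = P} anti σ = ⟦⟧-injective {P = act σ P} {sgn σ • P} λ v →
  trans (⟦⟧-act σ P v) (trans (antisym-permute anti σ v) (sym (⟦⟧-• (sgn σ) P v)))

adjacent : ∀ {A : Set} {n} {u v : Vec A n} → u ⇄ v → Permutation′ n
adjacent (swap x y v) = Perm.swap Perm.id
adjacent (skip x s)   = Perm.lift₀ (adjacent s)

permute-adjacent : ∀ {A : Set} {n} {u v : Vec A n} (s : u ⇄ v) → permute (adjacent s) v ≡ u
permute-adjacent (swap x y v) = cong (λ w → x ∷ y ∷ w) (VecP.tabulate∘lookup v)
permute-adjacent (skip x s)   = cong (x ∷_) (permute-adjacent s)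

adjacent-⇄ : ∀ {A B : Set} {n} {u v : Vec A n} (s : u ⇄ v) (w : Vec B n) → permute (adjacent s) w ⇄ w
adjacent-⇄ (swap x y v) (a ∷ b ∷ w) = subst (λ z → b ∷ a ∷ z ⇄ a ∷ b ∷ w) (sym (VecP.tabulate∘lookup w)) (swap b a w)
adjacent-⇄ (skip x s)   (a ∷ w)     = skip a (adjacent-⇄ s w)

sgn-adjacent : ∀ {A : Set} {n} {u v : Vec A n} (s : u ⇄ v) → sgn (adjacent s) ≡ ⊖ 1ℚ
sgn-adjacent {n = n} s = begin
  sgn σ                                        ≡⟨ sgn-vandermonde σ ⟩
  vandermonde (tabulate (λ i → toℕ (σ ⟨$⟩ʳ i))) ≡⟨ cong vandermonde (VecP.tabulate-cong (λ i → VecP.lookup∘tabulate toℕ (σ ⟨$⟩ʳ i))) ⟨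
  vandermonde (permute σ (tabulate toℕ))       ≡⟨ vandermonde-antisym (adjacent-⇄ s (tabulate toℕ)) ⟩
  ⊖ vandermonde (tabulate {n = n} toℕ)         ≡⟨ cong ⊖_ (vandermonde-sorted n) ⟩
  ⊖ 1ℚ ∎
  where σ = adjacent s

alternating⇒antisym : ∀ {n} {P : Poly n} → Alternating P → Antisym ⟦ P ⟧
alternating⇒antisym {P = P} alt {u} {v} s = begin
  ⟦ P ⟧ u                        ≡⟨ cong ⟦ P ⟧ (permute-adjacent s) ⟨
  ⟦ P ⟧ (permute (adjacent s) v) ≡⟨ ⟦⟧-act (adjacent s) P v ⟨
  ⟦ act (adjacent s) P ⟧ v       ≡⟨ ⟦⟧-cong {P = act (adjacent s) P} {sgn (adjacent s) • P} (alt (adjacent s)) v ⟩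
  ⟦ sgn (adjacent s) • P ⟧ v     ≡⟨ ⟦⟧-• (sgn (adjacent s)) P v ⟩
  sgn (adjacent s) ⊛ ⟦ P ⟧ v     ≡⟨ cong (_⊛ ⟦ P ⟧ v) (sgn-adjacent s) ⟩
  (⊖ 1ℚ) ⊛ ⟦ P ⟧ v               ≡⟨ solve 1 (λ a → (:- con 1ℚ) :* a := :- a) refl (⟦ P ⟧ v) ⟩
  ⊖ ⟦ P ⟧ v ∎

-- The Vandermonde determinant Δ

matches : ℕ → ℕ → ℚ
matches c x with c ℕ.≟ x
... | yes _ = 1ℚ
... | no _  = 0ℚ

matches-≢ : ∀ {c x} → c ≢ x → matches c x ≡ 0ℚ
matches-≢ {c} {x} c≢x with c ℕ.≟ x
... | yes c≡x = contradiction c≡x c≢x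
... | no _    = refl

matches-refl : ∀ c → matches c c ≡ 1ℚ
matches-refl c with c ℕ.≟ c
... | yes _   = refl
... | no c≢c = contradiction refl c≢c

-- Laplace expansion along a row contributing the exponent x, with G the value of
-- the remaining minor as a function of its column exponents.
contract : ∀ {m} → ℕ → (Vec ℕ m → ℚ) → Vec ℕ (suc m) → ℚ
contract {zero}  x G (c ∷ [])  = matches c x ⊛ G []
contract {suc m} x G (c ∷ cs) = matches c x ⊛ G cs ⊕ ⊖ contract x (λ u → G (c ∷ u)) cs

contract-cong : ∀ {m} x {F G : Vec ℕ m → ℚ} → (∀ u → F u ≡ G u) → ∀ cs → contract x F cs ≡ contract x G cs
contract-cong {zero}  x eq (c ∷ []) = cong (matches c x ⊛_) (eq [])
contract-cong {suc m} x eq (c ∷ cs) = cong₂ (λ a b → matches c x ⊛ a ⊕ ⊖ b) (eq cs) (contract-cong x (λ u → eq (c ∷ u)) cs)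

contract-linear : ∀ {m} x a b (F G : Vec ℕ m → ℚ) cs →
  contract x (λ u → a ⊛ F u ⊕ b ⊛ G u) cs ≡ a ⊛ contract x F cs ⊕ b ⊛ contract x G cs
contract-linear {zero}  x a b F G (c ∷ []) =
  solve 5 (λ m a b f g → m :* (a :* f :+ b :* g) := a :* (m :* f) :+ b :* (m :* g)) refl (matches c x) a b (F []) (G [])
contract-linear {suc m} x a b F G (c ∷ cs) = trans
  (cong (λ z → matches c x ⊛ (a ⊛ F cs ⊕ b ⊛ G cs) ⊕ ⊖ z) (contract-linear x a b (λ u → F (c ∷ u)) (λ u → G (c ∷ u)) cs))
  (solve 7 (λ m a b f g f′ g′ → m :* (a :* f :+ b :* g) :+ :- (a :* f′ :+ b :* g′) := a :* (m :* f :+ :- f′) :+ b :* (m :* g :+ :- g′)) refl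
    (matches c x) a b (F cs) (G cs) (contract x (λ u → F (c ∷ u)) cs) (contract x (λ u → G (c ∷ u)) cs))

contract-* : ∀ {m} x a (F : Vec ℕ m → ℚ) cs → contract x (λ u → a ⊛ F u) cs ≡ a ⊛ contract x F cs
contract-* x a F cs = trans (contract-cong x (λ u → solve 2 (λ a f → a :* f := a :* f :+ con 0ℚ :* f) refl a (F u)) cs)
  (trans (contract-linear x a 0ℚ F F cs) (solve 2 (λ a f → a :* f :+ con 0ℚ :* f := a :* f) refl a (contract x F cs)))

contract-≡0 : ∀ {m} x {F : Vec ℕ m → ℚ} → (∀ u → F u ≡ 0ℚ) → ∀ cs → contract x F cs ≡ 0ℚ
contract-≡0 x {F} eq cs = trans (contract-cong x (λ u → trans (eq u) (sym (ℚP.*-zeroˡ (F u)))) cs)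
  (trans (contract-* x 0ℚ F cs) (ℚP.*-zeroˡ (contract x F cs)))

-- Exchange of two rows of a determinant. The terms in which the first column is used by row x and
-- by row y trade places with opposite signs; the terms in which neither uses it follow by
-- induction.
contract-swap : ∀ {m} x y (G : Vec ℕ m → ℚ) cs → contract x (contract y G) cs ≡ ⊖ contract y (contract x G) cs
contract-swap {zero} x y G (c ∷ d ∷ []) =
  solve 5 (λ cx cy dx dy g → cx :* (dy :* g) :+ :- (dx :* (cy :* g)) := :- (cy :* (dx :* g) :+ :- (dy :* (cx :* g)))) refl
    (matches c x) (matches c y) (matches d x) (matches d y) (G [])
contract-swap {suc m} x y G (c ∷ cs) = begin
  matches c x ⊛ Y ⊕ ⊖ contract x (λ u → matches c y ⊛ G u ⊕ ⊖ contract y G′ u) cs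
    ≡⟨ cong (λ z → matches c x ⊛ Y ⊕ ⊖ z) (step x y) ⟩
  matches c x ⊛ Y ⊕ ⊖ (matches c y ⊛ X ⊕ ⊖ contract x (contract y G′) cs)
    ≡⟨ cong (λ z → matches c x ⊛ Y ⊕ ⊖ (matches c y ⊛ X ⊕ ⊖ z)) (contract-swap x y G′ cs) ⟩
  matches c x ⊛ Y ⊕ ⊖ (matches c y ⊛ X ⊕ ⊖ ⊖ contract y (contract x G′) cs)
    ≡⟨ solve 5 (λ cx Y cy X r → cx :* Y :+ :- (cy :* X :+ :- (:- r)) := :- (cy :* X :+ :- (cx :* Y :+ :- r))) refl
        (matches c x) Y (matches c y) X (contract y (contract x G′) cs) ⟩
  ⊖ (matches c y ⊛ X ⊕ ⊖ (matches c x ⊛ Y ⊕ ⊖ contract y (contract x G′) cs))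
    ≡⟨ cong (λ z → ⊖ (matches c y ⊛ X ⊕ ⊖ z)) (step y x) ⟨
  ⊖ (matches c y ⊛ X ⊕ ⊖ contract y (λ u → matches c x ⊛ G u ⊕ ⊖ contract x G′ u) cs) ∎
  where
  G′ : Vec ℕ m → ℚ
  G′ u = G (c ∷ u)
  X = contract x G cs
  Y = contract y G cs
  step : ∀ x y → contract x (λ u → matches c y ⊛ G u ⊕ ⊖ contract y G′ u) cs ≡ matches c y ⊛ contract x G cs ⊕ ⊖ contract x (contract y G′) cs
  step x y = begin
    contract x (λ u → matches c y ⊛ G u ⊕ ⊖ contract y G′ u) cs
      ≡⟨ contract-cong x (λ u → cong (matches c y ⊛ G u ⊕_) (minus (contract y G′ u))) cs ⟩
    contract x (λ u → matches c y ⊛ G u ⊕ (⊖ 1ℚ) ⊛ contract y G′ u) cs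
      ≡⟨ contract-linear x (matches c y) (⊖ 1ℚ) G (contract y G′) cs ⟩
    matches c y ⊛ contract x G cs ⊕ (⊖ 1ℚ) ⊛ contract x (contract y G′) cs
      ≡⟨ cong (matches c y ⊛ contract x G cs ⊕_) (minus (contract x (contract y G′) cs)) ⟨
    matches c y ⊛ contract x G cs ⊕ ⊖ contract x (contract y G′) cs ∎
    where
    minus : ∀ q → ⊖ q ≡ (⊖ 1ℚ) ⊛ q
    minus q = solve 1 (λ q → :- q := (:- con 1ℚ) :* q) refl q

contract-degree : ∀ {m} x {G : Vec ℕ m → ℚ} cs → (∀ u → x ℕ.+ Vec.sum u ≡ Vec.sum cs → G u ≡ 0ℚ) → contract x G cs ≡ 0ℚ
contract-degree {zero} x {G} (c ∷ []) h with c ℕ.≟ x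
... | yes refl = trans (ℚP.*-identityˡ (G [])) (h [] refl)
... | no _     = ℚP.*-zeroˡ (G [])
contract-degree {suc m} x {G} (c ∷ cs) h = cong₂ (λ a b → a ⊕ ⊖ b) head
  (contract-degree x {λ u → G (c ∷ u)} cs (λ u eq → h (c ∷ u) (trans (+-left-comm x c _) (cong (c ℕ.+_) eq))))
  where
  head : matches c x ⊛ G cs ≡ 0ℚ
  head with c ℕ.≟ x
  ... | yes refl = trans (ℚP.*-identityˡ (G cs)) (h cs refl)
  ... | no _     = ℚP.*-zeroˡ (G cs)

contract-absent : ∀ {m} x {G : Vec ℕ m → ℚ} {cs} → VecAll.All (_≢ x) cs → contract x G cs ≡ 0ℚ
contract-absent {zero}  x {G} {c ∷ []} (c≢x ∷ []) = trans (cong (_⊛ G []) (matches-≢ c≢x)) (ℚP.*-zeroˡ (G []))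
contract-absent {suc m} x {G} {c ∷ cs} (c≢x ∷ abs) = cong₂ (λ a b → a ⊕ ⊖ b)
  (trans (cong (_⊛ G cs) (matches-≢ c≢x)) (ℚP.*-zeroˡ (G cs))) (contract-absent x abs)

contract-tabulate : ∀ {m} x (G : Vec ℕ m → ℚ) (ex : Fin (suc m) → ℕ) → contract x G (tabulate ex) ≡
  sumL (λ j → sign (toℕ j) ⊛ (matches (ex j) x ⊛ G (tabulate (ex ∘ punchIn j)))) (allFin (suc m))
contract-tabulate {zero}  x G ex = solve 1 (λ a → a := con 1ℚ :* a :+ con 0ℚ) refl (matches (ex zero) x ⊛ G [])
contract-tabulate {suc m} x G ex = begin
  head ⊕ ⊖ contract x (λ u → G (ex zero ∷ u)) (tabulate (ex ∘ suc))
    ≡⟨ cong (λ z → head ⊕ ⊖ z) (contract-tabulate x _ (ex ∘ suc)) ⟩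
  head ⊕ ⊖ sumL (λ j → sign (toℕ j) ⊛ rest j) (allFin (suc m))
    ≡⟨ cong₂ _⊕_ (sym (ℚP.*-identityˡ head)) (trans (sym (sumL-⊖ (λ j → sign (toℕ j) ⊛ rest j) (allFin (suc m)))) (sumL-cong (λ j → ℚP.neg-distribˡ-* (sign (toℕ j)) (rest j)) (allFin (suc m)))) ⟩
  1ℚ ⊛ head ⊕ sumL (λ j → (⊖ sign (toℕ j)) ⊛ rest j) (allFin (suc m))
    ≡⟨ sumL-allFin (λ j → sign (toℕ j) ⊛ (matches (ex j) x ⊛ G (tabulate (ex ∘ punchIn j)))) ⟨
  sumL (λ j → sign (toℕ j) ⊛ (matches (ex j) x ⊛ G (tabulate (ex ∘ punchIn j)))) (allFin (2 ℕ.+ m)) ∎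
  where
  head = matches (ex zero) x ⊛ G (tabulate (ex ∘ suc))
  rest : Fin (suc m) → ℚ
  rest j = matches (ex (suc j)) x ⊛ G (ex zero ∷ tabulate (ex ∘ suc ∘ punchIn j))

-- The determinant of the 0-1 matrix with entries `matches` cⱼ xᵢ, restricted to cells with
-- y-exponent 0. These are the divided-power coefficients of det (xᵢ^cⱼ / cⱼ!), as `⟦⟧-det` shows.
slater : ∀ {m} → Vec Cell m → Vec ℕ m → ℚ
slater []            _  = 1ℚ
slater ((x , y) ∷ v) cs = matches 0 y ⊛ contract x (slater v) cs

slater-antisym : ∀ {m} (cs : Vec ℕ m) → Antisym (λ v → slater v cs)
slater-antisym cs (swap (x , y) (x′ , y′) v) = begin
  matches 0 y ⊛ contract x (λ u → matches 0 y′ ⊛ contract x′ (slater v) u) cs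
    ≡⟨ cong (matches 0 y ⊛_) (contract-* x (matches 0 y′) (contract x′ (slater v)) cs) ⟩
  matches 0 y ⊛ (matches 0 y′ ⊛ contract x (contract x′ (slater v)) cs)
    ≡⟨ cong (λ z → matches 0 y ⊛ (matches 0 y′ ⊛ z)) (contract-swap x x′ (slater v) cs) ⟩
  matches 0 y ⊛ (matches 0 y′ ⊛ (⊖ contract x′ (contract x (slater v)) cs))
    ≡⟨ solve 3 (λ a b c → a :* (b :* (:- c)) := :- (b :* (a :* c))) refl (matches 0 y) (matches 0 y′) (contract x′ (contract x (slater v)) cs) ⟩
  ⊖ (matches 0 y′ ⊛ (matches 0 y ⊛ contract x′ (contract x (slater v)) cs))
    ≡⟨ cong (λ z → ⊖ (matches 0 y′ ⊛ z)) (contract-* x′ (matches 0 y) (contract x (slater v)) cs) ⟨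
  ⊖ (matches 0 y′ ⊛ contract x′ (λ u → matches 0 y ⊛ contract x (slater v) u) cs) ∎
slater-antisym cs (skip (x , y) {u} {v} s) = begin
  matches 0 y ⊛ contract x (slater u) cs
    ≡⟨ cong (matches 0 y ⊛_) (contract-cong x (λ ds → trans (slater-antisym ds s) (solve 1 (λ a → :- a := (:- con 1ℚ) :* a) refl (slater v ds))) cs) ⟩
  matches 0 y ⊛ contract x (λ ds → (⊖ 1ℚ) ⊛ slater v ds) cs
    ≡⟨ cong (matches 0 y ⊛_) (contract-* x (⊖ 1ℚ) (slater v) cs) ⟩
  matches 0 y ⊛ ((⊖ 1ℚ) ⊛ contract x (slater v) cs)
    ≡⟨ solve 2 (λ a b → a :* ((:- con 1ℚ) :* b) := :- (a :* b)) refl (matches 0 y) (contract x (slater v) cs) ⟩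
  ⊖ (matches 0 y ⊛ contract x (slater v) cs) ∎

slater-x-degree : ∀ {m} (v : Vec Cell m) cs → xDegree v ≢ Vec.sum cs → slater v cs ≡ 0ℚ
slater-x-degree []            []  ne = contradiction refl ne
slater-x-degree ((x , y) ∷ v) cs ne = trans (cong (matches 0 y ⊛_)
  (contract-degree x cs (λ u eq → slater-x-degree v u (λ deg → ne (trans (cong (x ℕ.+_) deg) eq))))) (ℚP.*-zeroʳ (matches 0 y))

slater-y-degree : ∀ {m} (v : Vec Cell m) cs → yDegree v ≢ 0 → slater v cs ≡ 0ℚ
slater-y-degree []                []  ne = contradiction refl ne
slater-y-degree ((x , zero) ∷ v)  cs ne = trans (ℚP.*-identityˡ _) (contract-≡0 x (λ u → slater-y-degree v u ne) cs)
slater-y-degree ((x , suc y) ∷ v) cs ne = ℚP.*-zeroˡ (contract x (slater v) cs)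

downFrom : ∀ m → Vec ℕ m
downFrom zero    = []
downFrom (suc m) = m ∷ downFrom m

-- The exponents decrease strictly, so the row of the largest one matches only the first column, and
-- the matrix is the identity.
slater-diagonal : ∀ m → slater (Vec.map flat (downFrom m)) (downFrom m) ≡ 1ℚ
slater-diagonal zero    = refl
slater-diagonal (suc m) = trans (ℚP.*-identityˡ _) (diagonal m)
  where
  absent : ∀ {k} m → m ≤ k → VecAll.All (_≢ k) (downFrom m)
  absent zero    _   = []
  absent (suc m) m<k = ℕP.<⇒≢ m<k ∷ absent m (ℕP.<⇒≤ m<k)
  diagonal : ∀ m → contract m (slater (Vec.map flat (downFrom m))) (m ∷ downFrom m) ≡ 1ℚ
  diagonal zero    = refl
  diagonal (suc m) = begin
    matches (suc m) (suc m) ⊛ slater (Vec.map flat (downFrom (suc m))) (downFrom (suc m)) ⊕ ⊖ contract (suc m) _ (downFrom (suc m))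
      ≡⟨ cong₂ (λ a b → a ⊕ ⊖ b) (cong₂ _⊛_ (matches-refl (suc m)) (slater-diagonal (suc m))) (contract-absent (suc m) (absent (suc m) ℕP.≤-refl)) ⟩
    1ℚ ∎

-- `det` keeps the number of variables fixed while the matrix shrinks. A minor that omits the first
-- row does not involve the first variable, so it is the `lift` of a determinant in one variable
-- fewer, and induction becomes possible.
lift : ∀ {n} → Poly n → Poly (suc n)
lift = map (λ (c , a , b) → c , 0 ∷ a , 0 ∷ b)

lift-+ : ∀ {n} (P Q : Poly n) → lift (P ++ Q) ≡ lift P ++ lift Q
lift-+ P Q = ListP.map-++ _ P Q

lift-sumP : ∀ {n} {I : Set} (F : I → Poly n) l → sumP (map (lift ∘ F) l) ≡ lift (sumP (map F l))
lift-sumP F []      = refl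
lift-sumP F (i ∷ l) = trans (cong (lift (F i) ++_) (lift-sumP F l)) (sym (lift-+ (F i) _))

lift-• : ∀ {n} c (P : Poly n) → c • lift P ≡ lift (c • P)
lift-• c []      = refl
lift-• c (t ∷ P) = cong (_ ∷_) (lift-• c P)

lift-* : ∀ {n} (P Q : Poly n) → lift P *P lift Q ≡ lift (P *P Q)
lift-* []      Q = refl
lift-* (t ∷ P) Q = trans (cong₂ _++_ (trans (sym (ListP.map-∘ Q)) (ListP.map-∘ Q)) (lift-* P Q)) (sym (ListP.map-++ _ _ (P *P Q)))

lift-det : ∀ {n} m (M : Fin m → Fin m → Poly n) → det m (λ r c → lift (M r c)) ≡ lift (det m M)
lift-det zero    M = refl
lift-det (suc m) M = trans (cong sumP (ListP.map-cong summand (allFin (suc m))))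
  (lift-sumP (λ j → sign (toℕ j) • (M zero j *P det m (minor j))) (allFin (suc m)))
  where
  minor : Fin (suc m) → Fin m → Fin m → Poly _
  minor j r c = M (suc r) (punchIn j c)
  summand : ∀ j → sign (toℕ j) • (lift (M zero j) *P det m (λ r c → lift (minor j r c))) ≡ lift (sign (toℕ j) • (M zero j *P det m (minor j)))
  summand j = trans (cong (λ D → sign (toℕ j) • (lift (M zero j) *P D)) (lift-det m (minor j)))
    (trans (cong (sign (toℕ j) •_) (lift-* (M zero j) (det m (minor j)))) (lift-• (sign (toℕ j)) (M zero j *P det m (minor j))))

reciprocal : ∀ d .{{_ : ℕ.NonZero d}} → nℚ d ⊛ ((+ 1) ℚ./ d) ≡ 1ℚ
reciprocal (suc d) = ℚP.toℚᵘ-injective (ℚᵘP.≃-trans (ℚP.toℚᵘ-homo-* (nℚ (suc d)) ((+ 1) ℚ./ suc d))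
  (ℚᵘP.≃-trans (ℚᵘP.*-cong (ℚP.toℚᵘ-fromℚᵘ (ℚᵘ.mkℚᵘ (+ suc d) 0)) (ℚP.toℚᵘ-fromℚᵘ (ℚᵘ.mkℚᵘ (+ 1) d)))
    (ℚᵘ.*≡* (trans (ℤP.*-identityʳ _) (trans (ℤP.*-identityʳ (+ suc d)) (trans (cong +_ (sym (ℕP.+-identityʳ (suc d)))) (sym (ℤP.*-identityˡ _))))))))

1/! : ℕ → ℚ
1/! e = ((+ 1) ℚ./ (e !)) {{e ℕP.!≢0}}

module _ {n} (e : ℕ) (Q : Poly n) where

  rowTerm : Term n → Term (suc n)
  rowTerm (d , a , b) = 1/! e ⊛ d , (e ℕ.+ 0) ∷ zipWith ℕ._+_ (replicate n 0) a , 0 ∷ zipWith ℕ._+_ (replicate n 0) b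

  row-map : xpow/fact zero e *P lift Q ≡ map rowTerm Q
  row-map = trans (ListP.++-identityʳ _) (sym (ListP.map-∘ Q))

  coeff-row : ∀ a b → coeff (xpow/fact zero e *P lift Q) (e ∷ a) (0 ∷ b) ≡ 1/! e ⊛ coeff Q a b
  coeff-row a b = trans (cong (λ P → coeff P (e ∷ a) (0 ∷ b)) row-map) (coeff-map rowTerm (1/! e) (λ t → termCoeff-scale (rowTerm t) t (1/! e)
    (λ at → inj₂ (trans (sym (add-0 _)) (VecP.∷-injectiveʳ (proj₁ at)) , trans (sym (add-0 _)) (VecP.∷-injectiveʳ (proj₂ at))))
    (λ at → (cong₂ _∷_ (ℕP.+-identityʳ e) (trans (add-0 _) (proj₁ at)) , cong (0 ∷_) (trans (add-0 _) (proj₂ at))) , refl)) Q)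
    where
    add-0 : ∀ (u : Vec ℕ n) → zipWith ℕ._+_ (replicate n 0) u ≡ u
    add-0 = VecP.zipWith-identityˡ ℕP.+-identityˡ

  coeff-row-miss : ∀ x y a b → e ≢ x ⊎ 0 ≢ y → coeff (xpow/fact zero e *P lift Q) (x ∷ a) (y ∷ b) ≡ 0ℚ
  coeff-row-miss x y a b ne = trans (cong (λ P → coeff P (x ∷ a) (y ∷ b)) row-map) (trans
    (coeff-map rowTerm 0ℚ {a′ = a} {b} (λ t → trans (termCoeff-no (rowTerm t) (miss {t} ne)) (sym (ℚP.*-zeroˡ (termCoeff t a b)))) Q)
    (ℚP.*-zeroˡ (coeff Q a b)))
    where
    miss : ∀ {t} → e ≢ x ⊎ 0 ≢ y → ¬ At (rowTerm t) (x ∷ a) (y ∷ b)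
    miss (inj₁ e≢x) at = e≢x (trans (sym (ℕP.+-identityʳ e)) (VecP.∷-injectiveˡ (proj₁ at)))
    miss (inj₂ 0≢y) at = 0≢y (VecP.∷-injectiveˡ (proj₂ at))

  ⟦⟧-row : ∀ x y v → ⟦ xpow/fact zero e *P lift Q ⟧ ((x , y) ∷ v) ≡ matches e x ⊛ (matches 0 y ⊛ ⟦ Q ⟧ v)
  ⟦⟧-row x y v with e ℕ.≟ x | 0 ℕ.≟ y
  ... | no e≢x | yes _ = trans (⟦⟧-zero {P = xpow/fact zero e *P lift Q} {(x , y) ∷ v} (coeff-row-miss x y _ _ (inj₁ e≢x))) (sym (ℚP.*-zeroˡ (1ℚ ⊛ ⟦ Q ⟧ v)))
  ... | no e≢x | no _  = trans (⟦⟧-zero {P = xpow/fact zero e *P lift Q} {(x , y) ∷ v} (coeff-row-miss x y _ _ (inj₁ e≢x))) (sym (ℚP.*-zeroˡ (0ℚ ⊛ ⟦ Q ⟧ v)))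
  ... | yes _ | no 0≢y = trans (⟦⟧-zero {P = xpow/fact zero e *P lift Q} {(x , y) ∷ v} (coeff-row-miss x y _ _ (inj₂ 0≢y)))
          (sym (trans (ℚP.*-identityˡ _) (ℚP.*-zeroˡ (⟦ Q ⟧ v))))
  ... | yes refl | yes refl = begin
    (nℚ (e !) ⊛ fa) ⊛ (1ℚ ⊛ fb) ⊛ coeff (xpow/fact zero e *P lift Q) (e ∷ Vec.map proj₁ v) (0 ∷ Vec.map proj₂ v)
      ≡⟨ cong ((nℚ (e !) ⊛ fa) ⊛ (1ℚ ⊛ fb) ⊛_) (coeff-row _ _) ⟩
    (nℚ (e !) ⊛ fa) ⊛ (1ℚ ⊛ fb) ⊛ (1/! e ⊛ c)
      ≡⟨ solve 5 (λ n a b r c → (n :* a) :* (con 1ℚ :* b) :* (r :* c) := (n :* r) :* (a :* b :* c)) refl (nℚ (e !)) fa fb (1/! e) c ⟩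
    (nℚ (e !) ⊛ 1/! e) ⊛ (fa ⊛ fb ⊛ c)
      ≡⟨ cong (_⊛ (fa ⊛ fb ⊛ c)) (reciprocal (e !) {{e ℕP.!≢0}}) ⟩
    1ℚ ⊛ (fa ⊛ fb ⊛ c)
      ≡⟨ cong (1ℚ ⊛_) (ℚP.*-identityˡ (fa ⊛ fb ⊛ c)) ⟨
    1ℚ ⊛ (1ℚ ⊛ ⟦ Q ⟧ v) ∎
    where
    fa = facts (Vec.map proj₁ v)
    fb = facts (Vec.map proj₂ v)
    c = coeff Q (Vec.map proj₁ v) (Vec.map proj₂ v)

⟦⟧-det : ∀ {m} (ex : Fin m → ℕ) v → ⟦ det m (λ i j → xpow/fact i (ex j)) ⟧ v ≡ slater v (tabulate ex)
⟦⟧-det {zero}  ex [] = refl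
⟦⟧-det {suc m} ex ((x , y) ∷ v) = begin
  ⟦ det (suc m) (λ i j → xpow/fact i (ex j)) ⟧ ((x , y) ∷ v)
    ≡⟨ ⟦⟧-sumP summand (allFin (suc m)) ((x , y) ∷ v) ⟩
  sumL (λ j → ⟦ summand j ⟧ ((x , y) ∷ v)) (allFin (suc m))
    ≡⟨ sumL-cong step (allFin (suc m)) ⟩
  sumL (λ j → matches 0 y ⊛ (sign (toℕ j) ⊛ (matches (ex j) x ⊛ slater v (tabulate (ex ∘ punchIn j))))) (allFin (suc m))
    ≡⟨ sumL-* (matches 0 y) _ (allFin (suc m)) ⟩
  matches 0 y ⊛ sumL (λ j → sign (toℕ j) ⊛ (matches (ex j) x ⊛ slater v (tabulate (ex ∘ punchIn j)))) (allFin (suc m))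
    ≡⟨ cong (matches 0 y ⊛_) (contract-tabulate x (slater v) ex) ⟨
  matches 0 y ⊛ contract x (slater v) (tabulate ex) ∎
  where
  minor : Fin (suc m) → Fin m → Fin m → Poly m
  minor j r c = xpow/fact r (ex (punchIn j c))
  summand : Fin (suc m) → Poly (suc m)
  -- `xpow/fact (suc r) e` computes to `lift (xpow/fact r e)`, so this is definitionally the summand
  -- of `det`.
  summand j = sign (toℕ j) • (xpow/fact zero (ex j) *P det m (λ r c → lift (minor j r c)))
  step : ∀ j → ⟦ summand j ⟧ ((x , y) ∷ v) ≡ matches 0 y ⊛ (sign (toℕ j) ⊛ (matches (ex j) x ⊛ slater v (tabulate (ex ∘ punchIn j))))
  step j = begin
    ⟦ summand j ⟧ ((x , y) ∷ v)
      ≡⟨ ⟦⟧-• (sign (toℕ j)) (xpow/fact zero (ex j) *P det m (λ r c → lift (minor j r c))) ((x , y) ∷ v) ⟩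
    sign (toℕ j) ⊛ ⟦ xpow/fact zero (ex j) *P det m (λ r c → lift (minor j r c)) ⟧ ((x , y) ∷ v)
      ≡⟨ cong (λ D → sign (toℕ j) ⊛ ⟦ xpow/fact zero (ex j) *P D ⟧ ((x , y) ∷ v)) (lift-det m (minor j)) ⟩
    sign (toℕ j) ⊛ ⟦ xpow/fact zero (ex j) *P lift (det m (minor j)) ⟧ ((x , y) ∷ v)
      ≡⟨ cong (sign (toℕ j) ⊛_) (trans (⟦⟧-row (ex j) (det m (minor j)) x y v) (cong (λ z → matches (ex j) x ⊛ (matches 0 y ⊛ z)) (⟦⟧-det (ex ∘ punchIn j) v))) ⟩
    sign (toℕ j) ⊛ (matches (ex j) x ⊛ (matches 0 y ⊛ slater v (tabulate (ex ∘ punchIn j))))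
      ≡⟨ solve 4 (λ s a b c → s :* (a :* (b :* c)) := b :* (s :* (a :* c))) refl (sign (toℕ j)) (matches (ex j) x) (matches 0 y) (slater v (tabulate (ex ∘ punchIn j))) ⟩
    matches 0 y ⊛ (sign (toℕ j) ⊛ (matches (ex j) x ⊛ slater v (tabulate (ex ∘ punchIn j)))) ∎

⟦Δ⟧ : ∀ n v → ⟦ Δ n ⟧ v ≡ slater v (downFrom n)
⟦Δ⟧ n v = trans (⟦⟧-det (λ j → n ∸ 1 ∸ toℕ j) v) (cong (slater v) (columns n))
  where
  columns : ∀ n → tabulate {n = n} (λ j → n ∸ 1 ∸ toℕ j) ≡ downFrom n
  columns zero    = refl
  columns (suc n) = cong (n ∷_) (trans (VecP.tabulate-cong (λ j → sym (ℕP.∸-+-assoc n 1 (toℕ j)))) (columns n))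

-- Degree bounds and the harmonicity of Δ

sum-⇄* : ∀ {n} {u v : Vec ℕ n} → u ⇄* v → Vec.sum u ≡ Vec.sum v
sum-⇄* ε       = refl
sum-⇄* (s ◅ p) = trans (sum-⇄ s) (sum-⇄* p)
  where
  sum-⇄ : ∀ {n} {u v : Vec ℕ n} → u ⇄ v → Vec.sum u ≡ Vec.sum v
  sum-⇄ (swap x y v) = +-left-comm x y (Vec.sum v)
  sum-⇄ (skip x s)   = cong (x ℕ.+_) (sum-⇄ s)

sum-map-suc : ∀ {n} (v : Vec ℕ n) → Vec.sum (Vec.map suc v) ≡ n ℕ.+ Vec.sum v
sum-map-suc []      = refl
sum-map-suc {suc n} (x ∷ v) = cong suc (trans (cong (x ℕ.+_) (sum-map-suc v)) (+-left-comm x n (Vec.sum v)))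

triangle-suc : ∀ n → triangle (suc n) ≡ n ℕ.+ triangle n
triangle-suc n = sum-map-suc (staircase n)

sum-downFrom : ∀ n → Vec.sum (downFrom n) ≡ triangle n
sum-downFrom zero    = refl
sum-downFrom (suc n) = trans (cong (n ℕ.+_) (sum-downFrom n)) (sym (triangle-suc n))

-- A non-zero value needs distinct entries, whose sum is at least 0 + 1 + ⋯ + (m - 1). For
-- termination, `fuel` decreases when all entries are lowered by one, and stays the same when a 0 is
-- removed and m drops.
antisym-low : ∀ {m} fuel {f : Vec ℕ m → ℚ} → Antisym f → ∀ v → Vec.sum v < fuel → Vec.sum v < triangle m → f v ≡ 0ℚ
antisym-low {suc m} (suc fuel) {f} anti v <fuel <tri with positive-or-zero v
... | inj₁ (u , refl) = antisym-low fuel (λ s → anti (⇄-map suc s)) u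
        (ℕP.<-≤-trans (ℕP.≤-<-trans (ℕP.m≤n+m (Vec.sum u) m) (subst (suc m ℕ.+ Vec.sum u ≤_) refl (ℕP.≤-reflexive (sym (sum-map-suc u))))) (ℕP.≤-pred <fuel))
        (ℕP.≤-<-trans (ℕP.≤-trans (ℕP.m≤n+m (Vec.sum u) (suc m)) (ℕP.≤-reflexive (sym (sum-map-suc u)))) <tri)
... | inj₂ (u , p) = antisym-≡0 anti p (zero-head u (subst (_< suc fuel) (sum-⇄* p) <fuel) (subst (_< triangle (suc m)) (sum-⇄* p) <tri))
  where
  low : ∀ u → Vec.sum u < suc fuel → Vec.sum u < triangle m → f (0 ∷ Vec.map suc u) ≡ 0ℚ
  low = antisym-low (suc fuel) (λ s → anti (skip 0 (⇄-map suc s)))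
  zero-head : ∀ u → Vec.sum u < suc fuel → Vec.sum u < triangle (suc m) → f (0 ∷ u) ≡ 0ℚ
  zero-head u <fuel <tri = split m f anti low u <fuel <tri
    where
    split : ∀ m (f : Vec ℕ (suc m) → ℚ) → Antisym f → (∀ u → Vec.sum u < suc fuel → Vec.sum u < triangle m → f (0 ∷ Vec.map suc u) ≡ 0ℚ) →
      ∀ u → Vec.sum u < suc fuel → Vec.sum u < triangle (suc m) → f (0 ∷ u) ≡ 0ℚ
    split zero    f anti low []        <fuel <tri = low [] <fuel <tri
    split (suc m) f anti low u@(_ ∷ _) <fuel <tri with positive-or-zero u
    ... | inj₂ (t , p)  = antisym-repeat anti p
    ... | inj₁ (t , u≡) = trans (cong (λ z → f (0 ∷ z)) u≡) (low t
            (ℕP.≤-<-trans (ℕP.≤-trans (ℕP.m≤n+m (Vec.sum t) (suc m)) (ℕP.≤-reflexive (sym sum-u))) <fuel)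
            (ℕP.+-cancelˡ-< (suc m) _ _ (subst₂ _<_ sum-u (triangle-suc (suc m)) <tri)))
      where
      sum-u : Vec.sum u ≡ suc m ℕ.+ Vec.sum t
      sum-u = trans (cong Vec.sum u≡) (sum-map-suc t)

map-proj₁-flat : ∀ {n} (e : Vec ℕ n) → Vec.map proj₁ (Vec.map flat e) ≡ e
map-proj₁-flat []      = refl
map-proj₁-flat (x ∷ e) = cong (x ∷_) (map-proj₁-flat e)

-- A power sum of derivatives preserves antisymmetry, so the result vanishes below the degree of the
-- staircase by `antisym-low`. From that degree on, it only involves coefficients of Δ above the
-- degree of Δ. A derivative in y gives 0 because Δ is free of y.
slater-harmonic : ∀ {n} a b → 0 < a ℕ.+ b → ∀ (v : Vec Cell n) → moves one (shift a b) (λ u → slater u (downFrom n)) v ≡ 0ℚ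
slater-harmonic {n} a (suc b) _ v = moves-degree proj₂ 0 (suc b) (λ (_ , q) → inj₂ (trans (ℕP.+-identityʳ _) (ℕP.+-comm (suc b) q))) v
  (λ u eq → slater-y-degree u (downFrom n) (λ u≡0 → ℕP.0≢1+n (trans (sym u≡0) (trans (sym (ℕP.+-identityʳ _)) (trans eq (ℕP.+-suc (yDegree v) b))))))
slater-harmonic {n} (suc a) zero _ v with yDegree v ℕ.≟ 0
... | no ≢0 = moves-degree proj₂ 0 0 (λ _ → inj₂ refl) v
  (λ u eq → slater-y-degree u (downFrom n) (λ u≡0 → ≢0 (trans (sym (ℕP.+-identityʳ _)) (trans (sym eq) (trans (ℕP.+-identityʳ _) u≡0)))))
... | yes ≡0 = trans (cong M (yDegree-0 v ≡0)) (trans (moves-map flat (λ _ → refl) (λ _ → refl) T e) flat-case)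
  where
  T : Vec Cell n → ℚ
  T u = slater u (downFrom n)
  M : Vec Cell n → ℚ
  M = moves one (shift (suc a) 0) T
  e : Vec ℕ n
  e = Vec.map proj₁ v
  flat-case : moves one (suc a ℕ.+_) (T ∘ Vec.map flat) e ≡ 0ℚ
  flat-case with Vec.sum e ℕP.<? triangle n
  ... | yes <tri = antisym-low (suc (Vec.sum e)) (moves-antisym (λ s → slater-antisym (downFrom n) (⇄-map flat s))) e ℕP.≤-refl <tri
  ... | no ≮tri = moves-degree id 0 (suc a) (λ x → inj₂ (trans (ℕP.+-identityʳ _) (ℕP.+-comm (suc a) x))) e
    (λ u eq → slater-x-degree (Vec.map flat u) (downFrom n) (λ u≡ → ≮tri (subst₂ _<_ (cong Vec.sum (VecP.map-id e))
      (trans (sym (trans (sym (ℕP.+-identityʳ _)) eq)) (trans (cong Vec.sum (trans (VecP.map-id u) (sym (map-proj₁-flat u)))) (trans u≡ (sum-downFrom n))))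
      (subst (Vec.sum (Vec.map id e) <_) (sym (ℕP.+-suc _ a)) (ℕ.s≤s (ℕP.m≤m+n _ a))))))

slater-alternant : ∀ {n} → Alternant {n} 0 0 (λ v → slater v (downFrom n))
slater-alternant {n} = record
  { harmonic = slater-harmonic
  ; antisym  = slater-antisym (downFrom n)
  ; x-degree = λ v ne → slater-x-degree v (downFrom n) (λ eq → ne (trans eq (sum-downFrom n)))
  ; y-degree = λ v → slater-y-degree v (downFrom n)
  }

-- Bases by triangular elimination

alternant-cong : ∀ {n k l} {C D : Vec Cell n → ℚ} → (∀ v → D v ≡ C v) → Alternant k l C → Alternant k l D
alternant-cong eq A = record
  { harmonic = λ a b 0< v → trans (moves-cong eq v) (A .harmonic a b 0< v)
  ; antisym  = λ {u} {v} s → trans (eq u) (trans (A .antisym s) (cong ⊖_ (sym (eq v))))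
  ; x-degree = λ v ne → trans (eq v) (A .x-degree v ne)
  ; y-degree = λ v ne → trans (eq v) (A .y-degree v ne)
  }

alternant-linear : ∀ {n k l} {C D : Vec Cell n → ℚ} → Alternant k l C → ∀ c → Alternant k l D → Alternant k l (λ v → C v ⊕ c ⊛ D v)
alternant-linear {C = C} {D} A c B = record
  { harmonic = λ a b 0< v → trans (moves-+ C (λ u → c ⊛ D u) v)
      (0+ (A .harmonic a b 0< v) (trans (moves-* c D v) (scale (B .harmonic a b 0< v))))
  ; antisym  = λ {u} {v} s → trans (cong₂ (λ a b → a ⊕ c ⊛ b) (A .antisym s) (B .antisym s))
      (solve 3 (λ a c b → (:- a) :+ c :* (:- b) := :- (a :+ c :* b)) refl (C v) c (D v))
  ; x-degree = λ v ne → 0+ (A .x-degree v ne) (scale (B .x-degree v ne))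
  ; y-degree = λ v ne → 0+ (A .y-degree v ne) (scale (B .y-degree v ne))
  }
  where
  scale : ∀ {q} → q ≡ 0ℚ → c ⊛ q ≡ 0ℚ
  scale eq = trans (cong (c ⊛_) eq) (ℚP.*-zeroʳ c)

⟦⟧-+• : ∀ {n} (P : Poly n) c Q v → ⟦ P +P c • Q ⟧ v ≡ ⟦ P ⟧ v ⊕ c ⊛ ⟦ Q ⟧ v
⟦⟧-+• P c Q v = trans (⟦⟧-+ P (c • Q) v) (cong (⟦ P ⟧ v ⊕_) (⟦⟧-• c Q v))

module _ {n : ℕ} where

  basis-resp : ∀ {S T : Poly n → Set} {bs} → (∀ P → S P → T P) → (∀ P → T P → S P) → IsBasis S bs → IsBasis T bs
  basis-resp to from (mem , ind , span) = ListAll.map (to _) mem , ind , λ P TP → span P (from P TP)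

  basis-[] : ∀ {S : Poly n → Set} → (∀ P → S P → P ≈ zeroP) → IsBasis S []
  basis-[] h = [] , (λ { [] _ _ → [] }) , λ P SP → [] , refl , h P SP

  -- The functional P ↦ ⟦ P ⟧ u is non-zero at b. Subtracting ⟦ P ⟧ u / ⟦ b ⟧ u times b takes any P
  -- in S into its kernel, of which bs is a basis; applied to a linear relation, the functional
  -- isolates the coefficient of b.
  basis-∷ : ∀ {S : Poly n → Set} → (∀ P Q c → S P → S Q → S (P +P c • Q)) → ∀ u b bs → S b → ⟦ b ⟧ u ≢0 →
    IsBasis (λ P → S P × ⟦ P ⟧ u ≡ 0ℚ) bs → IsBasis S (b ∷ bs)
  basis-∷ {S} closed u b bs Sb bu≢0 (mem , ind , span) = Sb ∷ ListAll.map proj₁ mem , independent , spanning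
    where
    lincomb-u : ∀ cs {bs} → All (λ P → S P × ⟦ P ⟧ u ≡ 0ℚ) bs → ⟦ lincomb cs bs ⟧ u ≡ 0ℚ
    lincomb-u []       _  = ℚP.*-zeroʳ (weight u)
    lincomb-u (c ∷ cs) [] = ℚP.*-zeroʳ (weight u)
    lincomb-u (c ∷ cs) {d ∷ bs} ((_ , d0) ∷ mem) = trans (⟦⟧-+ (c • d) (lincomb cs bs) u)
      (0+ (trans (⟦⟧-• c d u) (trans (cong (c ⊛_) d0) (ℚP.*-zeroʳ c))) (lincomb-u cs mem))

    independent : LinIndep (b ∷ bs)
    independent (c ∷ cs) len eq = c≡0 ∷ ind cs (ℕP.suc-injective len) rest
      where
      c≡0 : c ≡ 0ℚ
      c≡0 = *-cancel-0 bu≢0 (begin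
        ⟦ b ⟧ u ⊛ c                            ≡⟨ solve 2 (λ b c → b :* c := c :* b :+ con 0ℚ) refl (⟦ b ⟧ u) c ⟩
        c ⊛ ⟦ b ⟧ u ⊕ 0ℚ                       ≡⟨ cong₂ _⊕_ (⟦⟧-• c b u) (lincomb-u cs mem) ⟨
        ⟦ c • b ⟧ u ⊕ ⟦ lincomb cs bs ⟧ u      ≡⟨ ⟦⟧-+ (c • b) (lincomb cs bs) u ⟨
        ⟦ lincomb (c ∷ cs) (b ∷ bs) ⟧ u        ≡⟨ ⟦⟧-cong {P = lincomb (c ∷ cs) (b ∷ bs)} {zeroP} eq u ⟩
        ⟦ zeroP ⟧ u                            ≡⟨ ℚP.*-zeroʳ (weight u) ⟩
        0ℚ ∎)
      rest : lincomb cs bs ≈ zeroP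
      rest x y = begin
        r                                      ≡⟨ solve 2 (λ r k → r := con 0ℚ :* k :+ r) refl r (coeff b x y) ⟩
        0ℚ ⊛ coeff b x y ⊕ r                   ≡⟨ cong (λ d → d ⊛ coeff b x y ⊕ r) c≡0 ⟨
        c ⊛ coeff b x y ⊕ r                    ≡⟨ cong (_⊕ r) (coeff-• c b x y) ⟨
        coeff (c • b) x y ⊕ r                  ≡⟨ coeff-++ (c • b) (lincomb cs bs) x y ⟨
        coeff (lincomb (c ∷ cs) (b ∷ bs)) x y  ≡⟨ eq x y ⟩
        0ℚ ∎
        where r = coeff (lincomb cs bs) x y

    spanning : Spans S (b ∷ bs)
    spanning P SP = c ∷ cs , cong suc len , combine
      where
      instance _ = ℚ.≢-nonZero bu≢0
      c : ℚ
      c = ⟦ P ⟧ u ⊛ ℚ.1/ ⟦ b ⟧ u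
      reduced : Poly n
      reduced = P +P (⊖ c) • b
      reduced-u : ⟦ reduced ⟧ u ≡ 0ℚ
      reduced-u = begin
        ⟦ reduced ⟧ u ≡⟨ ⟦⟧-+• P (⊖ c) b u ⟩
        ⟦ P ⟧ u ⊕ (⊖ c) ⊛ ⟦ b ⟧ u ≡⟨ solve 3 (λ p i b → p :+ (:- (p :* i)) :* b := p :+ :- (p :* (i :* b))) refl (⟦ P ⟧ u) (ℚ.1/ ⟦ b ⟧ u) (⟦ b ⟧ u) ⟩
        ⟦ P ⟧ u ⊕ ⊖ (⟦ P ⟧ u ⊛ ((ℚ.1/ ⟦ b ⟧ u) ⊛ ⟦ b ⟧ u)) ≡⟨ cong (λ z → ⟦ P ⟧ u ⊕ ⊖ (⟦ P ⟧ u ⊛ z)) (ℚP.*-inverseˡ (⟦ b ⟧ u)) ⟩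
        ⟦ P ⟧ u ⊕ ⊖ (⟦ P ⟧ u ⊛ 1ℚ) ≡⟨ solve 1 (λ p → p :+ :- (p :* con 1ℚ) := con 0ℚ) refl (⟦ P ⟧ u) ⟩
        0ℚ ∎
      solution = span reduced (closed P b (⊖ c) SP Sb , reduced-u)
      cs : List ℚ
      cs = proj₁ solution
      len : length cs ≡ length bs
      len = proj₁ (proj₂ solution)
      combine : P ≈ lincomb (c ∷ cs) (b ∷ bs)
      combine x y = begin
        p                                      ≡⟨ solve 3 (λ p c k → p := c :* k :+ (p :+ (:- c) :* k)) refl p c k ⟩
        c ⊛ k ⊕ (p ⊕ (⊖ c) ⊛ k)                ≡⟨ cong₂ (λ s t → s ⊕ (p ⊕ t)) (coeff-• c b x y) (coeff-• (⊖ c) b x y) ⟨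
        coeff (c • b) x y ⊕ (p ⊕ coeff ((⊖ c) • b) x y) ≡⟨ cong (coeff (c • b) x y ⊕_) (trans (sym (coeff-++ P _ x y)) (proj₂ (proj₂ solution) x y)) ⟩
        coeff (c • b) x y ⊕ coeff (lincomb cs bs) x y   ≡⟨ coeff-++ (c • b) (lincomb cs bs) x y ⟨
        coeff (lincomb (c ∷ cs) (b ∷ bs)) x y ∎
        where
        p = coeff P x y
        k = coeff b x y

  -- `lincomb` pairs coefficients and polynomials by position, so a permutation of the basis must
  -- also act on the coefficients. The last component carries their vanishing back, for `LinIndep`.
  Rearranged : List (Poly n) → List (Poly n) → Set
  Rearranged bs bs′ = ∀ cs → length cs ≡ length bs → ∃ λ cs′ → length cs′ ≡ length bs′ ×
    lincomb cs bs ≈ lincomb cs′ bs′ × (All (_≡ 0ℚ) cs′ → All (_≡ 0ℚ) cs)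

  rearrange : ∀ {bs bs′} → bs ↭ bs′ → Rearranged bs bs′
  rearrange _↭_.refl cs len = cs , len , (λ _ _ → refl) , id
  rearrange (_↭_.prep b p) (c ∷ cs) len with rearrange p cs (ℕP.suc-injective len)
  ... | cs′ , len′ , eq , back = c ∷ cs′ , cong suc len′ ,
    (λ x y → trans (coeff-++ (c • b) _ x y) (trans (cong (coeff (c • b) x y ⊕_) (eq x y)) (sym (coeff-++ (c • b) _ x y)))) ,
    λ { (z ∷ zs) → z ∷ back zs }
  rearrange (_↭_.swap {xs} {ys} b b′ p) (c ∷ c′ ∷ cs) len with rearrange p cs (ℕP.suc-injective (ℕP.suc-injective len))
  ... | cs′ , len′ , eq , back = c′ ∷ c ∷ cs′ , cong (2 ℕ.+_) len′ , swapped , λ { (z′ ∷ z ∷ zs) → z ∷ z′ ∷ back zs }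
    where
    split : ∀ (R S T : Poly n) x y → coeff (R ++ S ++ T) x y ≡ coeff R x y ⊕ (coeff S x y ⊕ coeff T x y)
    split R S T x y = trans (coeff-++ R _ x y) (cong (coeff R x y ⊕_) (coeff-++ S T x y))
    swapped : lincomb (c ∷ c′ ∷ cs) (b ∷ b′ ∷ xs) ≈ lincomb (c′ ∷ c ∷ cs′) (b′ ∷ b ∷ ys)
    swapped x y = begin
      coeff (lincomb (c ∷ c′ ∷ cs) (b ∷ b′ ∷ xs)) x y ≡⟨ split (c • b) (c′ • b′) (lincomb cs xs) x y ⟩
      r ⊕ (s ⊕ coeff (lincomb cs xs) x y)              ≡⟨ cong (λ t → r ⊕ (s ⊕ t)) (eq x y) ⟩
      r ⊕ (s ⊕ t)                                      ≡⟨ solve 3 (λ r s t → r :+ (s :+ t) := s :+ (r :+ t)) refl r s t ⟩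
      s ⊕ (r ⊕ t)                                      ≡⟨ split (c′ • b′) (c • b) (lincomb cs′ ys) x y ⟨
      coeff (lincomb (c′ ∷ c ∷ cs′) (b′ ∷ b ∷ ys)) x y ∎
      where
      r = coeff (c • b) x y
      s = coeff (c′ • b′) x y
      t = coeff (lincomb cs′ ys) x y
  rearrange (_↭_.trans p q) cs len with rearrange p cs len
  ... | cs′ , len′ , eq , back with rearrange q cs′ len′
  ...   | cs″ , len″ , eq′ , back′ = cs″ , len″ , (λ x y → trans (eq x y) (eq′ x y)) , back ∘ back′

  basis-↭ : ∀ {S : Poly n → Set} {bs bs′} → bs ↭ bs′ → IsBasis S bs → IsBasis S bs′
  basis-↭ {S} {bs} {bs′} p (mem , ind , span) = ↭P.All-resp-↭ p mem , independent , spanning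
    where
    independent : LinIndep bs′
    independent cs len eq with rearrange (↭-sym p) cs len
    ... | cs′ , len′ , eq′ , back = back (ind cs′ len′ (λ x y → trans (sym (eq′ x y)) (eq x y)))
    spanning : Spans S bs′
    spanning P SP with span P SP
    ... | cs , len , eq with rearrange p cs len
    ...   | cs′ , len′ , eq′ , _ = cs′ , len′ , λ x y → trans (eq x y) (eq′ x y)

-- Selecting the solution of an equation from a range

interval : ℕ → ℕ → List ℕ
interval lo zero    = []
interval lo (suc c) = lo ∷ interval (suc lo) c

range-interval : ∀ lo hi → range lo hi ≡ interval lo (suc hi ∸ lo)
range-interval lo hi = go lo (suc hi ∸ lo) (lo ℕ.+_) (λ i → i) (λ _ → refl)
  where
  go : ∀ lo c (f : ℕ → ℕ) (g : ℕ → ℕ) → (∀ i → f (g i) ≡ lo ℕ.+ i) → map f (applyUpTo g c) ≡ interval lo c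
  go lo zero    f g eq = refl
  go lo (suc c) f g eq = cong₂ _∷_ (trans (eq 0) (ℕP.+-identityʳ lo)) (go (suc lo) c f (g ∘ suc) (λ i → trans (eq (suc i)) (ℕP.+-suc lo i)))

-- The common body of the loops in `family`. For n = 2 + m their upper bounds compute to m, m ∸ 1
-- and m ∸ 2, so `family` unfolds to instances of this.
select : ∀ {A : Set} → (ℕ → ℕ) → (ℕ → A) → ℕ → ℕ → List A
select f g k i = if ⌊ f i ℕ.≟ k ⌋ then g i ∷ [] else []

Selected : ∀ {A : Set} → (ℕ → ℕ) → (ℕ → A) → ℕ → (ℕ → Set) → List A → Set
Selected f g k In l = (∃ λ i → In i × f i ≡ k × l ≡ g i ∷ []) ⊎ ((∀ i → In i → f i ≢ k) × l ≡ [])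

select-interval : ∀ {A : Set} (f : ℕ → ℕ) (g : ℕ → A) k → (∀ {i j} → f i ≡ f j → i ≡ j) → ∀ lo c →
  Selected f g k (λ i → lo ≤ i × i < lo ℕ.+ c) (concatMap (select f g k) (interval lo c))
select-interval f g k inj lo zero = inj₂ ((λ i (lo≤ , <lo) → contradiction (subst (i <_) (ℕP.+-identityʳ lo) <lo) (ℕP.≤⇒≯ lo≤)) , refl)
select-interval f g k inj lo (suc c) with f lo ℕ.≟ k | select-interval f g k inj (suc lo) c
... | yes eq | inj₁ (i , (lo< , _) , eq′ , _) = contradiction (inj (trans eq (sym eq′))) (ℕP.<⇒≢ lo<)
... | yes eq | inj₂ (_ , rest) = inj₁ (lo , (ℕP.≤-refl , ℕP.m<m+n lo (ℕ.s≤s ℕ.z≤n)) , eq , cong (g lo ∷_) rest)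
... | no ne  | inj₁ (i , (lo< , <hi) , eq , rest) = inj₁ (i , (ℕP.<⇒≤ lo< , subst (i <_) (sym (ℕP.+-suc lo c)) <hi) , eq , rest)
... | no ne  | inj₂ (none , rest) = inj₂ (none′ , rest)
  where
  none′ : ∀ i → lo ≤ i × i < lo ℕ.+ suc c → f i ≢ k
  none′ i (lo≤ , <hi) eq with ℕP.m≤n⇒m<n∨m≡n lo≤
  ... | inj₁ lo<  = none i (lo< , subst (i <_) (ℕP.+-suc lo c) <hi) eq
  ... | inj₂ refl = ne eq

select-range : ∀ {A : Set} (f : ℕ → ℕ) (g : ℕ → A) k → (∀ {i j} → f i ≡ f j → i ≡ j) → ∀ lo hi →
  Selected f g k (λ i → lo ≤ i × i ≤ hi) (concatMap (select f g k) (range lo hi))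
select-range f g k inj lo hi rewrite range-interval lo hi with select-interval f g k inj lo (suc hi ∸ lo)
... | inj₁ (i , (lo≤ , <hi) , rest) = inj₁ (i , (lo≤ , ℕP.≤-pred (subst (i <_) (ℕP.m+[n∸m]≡n lo≤hi) <hi)) , rest)
  where
  lo≤hi : lo ≤ suc hi
  lo≤hi with lo ℕ.≤? suc hi
  ... | yes p = p
  ... | no ¬p = contradiction (subst (λ z → i < lo ℕ.+ z) (ℕP.m≤n⇒m∸n≡0 (ℕP.<⇒≤ (ℕP.≰⇒> ¬p))) <hi) (λ i< → ℕP.≤⇒≯ lo≤ (subst (i <_) (ℕP.+-identityʳ lo) i<))
... | inj₂ (none , rest) = inj₂ ((λ i (lo≤ , ≤hi) → none i (lo≤ , subst (i <_) (sym (ℕP.m+[n∸m]≡n (ℕP.≤-trans lo≤ (ℕP.≤-trans ≤hi (ℕP.n≤1+n hi))))) (ℕ.s≤s ≤hi))) , rest)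

-- The alternants E_a E_b Δ

-- The divided-power coefficient of Δ at the x-exponents u, w, 0, ..., m - 1.
stair : ∀ m → ℕ → ℕ → ℚ
stair m u w = slater ((u , 0) ∷ (w , 0) ∷ Vec.map flat (staircase m)) (downFrom (2 ℕ.+ m))

stair-low : ∀ m u w → w < m → stair m u w ≡ 0ℚ
stair-low (suc m) u w (ℕ.s≤s w≤m) = antisym-repeat {C = λ v → slater ((u , 0) ∷ v) (downFrom (3 ℕ.+ m))}
  (λ s → slater-antisym (downFrom (3 ℕ.+ m)) (skip (u , 0) s)) (⇄*-map flat (proj₂ (staircase-∋ w≤m)))

stair-swap : ∀ m u w → stair m u w ≡ ⊖ stair m w u
stair-swap m u w = slater-antisym (downFrom (2 ℕ.+ m)) (swap (u , 0) (w , 0) (Vec.map flat (staircase m)))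

xDegree-flat : ∀ {n} (e : Vec ℕ n) → xDegree (Vec.map flat e) ≡ Vec.sum e
xDegree-flat e = cong Vec.sum (map-proj₁-flat e)

triangle-2+ : ∀ m → triangle (2 ℕ.+ m) ≡ suc (m ℕ.+ m) ℕ.+ triangle m
triangle-2+ m = trans (triangle-suc (suc m)) (cong suc (trans (cong (m ℕ.+_) (triangle-suc m)) (sym (ℕP.+-assoc m m (triangle m)))))

stair-degree : ∀ m u w → u ℕ.+ w ≢ suc (m ℕ.+ m) → stair m u w ≡ 0ℚ
stair-degree m u w ne = slater-x-degree ((u , 0) ∷ (w , 0) ∷ Vec.map flat (staircase m)) (downFrom (2 ℕ.+ m)) λ eq →
  ne (ℕP.+-cancelʳ-≡ (triangle m) _ _ (trans (ℕP.+-assoc u w (triangle m))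
    (trans (trans (cong (λ z → u ℕ.+ (w ℕ.+ z)) (sym (xDegree-flat (staircase m)))) (trans eq (sum-downFrom (2 ℕ.+ m)))) (triangle-2+ m))))

-- The total degree of Δ then forces w < m, an exponent that already occurs in the staircase.
stair-high : ∀ m u w → suc m < u → stair m u w ≡ 0ℚ
stair-high m u w m<u with u ℕ.+ w ℕ.≟ suc (m ℕ.+ m)
... | no ne  = stair-degree m u w ne
... | yes eq = stair-low m u w (ℕP.+-cancelˡ-< (suc m) w m (subst (suc m ℕ.+ w <_) eq (ℕP.+-monoˡ-< w m<u)))

-- No sign is computed: were this value 0, every `stair m p q` would be 0, and `antisym-staircase`
-- would make all coefficients of Δ vanish, against `slater-diagonal`.
stair-top≢0 : ∀ m → stair m (suc m) m ≢0
stair-top≢0 m top≡0 = 1≢0 (trans (sym (slater-diagonal (2 ℕ.+ m))) (antisym-staircase {N = triangle (2 ℕ.+ m)} harm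
    (λ p q s → slater-antisym (downFrom (2 ℕ.+ m)) (skip (p , 0) (skip (q , 0) (⇄-map flat s))))
    (λ v N< → slater-x-degree (Vec.map flat v) (downFrom (2 ℕ.+ m))
      (λ eq → ℕP.<-irrefl (sym (trans (sym (xDegree-flat v)) (trans eq (sum-downFrom (2 ℕ.+ m))))) N<))
    all≡0 (downFrom (2 ℕ.+ m))))
  where
  1≢0 : 1ℚ ≢0
  1≢0 ()
  harm : HarmonicX (λ e → slater (Vec.map flat e) (downFrom (2 ℕ.+ m)))
  harm a e = trans (sym (moves-map {w′ = one} {g′ = shift (suc a) 0} flat (λ _ → refl) (λ _ → refl) _ e))
    (slater-harmonic (suc a) 0 (ℕ.s≤s ℕ.z≤n) (Vec.map flat e))
  all≡0 : ∀ p q → stair m p q ≡ 0ℚ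
  all≡0 p q with ℕP.<-cmp p m
  ... | tri< p<m _ _  = trans (stair-swap m p q) (cong ⊖_ (stair-low m q p p<m))
  ... | tri≈ _ refl _ = trans (stair-swap m m q) (cong ⊖_ case)
    where
    case : stair m q m ≡ 0ℚ
    case with q ℕ.≟ suc m
    ... | yes refl = top≡0
    ... | no ne    = stair-degree m q m (λ eq → ne (ℕP.+-cancelʳ-≡ m q (suc m) eq))
  ... | tri> _ _ m<p with ℕP.m≤n⇒m<n∨m≡n m<p
  ...   | inj₁ 1+m<p = stair-high m p q 1+m<p
  ...   | inj₂ refl with q ℕ.≟ m
  ...     | yes refl = top≡0
  ...     | no ne    = stair-degree m (suc m) q (λ eq → ne (ℕP.+-cancelˡ-≡ (suc m) q m eq))

EE : ∀ {n} → ℕ → ℕ → Poly n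
EE {n} a b = E a (E b (Δ n))

⟦EE⟧ : ∀ {n} a b v → ⟦ EE {n} a b ⟧ v ≡ polarize a (polarize b (λ u → slater u (downFrom n))) v
⟦EE⟧ {n} a b v = trans (⟦⟧-E a (E b (Δ n)) v) (moves-cong (λ u → trans (⟦⟧-E b (Δ n) u) (moves-cong (⟦Δ⟧ n) u)) v)

EE-alternant : ∀ {n k a b} → 1 ≤ a → 1 ≤ b → a ℕ.+ b ≡ k → Alternant {n} k 2 ⟦ EE a b ⟧
EE-alternant {n} {k} {suc a} {suc b} _ _ eq = alternant-cong (⟦EE⟧ (suc a) (suc b))
  (subst (λ d → Alternant d 2 (polarize (suc a) (polarize (suc b) (λ u → slater u (downFrom n))))) (trans (cong (suc a ℕ.+_) (ℕP.+-identityʳ (suc b))) eq)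
    (polarize-alternant a (polarize-alternant b slater-alternant)))

module _ (m : ℕ) where

  -- The position of the leading coefficient of E_j E_i Δ.
  point : ℕ → ℕ → Vec Cell (2 ℕ.+ m)
  point i j = (suc m ∸ i , 1) ∷ (m ∸ j , 1) ∷ Vec.map flat (staircase m)

  EE-point : ∀ a b i j → ⟦ EE a b ⟧ (point i j) ≡
    stair m (a ℕ.+ (suc m ∸ i)) (b ℕ.+ (m ∸ j)) ⊕ stair m (b ℕ.+ (suc m ∸ i)) (a ℕ.+ (m ∸ j))
  EE-point a b i j = trans (⟦EE⟧ a b (point i j)) (polarize-twice a b (λ u → slater u (downFrom (2 ℕ.+ m))) (suc m ∸ i) (m ∸ j) (staircase m))

  above : ∀ {a i} → i ≤ m → i < a → suc m < a ℕ.+ (suc m ∸ i)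
  above {a} {i} i≤m i<a = subst (_< a ℕ.+ (suc m ∸ i)) (ℕP.m+[n∸m]≡n (ℕP.≤-trans i≤m (ℕP.n≤1+n m))) (ℕP.+-monoˡ-< (suc m ∸ i) i<a)

  -- Whichever of the shifts a and b the first exponent m + 1 - i receives, it passes m + 1. This is
  -- the triangularity: E_a E_b Δ vanishes at every point whose first index is below both a and b.
  EE-point-0 : ∀ {a b i} j → i ≤ m → i < a → i < b → ⟦ EE a b ⟧ (point i j) ≡ 0ℚ
  EE-point-0 {a} {b} {i} j i≤m i<a i<b = trans (EE-point a b i j)
    (0+ (stair-high m _ _ (above i≤m i<a)) (stair-high m _ _ (above i≤m i<b)))

  on-top : ∀ {i j} → i ≤ m → j ≤ m → stair m (i ℕ.+ (suc m ∸ i)) (j ℕ.+ (m ∸ j)) ≡ stair m (suc m) m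
  on-top i≤m j≤m = cong₂ (stair m) (ℕP.m+[n∸m]≡n (ℕP.≤-trans i≤m (ℕP.n≤1+n m))) (ℕP.m+[n∸m]≡n j≤m)

  -- For equal indices the two ways to distribute the shifts coincide, so the value is twice
  -- `stair m (suc m) m`.
  EE-diagonal≢0 : ∀ {i} → i ≤ m → ⟦ EE i i ⟧ (point i i) ≢0
  EE-diagonal≢0 {i} i≤m eq = stair-top≢0 m (*-cancel-0 {1ℚ ⊕ 1ℚ} (λ ()) (begin
    (1ℚ ⊕ 1ℚ) ⊛ κ             ≡⟨ solve 1 (λ k → (con 1ℚ :+ con 1ℚ) :* k := k :+ k) refl κ ⟩
    κ ⊕ κ                     ≡⟨ trans (EE-point i i i i) (cong₂ _⊕_ (on-top i≤m i≤m) (on-top i≤m i≤m)) ⟨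
    ⟦ EE i i ⟧ (point i i)    ≡⟨ eq ⟩
    0ℚ ∎))
    where κ = stair m (suc m) m

  -- Since i < j, only the distribution that gives i to the first exponent stays within m + 1.
  EE-lower : ∀ {i j} → i < j → j ≤ m → ⟦ EE i j ⟧ (point i j) ≡ stair m (suc m) m
  EE-lower {i} {j} i<j j≤m = trans (EE-point i j i j) (trans
    (cong₂ _⊕_ (on-top i≤m j≤m) (stair-high m _ _ (above i≤m i<j))) (ℚP.+-identityʳ _))
    where i≤m = ℕP.≤-trans (ℕP.<⇒≤ i<j) j≤m

  EE-upper : ∀ {i j} → i < j → j ≤ m → ⟦ EE j i ⟧ (point i j) ≡ stair m (suc m) m
  EE-upper {i} {j} i<j j≤m = trans (EE-point j i i j) (trans
    (cong₂ _⊕_ (stair-high m _ _ (above i≤m i<j)) (on-top i≤m j≤m)) (ℚP.+-identityˡ _))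
    where i≤m = ℕP.≤-trans (ℕP.<⇒≤ i<j) j≤m

-- The correspondence between A_n^{k,2} and its coefficient functions

triangle-div : ∀ n → (n * (n ∸ 1)) ℕD./ 2 ≡ triangle n
triangle-div n = trans (cong (ℕD._/ 2) (trans (sym (twice n)) refl)) (ℕD.m*n/n≡m (triangle n) 2)
  where
  twice : ∀ n → triangle n * 2 ≡ n * (n ∸ 1)
  twice zero    = refl
  twice (suc n) = begin
    triangle (suc n) * 2          ≡⟨ cong (_* 2) (triangle-suc n) ⟩
    (n ℕ.+ triangle n) * 2        ≡⟨ ℕP.*-distribʳ-+ 2 n (triangle n) ⟩
    n * 2 ℕ.+ triangle n * 2      ≡⟨ cong (n * 2 ℕ.+_) (twice n) ⟩
    n * 2 ℕ.+ n * (n ∸ 1)         ≡⟨ ℕP.*-distribˡ-+ n 2 (n ∸ 1) ⟨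
    n * (2 ℕ.+ (n ∸ 1))           ≡⟨ step n ⟩
    suc n * n ∎
    where
    step : ∀ n → n * (2 ℕ.+ (n ∸ 1)) ≡ suc n * n
    step zero    = refl
    step (suc n) = ℕP.*-comm (suc n) (2 ℕ.+ n)

⟦⟧-nonzero : ∀ {n} {P : Poly n} {v} → ⟦ P ⟧ v ≢0 → coeff P (Vec.map proj₁ v) (Vec.map proj₂ v) ≢0
⟦⟧-nonzero {P = P} {v} ne eq = ne (⟦⟧-zero {P = P} {v} eq)

≢⇒≡0 : ∀ {q} {A : Set} → (q ≢0 → A) → ¬ A → q ≡ 0ℚ
≢⇒≡0 {q} h ¬A with q ℚP.≟ 0ℚ
... | yes eq = eq
... | no ne  = contradiction (h ne) ¬A

module _ {n : ℕ} (k : ℤ) (l : ℕ) (P : Poly n) (P∈A : InA n k l P) where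

  InA-harmonic : ∀ a b → 0 < a ℕ.+ b → ∀ v → moves one (shift a b) ⟦ P ⟧ v ≡ 0ℚ
  InA-harmonic a b 0< v = trans (sym (⟦⟧-powerSum a b P v)) (⟦⟧-zero {P = sumP (map (λ i → iter a (∂x i) (iter b (∂y i) P)) (List.allFin n))} {v} (proj₁ P∈A a b 0< _ _))

  InA-antisym : Antisym ⟦ P ⟧
  InA-antisym = alternating⇒antisym {P = P} (proj₁ (proj₂ P∈A))

  InA-x-degree : ∀ v → + xDegree v ℤ.+ k ≢ + triangle n → ⟦ P ⟧ v ≡ 0ℚ
  InA-x-degree v = ≢⇒≡0 λ ne → trans (proj₁ (proj₂ (proj₂ P∈A) _ _ (⟦⟧-nonzero {P = P} {v} ne))) (cong +_ (triangle-div n))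

  InA-y-degree : ∀ v → yDegree v ≢ l → ⟦ P ⟧ v ≡ 0ℚ
  InA-y-degree v = ≢⇒≡0 λ ne → proj₂ (proj₂ (proj₂ P∈A) _ _ (⟦⟧-nonzero {P = P} {v} ne))

alternant⇒InA : ∀ {n k l} {P : Poly n} → Alternant k l ⟦ P ⟧ → InA n (+ k) l P
alternant⇒InA {n} {k} {l} {P} A = harm , antisym⇒alternating {P = P} (A .antisym) , bihom
  where
  harm : Harmonic P
  harm a b 0< = ⟦⟧-≈0 {P = sumP (map (λ i → iter a (∂x i) (iter b (∂y i) P)) (List.allFin n))} λ v → trans (⟦⟧-powerSum a b P v) (A .harmonic a b 0< v)
  bihom : Bihom (+ k) l P
  bihom a b ne = x-part , y-part
    where
    v = Vec.zip a b
    nonzero : ⟦ P ⟧ v ≢0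
    nonzero eq = *-≢0 (weight≢0 v) ne (trans (sym (⟦⟧-coeff P a b)) eq)
    x-part : + vsum a ℤ.+ + k ≡ + ((n * (n ∸ 1)) ℕD./ 2)
    x-part with k ℕ.+ xDegree v ℕ.≟ triangle n
    ... | yes eq = cong +_ (trans (ℕP.+-comm (vsum a) k) (trans (cong (λ z → k ℕ.+ Vec.sum z) (sym (VecP.map-proj₁-zip a b))) (trans eq (sym (triangle-div n)))))
    ... | no ≢   = contradiction (A .x-degree v ≢) nonzero
    y-part : vsum b ≡ l
    y-part with yDegree v ℕ.≟ l
    ... | yes eq = trans (cong Vec.sum (sym (VecP.map-proj₂-zip a b))) eq
    ... | no ≢   = contradiction (A .y-degree v ≢) nonzero

InA⇒alternant : ∀ {n k l} {P : Poly n} → InA n (+ k) l P → Alternant k l ⟦ P ⟧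
InA⇒alternant {k = k} {l} {P} P∈A = record
  { harmonic = InA-harmonic (+ k) l P P∈A
  ; antisym  = InA-antisym (+ k) l P P∈A
  ; x-degree = λ v ne → InA-x-degree (+ k) l P P∈A v (λ eq → ne (trans (ℕP.+-comm k (xDegree v)) (ℤP.+-injective eq)))
  ; y-degree = InA-y-degree (+ k) l P P∈A
  }

-- Tests are asked for only where p + q + k = 2m + 1: next to the staircase every other probe has
-- the wrong x-degree and vanishes. The integer k lets the lemma serve both halves of the theorem.
InA-unique : ∀ {m k} {P : Poly (2 ℕ.+ m)} → InA (2 ℕ.+ m) k 2 P →
  (∀ p q → q < p → p ≤ m → + (p ℕ.+ q) ℤ.+ k ≡ + suc (m ℕ.+ m) → probe ⟦ P ⟧ p q ≡ 0ℚ) → P ≈ zeroP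
InA-unique {m} {k} {P} P∈A tests = ⟦⟧-≈0 {P = P} (Uniqueness.unique {N = N} (InA-harmonic k 2 P P∈A) (InA-antisym k 2 P P∈A) bounded (InA-y-degree k 2 P P∈A) probes)
  where
  T = triangle (2 ℕ.+ m)
  -- The x-degree is T - k, which exceeds T when k is negative.
  N = T ℕ.+ ℤ.∣ k ∣
  bounded : ∀ v → N < xDegree v → ⟦ P ⟧ v ≡ 0ℚ
  bounded v N< = InA-x-degree k 2 P P∈A v λ eq → ℕP.<⇒≱ N< (subst (λ z → ℤ.∣ z ∣ ≤ N) (x≡ eq) (ℤP.∣i-j∣≤∣i∣+∣j∣ (+ T) k))
    where
    x≡ : + xDegree v ℤ.+ k ≡ + T → + T ℤ.- k ≡ + xDegree v
    x≡ eq = trans (cong (ℤ._- k) (sym eq)) (trans (ℤP.+-assoc (+ xDegree v) k (ℤ.- k)) (trans (cong (ℤ._+_ (+ xDegree v)) (ℤP.+-inverseʳ k)) (ℤP.+-identityʳ _)))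
  probes : ∀ p q → q < p → p ≤ m → probe ⟦ P ⟧ p q ≡ 0ℚ
  probes p q q<p p≤m with + (p ℕ.+ q) ℤ.+ k ℤP.≟ + suc (m ℕ.+ m)
  ... | yes eq = tests p q q<p p≤m eq
  ... | no ne  = InA-x-degree k 2 P P∈A ((p , 1) ∷ (q , 1) ∷ Vec.map flat (staircase m)) λ eq → ne (ℤG.∙-cancelʳ (+ triangle m) _ _ (begin
    (+ (p ℕ.+ q) ℤ.+ k) ℤ.+ + triangle m     ≡⟨ ℤP.+-assoc (+ (p ℕ.+ q)) k (+ triangle m) ⟩
    + (p ℕ.+ q) ℤ.+ (k ℤ.+ + triangle m)     ≡⟨ cong (ℤ._+_ (+ (p ℕ.+ q))) (ℤP.+-comm k (+ triangle m)) ⟩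
    + (p ℕ.+ q) ℤ.+ (+ triangle m ℤ.+ k)     ≡⟨ ℤP.+-assoc (+ (p ℕ.+ q)) (+ triangle m) k ⟨
    + (p ℕ.+ q ℕ.+ triangle m) ℤ.+ k         ≡⟨ cong (λ z → + z ℤ.+ k) (trans (ℕP.+-assoc p q (triangle m)) (cong (λ z → p ℕ.+ (q ℕ.+ z)) (sym (xDegree-flat (staircase m))))) ⟩
    + (p ℕ.+ (q ℕ.+ xDegree (Vec.map flat (staircase m)))) ℤ.+ k ≡⟨ eq ⟩
    + T                                       ≡⟨ cong +_ (triangle-2+ m) ⟩
    + suc (m ℕ.+ m) ℤ.+ + triangle m ∎))

-- The triangular structure of the family

suc-bound : ∀ m {i} → 1 ≤ i → i ≤ m ∸ 1 → suc i ≤ m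
suc-bound zero    1≤i i≤0 = contradiction (ℕP.≤-trans 1≤i i≤0) (λ ())
suc-bound (suc m) 1≤i i≤m = ℕ.s≤s i≤m

module _ (m k : ℕ) where

  Pair Wide : ℕ → ℕ → Set
  Pair i j = 1 ≤ i × i ≤ j × j ≤ m × i ℕ.+ j ≡ k
  Wide i j = Pair i j × 2 ℕ.+ i ≤ j

  -- The spaces met during the elimination, T being the set of positions already used. For empty T
  -- this is the space of all alternants of bidegree (k, 2); once T contains every `Pair`, it is
  -- zero.
  Killed : (ℕ → ℕ → Set) → Poly (2 ℕ.+ m) → Set
  Killed T P = Alternant k 2 ⟦ P ⟧ × (∀ i j → T i j → ⟦ P ⟧ (point m i j) ≡ 0ℚ)

  closed : ∀ T P Q c → Killed T P → Killed T Q → Killed T (P +P c • Q)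
  closed T P Q c (A , P0) (B , Q0) = alternant-cong (⟦⟧-+• P c Q) (alternant-linear A c B) ,
    λ i j t → trans (⟦⟧-+• P c Q (point m i j)) (0+ (P0 i j t) (trans (cong (c ⊛_) (Q0 i j t)) (ℚP.*-zeroʳ c)))

  all-killed : ∀ {T} → (∀ i j → Pair i j → T i j) → IsBasis (Killed T) []
  all-killed {T} all = basis-[] λ P (A , P0) → InA-unique {k = + k} {P} (alternant⇒InA {P = P} A) λ p q q<p p≤m eq →
    let p≤1+m = ℕP.≤-trans p≤m (ℕP.n≤1+n m)
        q≤m   = ℕP.≤-trans (ℕP.<⇒≤ q<p) p≤m
    in begin
    probe ⟦ P ⟧ p q                          ≡⟨ cong₂ (probe ⟦ P ⟧) (ℕP.m∸[m∸n]≡n p≤1+m) (ℕP.m∸[m∸n]≡n q≤m) ⟨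
    ⟦ P ⟧ (point m (suc m ∸ p) (m ∸ q))      ≡⟨ P0 (suc m ∸ p) (m ∸ q) (all _ _
      (ℕP.m<n⇒0<n∸m (ℕ.s≤s p≤m) , ℕP.∸-monoʳ-≤ (suc m) q<p , ℕP.m∸n≤m m q , pair-sum p q p≤1+m q≤m (ℤP.+-injective eq))) ⟩
    0ℚ ∎
    where
    pair-sum : ∀ p q → p ≤ suc m → q ≤ m → p ℕ.+ q ℕ.+ k ≡ suc (m ℕ.+ m) → (suc m ∸ p) ℕ.+ (m ∸ q) ≡ k
    pair-sum p q p≤ q≤ eq = ℕP.+-cancelˡ-≡ (p ℕ.+ q) _ _ (begin
      (p ℕ.+ q) ℕ.+ ((suc m ∸ p) ℕ.+ (m ∸ q))  ≡⟨ ℕP.+-assoc p q _ ⟩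
      p ℕ.+ (q ℕ.+ ((suc m ∸ p) ℕ.+ (m ∸ q)))  ≡⟨ cong (p ℕ.+_) (+-left-comm q (suc m ∸ p) (m ∸ q)) ⟩
      p ℕ.+ ((suc m ∸ p) ℕ.+ (q ℕ.+ (m ∸ q)))  ≡⟨ ℕP.+-assoc p (suc m ∸ p) _ ⟨
      (p ℕ.+ (suc m ∸ p)) ℕ.+ (q ℕ.+ (m ∸ q))  ≡⟨ cong₂ ℕ._+_ (ℕP.m+[n∸m]≡n p≤) (ℕP.m+[n∸m]≡n q≤) ⟩
      suc m ℕ.+ m                              ≡⟨ eq ⟨
      (p ℕ.+ q) ℕ.+ k ∎)

  -- One elimination step. The three hypotheses on T′ say that it is T with (i, j) adjoined, in
  -- whatever form suits the caller.
  kill : ∀ {T T′} i j b bs → Killed T b → ⟦ b ⟧ (point m i j) ≢0 →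
    (∀ i′ j′ → T i′ j′ → T′ i′ j′) → T′ i j → (∀ i′ j′ → T′ i′ j′ → T i′ j′ ⊎ (i′ ≡ i × j′ ≡ j)) →
    IsBasis (Killed T′) bs → IsBasis (Killed T) (b ∷ bs)
  kill {T} {T′} i j b bs Tb b≢0 weaken new cases basis = basis-∷ (closed T) (point m i j) b bs Tb b≢0
    (basis-resp (λ P (A , P0) → (A , λ i′ j′ t → P0 i′ j′ (weaken i′ j′ t)) , P0 i j new)
      (λ P ((A , P0) , Pij) → A , λ i′ j′ t′ → go P P0 Pij (cases i′ j′ t′)) basis)
    where
    go : ∀ P → (∀ i j → T i j → ⟦ P ⟧ (point m i j) ≡ 0ℚ) → ⟦ P ⟧ (point m i j) ≡ 0ℚ →
      ∀ {i′ j′} → T i′ j′ ⊎ (i′ ≡ i × j′ ≡ j) → ⟦ P ⟧ (point m i′ j′) ≡ 0ℚ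
    go P P0 Pij (inj₁ t)             = P0 _ _ t
    go P P0 Pij (inj₂ (refl , refl)) = Pij

  Extend : (ℕ → ℕ → Set) → ℕ → ℕ → ℕ → ℕ → Set
  Extend T i j i′ j′ = T i′ j′ ⊎ (i′ ≡ i × j′ ≡ j)

  kill-last : ∀ {T} i j b → Killed T b → ⟦ b ⟧ (point m i j) ≢0 → (∀ i′ j′ → Pair i′ j′ → Extend T i j i′ j′) →
    IsBasis (Killed T) (b ∷ [])
  kill-last {T} i j b Tb b≢0 all = kill {T} {Extend T i j} i j b [] Tb b≢0 (λ _ _ → inj₁) (inj₂ (refl , refl)) (λ _ _ → id) (all-killed all)

  diagonals offDiagonals : List (Poly (2 ℕ.+ m))
  diagonals    = concatMap (select (2 *_) (λ i → EE i i) k) (range 1 m)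
  offDiagonals = concatMap (select (λ i → 2 * i ℕ.+ 1) (λ i → EE i (suc i)) k) (range 1 (m ∸ 1))

  double : ∀ i → 2 * i ≡ i ℕ.+ i
  double i = cong (i ℕ.+_) (ℕP.+-identityʳ i)

  double+1 : ∀ i → 2 * i ℕ.+ 1 ≡ i ℕ.+ suc i
  double+1 i = trans (cong (ℕ._+ 1) (double i)) (trans (ℕP.+-assoc i i 1) (cong (i ℕ.+_) (ℕP.+-comm i 1)))

  even≢odd : ∀ i j → 2 * i ≢ 2 * j ℕ.+ 1
  even≢odd i j eq with ℕP.<-cmp i j
  ... | tri< i<j _ _  = ℕP.<⇒≢ (ℕP.<-≤-trans (ℕP.*-monoʳ-< 2 i<j) (ℕP.m≤m+n (2 * j) 1)) eq
  ... | tri≈ _ refl _ = ℕP.<⇒≢ (ℕP.m<m+n (2 * i) (ℕ.s≤s ℕ.z≤n)) eq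
  ... | tri> _ _ j<i  = ℕP.<⇒≢ (ℕP.<-≤-trans (subst (2 * j ℕ.+ 1 <_) (trans (ℕP.+-comm (2 * j) 2) (sym (ℕP.*-suc 2 j))) (ℕP.+-monoʳ-< (2 * j) ℕP.≤-refl)) (ℕP.*-monoʳ-≤ 2 j<i)) (sym eq)

  -- With the sum fixed, a larger difference means a smaller first index. By `EE-point-0` the
  -- members with j - i ≤ 1 therefore vanish at all wide positions.
  wide-< : ∀ {i j a b} → Wide i j → a ≤ b → b ≤ suc a → a ℕ.+ b ≡ k → i < a
  wide-< {i} {j} {a} {b} ((_ , _ , _ , eq) , 2+i≤j) a≤b b≤1+a eq′ = ℕP.≰⇒> λ a≤i →
    ℕP.<⇒≢ (ℕP.+-mono-≤-< a≤i (ℕP.≤-<-trans b≤1+a (ℕP.≤-trans (ℕ.s≤s (ℕ.s≤s a≤i)) 2+i≤j))) (trans eq′ (sym eq))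

  gap : ∀ {i j} → Pair i j → Wide i j ⊎ (j ≡ i × 2 * i ≡ k) ⊎ (j ≡ suc i × 2 * i ℕ.+ 1 ≡ k)
  gap {i} pr@(_ , i≤j , _ , eq) with ℕP.m≤n⇒m<n∨m≡n i≤j
  ... | inj₂ refl = inj₂ (inj₁ (refl , trans (double i) eq))
  ... | inj₁ i<j with ℕP.m≤n⇒m<n∨m≡n i<j
  ...   | inj₂ refl  = inj₂ (inj₂ (refl , trans (double+1 i) eq))
  ...   | inj₁ 1+i<j = inj₁ (pr , 1+i<j)

  -- By the parity of k at most one of the two lists is non-empty, and then its single element
  -- belongs to the only `Pair` that is not `Wide`. If both are empty, there is no such pair.
  narrow : ∀ {l l′} → Selected (2 *_) (λ i → EE i i) k (λ i → 1 ≤ i × i ≤ m) l →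
    Selected (λ i → 2 * i ℕ.+ 1) (λ i → EE i (suc i)) k (λ i → 1 ≤ i × i ≤ m ∸ 1) l′ → IsBasis (Killed Wide) (l ++ l′)
  narrow (inj₁ (i , _ , eq , _)) (inj₁ (j , _ , eq′ , _)) = contradiction (trans eq (sym eq′)) (even≢odd i j)
  narrow (inj₁ (i , (1≤i , i≤m) , eq , refl)) (inj₂ (none , refl)) =
    kill-last i i (EE i i) (EE-alternant 1≤i 1≤i i+i≡k , vanish) (EE-diagonal≢0 m i≤m) all
    where
    i+i≡k : i ℕ.+ i ≡ k
    i+i≡k = trans (sym (double i)) eq
    vanish : ∀ i′ j′ → Wide i′ j′ → ⟦ EE i i ⟧ (point m i′ j′) ≡ 0ℚ
    vanish i′ j′ w = EE-point-0 m j′ (ℕP.≤-trans (ℕP.<⇒≤ i′<i) i≤m) i′<i i′<i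
      where i′<i = wide-< w ℕP.≤-refl (ℕP.n≤1+n i) i+i≡k
    all : ∀ i′ j′ → Pair i′ j′ → Extend Wide i i i′ j′
    all i′ j′ pr@(1≤i′ , _ , j′≤m , _) with gap pr
    ... | inj₁ w = inj₁ w
    ... | inj₂ (inj₁ (refl , eq″)) = inj₂ (i′≡i , i′≡i)
      where i′≡i = ℕP.*-cancelˡ-≡ i′ i 2 (trans eq″ (sym eq))
    ... | inj₂ (inj₂ (refl , eq″)) = contradiction eq″ (none i′ (1≤i′ , ℕP.∸-monoˡ-≤ 1 j′≤m))
  narrow (inj₂ (none , refl)) (inj₁ (i , (1≤i , i≤m-1) , eq , refl)) =
    kill-last i (suc i) (EE i (suc i)) (EE-alternant 1≤i (ℕ.s≤s ℕ.z≤n) sum≡k , vanish)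
      (λ z → stair-top≢0 m (trans (sym (EE-lower m ℕP.≤-refl 1+i≤m)) z)) all
    where
    1+i≤m = suc-bound m 1≤i i≤m-1
    sum≡k : i ℕ.+ suc i ≡ k
    sum≡k = trans (sym (double+1 i)) eq
    vanish : ∀ i′ j′ → Wide i′ j′ → ⟦ EE i (suc i) ⟧ (point m i′ j′) ≡ 0ℚ
    vanish i′ j′ w = EE-point-0 m j′ (ℕP.≤-trans (ℕP.<⇒≤ i′<i) (ℕP.<⇒≤ 1+i≤m)) i′<i (ℕP.m<n⇒m<1+n i′<i)
      where i′<i = wide-< w (ℕP.n≤1+n i) ℕP.≤-refl sum≡k
    all : ∀ i′ j′ → Pair i′ j′ → Extend Wide i (suc i) i′ j′
    all i′ j′ pr@(1≤i′ , _ , j′≤m , _) with gap pr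
    ... | inj₁ w = inj₁ w
    ... | inj₂ (inj₁ (refl , eq″)) = contradiction eq″ (none i′ (1≤i′ , j′≤m))
    ... | inj₂ (inj₂ (refl , eq″)) = inj₂ (i′≡i , cong suc i′≡i)
      where i′≡i = ℕP.*-cancelˡ-≡ i′ i 2 (ℕP.+-cancelʳ-≡ 1 _ _ (trans eq″ (sym eq)))
  narrow (inj₂ (none , refl)) (inj₂ (none′ , refl)) = all-killed all
    where
    all : ∀ i j → Pair i j → Wide i j
    all i j pr@(1≤i , _ , j≤m , _) with gap pr
    ... | inj₁ w = w
    ... | inj₂ (inj₁ (refl , eq)) = contradiction eq (none i (1≤i , j≤m))
    ... | inj₂ (inj₂ (refl , eq)) = contradiction eq (none′ i (1≤i , ℕP.∸-monoˡ-≤ 1 j≤m))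

  narrow-basis : IsBasis (Killed Wide) (diagonals ++ offDiagonals)
  narrow-basis = narrow (select-range (2 *_) (λ i → EE i i) k (ℕP.*-cancelˡ-≡ _ _ 2) 1 m)
    (select-range (λ i → 2 * i ℕ.+ 1) (λ i → EE i (suc i)) k (λ eq → ℕP.*-cancelˡ-≡ _ _ 2 (ℕP.+-cancelʳ-≡ 1 _ _ eq)) 1 (m ∸ 1))

  column : ℕ → ℕ → Poly (2 ℕ.+ m)
  column i j = EE j i -P EE (j ∸ 1) (suc i)

  columns : ℕ → List (Poly (2 ℕ.+ m))
  columns i = concatMap (select (i ℕ.+_) (column i) k) (range (i ℕ.+ 2) m)

  WideBelow : ℕ → ℕ → ℕ → Set
  WideBelow lo i j = Wide i j × i < lo

  -- At every point with first index at most i the subtracted E_(j-1) E_(i+1) Δ vanishes, both of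
  -- its indices being larger than i. At (i, j) the value is thus that of E_j E_i Δ, the non-zero
  -- `stair m (suc m) m`.
  wide-column : ∀ {i j} → 1 ≤ i → 2 ℕ.+ i ≤ j → j ≤ m → i ℕ.+ j ≡ k →
    Killed (WideBelow i) (column i j) × ⟦ column i j ⟧ (point m i j) ≢0
  wide-column {i} {suc (suc j)} 1≤i (ℕ.s≤s (ℕ.s≤s i≤j)) j≤m eq =
    (alternant-cong (⟦⟧-+• (EE (2 ℕ.+ j) i) (⊖ 1ℚ) (EE (suc j) (suc i)))
      (alternant-linear (EE-alternant (ℕ.s≤s ℕ.z≤n) 1≤i (trans (ℕP.+-comm (2 ℕ.+ j) i) eq)) (⊖ 1ℚ)
        (EE-alternant (ℕ.s≤s ℕ.z≤n) (ℕ.s≤s ℕ.z≤n) (trans (ℕP.+-suc (suc j) i) (trans (ℕP.+-comm (2 ℕ.+ j) i) eq)))) ,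
     vanish) , nonzero
    where
    i≤m = ℕP.≤-trans i≤j (ℕP.≤-trans (ℕP.m≤n+m j 2) j≤m)
    value : ∀ u → ⟦ column i (2 ℕ.+ j) ⟧ u ≡ ⟦ EE (2 ℕ.+ j) i ⟧ u ⊕ (⊖ 1ℚ) ⊛ ⟦ EE (suc j) (suc i) ⟧ u
    value = ⟦⟧-+• (EE (2 ℕ.+ j) i) (⊖ 1ℚ) (EE (suc j) (suc i))
    second : ∀ {i′} j′ → i′ ≤ i → (⊖ 1ℚ) ⊛ ⟦ EE (suc j) (suc i) ⟧ (point m i′ j′) ≡ 0ℚ
    second j′ i′≤i = trans (cong ((⊖ 1ℚ) ⊛_) (EE-point-0 m j′ (ℕP.≤-trans i′≤i i≤m) (ℕ.s≤s (ℕP.≤-trans i′≤i i≤j)) (ℕ.s≤s i′≤i))) (ℚP.*-zeroʳ (⊖ 1ℚ))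
    vanish : ∀ i′ j′ → WideBelow i i′ j′ → ⟦ column i (2 ℕ.+ j) ⟧ (point m i′ j′) ≡ 0ℚ
    vanish i′ j′ (_ , i′<i) = trans (value (point m i′ j′)) (0+
      (EE-point-0 m j′ (ℕP.≤-trans (ℕP.<⇒≤ i′<i) i≤m) (ℕP.<-≤-trans i′<i (ℕP.≤-trans i≤j (ℕP.m≤n+m j 2))) i′<i)
      (second j′ (ℕP.<⇒≤ i′<i)))
    nonzero : ⟦ column i (2 ℕ.+ j) ⟧ (point m i (2 ℕ.+ j)) ≢0
    nonzero z = stair-top≢0 m (begin
      stair m (suc m) m                     ≡⟨ EE-upper m (ℕ.s≤s (ℕP.≤-trans i≤j (ℕP.n≤1+n j))) j≤m ⟨
      ⟦ EE (2 ℕ.+ j) i ⟧ pt                 ≡⟨ ℚP.+-identityʳ _ ⟨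
      ⟦ EE (2 ℕ.+ j) i ⟧ pt ⊕ 0ℚ            ≡⟨ cong (⟦ EE (2 ℕ.+ j) i ⟧ pt ⊕_) (second (2 ℕ.+ j) ℕP.≤-refl) ⟨
      ⟦ EE (2 ℕ.+ j) i ⟧ pt ⊕ (⊖ 1ℚ) ⊛ ⟦ EE (suc j) (suc i) ⟧ pt ≡⟨ value pt ⟨
      ⟦ column i (2 ℕ.+ j) ⟧ pt             ≡⟨ z ⟩
      0ℚ ∎)
      where pt = point m i (2 ℕ.+ j)

  -- For each first index `lo` at most one j satisfies lo + j = k, so each step uses at most one
  -- position. When `lo` reaches suc (m ∸ 2), the bounds 2 + i ≤ j ≤ m put every wide pair below it,
  -- and `narrow-basis` finishes.
  wide-basis : ∀ c lo → 1 ≤ lo → lo ℕ.+ c ≡ suc (m ∸ 2) →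
    IsBasis (Killed (WideBelow lo)) (concatMap columns (interval lo c) ++ (diagonals ++ offDiagonals))
  wide-basis zero lo 1≤lo lo≡ = basis-resp
    (λ P (A , P0) → A , λ i j (w , _) → P0 i j w)
    (λ P (A , P0) → A , λ i j w@((_ , _ , j≤m , _) , 2+i≤j) → P0 i j
      (w , subst (i <_) (sym (trans (sym (ℕP.+-identityʳ lo)) lo≡)) (ℕ.s≤s (ℕP.∸-monoˡ-≤ 2 (ℕP.≤-trans 2+i≤j j≤m)))))
    narrow-basis
  wide-basis (suc c) lo 1≤lo lo≡ = subst (IsBasis (Killed (WideBelow lo))) (sym (ListP.++-assoc (columns lo) _ _))
    (extend (select-range (lo ℕ.+_) (column lo) k (ℕP.+-cancelˡ-≡ lo _ _) (lo ℕ.+ 2) m))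
    where
    rest : List (Poly (2 ℕ.+ m))
    rest = concatMap columns (interval (suc lo) c) ++ (diagonals ++ offDiagonals)
    ih : IsBasis (Killed (WideBelow (suc lo))) rest
    ih = wide-basis c (suc lo) (ℕ.s≤s ℕ.z≤n) (trans (sym (ℕP.+-suc lo c)) lo≡)
    extend : ∀ {l} → Selected (lo ℕ.+_) (column lo) k (λ j → lo ℕ.+ 2 ≤ j × j ≤ m) l → IsBasis (Killed (WideBelow lo)) (l ++ rest)
    extend (inj₁ (j , (lo+2≤j , j≤m) , eq , refl)) =
      kill lo j (column lo j) rest (proj₁ wide) (proj₂ wide) (λ i′ j′ (w , i′<lo) → w , ℕP.m<n⇒m<1+n i′<lo)
        (((1≤lo , ℕP.≤-trans (ℕP.m≤n+m lo 2) 2+lo≤j , j≤m , eq) , 2+lo≤j) , ℕP.≤-refl) cases ih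
      where
      2+lo≤j : 2 ℕ.+ lo ≤ j
      2+lo≤j = subst (_≤ j) (ℕP.+-comm lo 2) lo+2≤j
      wide = wide-column 1≤lo 2+lo≤j j≤m eq
      cases : ∀ i′ j′ → WideBelow (suc lo) i′ j′ → WideBelow lo i′ j′ ⊎ (i′ ≡ lo × j′ ≡ j)
      cases i′ j′ (w@((_ , _ , _ , eq′) , _) , ℕ.s≤s i′≤lo) with ℕP.m≤n⇒m<n∨m≡n i′≤lo
      ... | inj₁ i′<lo = inj₁ (w , i′<lo)
      ... | inj₂ refl  = inj₂ (refl , ℕP.+-cancelˡ-≡ i′ j′ j (trans eq′ (sym eq)))
    extend (inj₂ (none , refl)) =
      basis-resp (λ P (A , P0) → A , λ i j (w , i<lo) → P0 i j (w , ℕP.m<n⇒m<1+n i<lo))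
        (λ P (A , P0) → A , λ i j w → P0 i j (below w)) ih
      where
      below : ∀ {i j} → WideBelow (suc lo) i j → WideBelow lo i j
      below {i} {j} (w@((_ , _ , j≤m , eq) , 2+i≤j) , ℕ.s≤s i≤lo) with ℕP.m≤n⇒m<n∨m≡n i≤lo
      ... | inj₁ i<lo = w , i<lo
      ... | inj₂ refl = contradiction eq (none j (subst (_≤ j) (ℕP.+-comm 2 i) 2+i≤j , j≤m))

  -- `WideBelow 1` is empty because i ≥ 1, so the elimination starts from the whole space. It takes
  -- the wide members first, whereas `family` lists them last; hence the permutation.
  family-basis : IsBasis (InA (2 ℕ.+ m) (+ k) 2) (family (2 ℕ.+ m) k)
  family-basis = basis-resp
    (λ P (A , _) → alternant⇒InA {P = P} A)
    (λ P P∈A → InA⇒alternant {P = P} P∈A , λ i j → λ { (((1≤i , _) , _) , i<1) → contradiction i<1 (ℕP.≤⇒≯ 1≤i) })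
    (basis-↭ (↭-trans (↭P.++-comm wides (diagonals ++ offDiagonals)) (↭-reflexive (ListP.++-assoc diagonals offDiagonals wides)))
      (subst (λ l → IsBasis (Killed (WideBelow 1)) (concatMap columns l ++ (diagonals ++ offDiagonals))) (sym (range-interval 1 (m ∸ 2)))
        (wide-basis (m ∸ 2) 1 ℕP.≤-refl refl)))
    where
    wides = concatMap columns (range 1 (m ∸ 2))

-- A test position has q < p ≤ m, hence p + q ≤ 2m - 1, and p + q + k = 2m + 1 then gives 2 ≤ k ≤ 2m
-- + 1 < 2n - 2 + 1. For the remaining k no test is left, and `InA-unique` applies vacuously.
vanishing : ∀ m (k : ℤ) → ¬ ((+ 2 ℤ.≤ k) × (k ℤ.≤ + (2 * (2 ℕ.+ m) ∸ 2))) →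
  (P : Poly (2 ℕ.+ m)) → InA (2 ℕ.+ m) k 2 P → P ≈ zeroP
vanishing m k outside P P∈A = InA-unique {k = k} {P} P∈A λ p q q<p p≤m eq → contradiction (bounds p q q<p p≤m eq) outside
  where
  bounds : ∀ p q → q < p → p ≤ m → + (p ℕ.+ q) ℤ.+ k ≡ + suc (m ℕ.+ m) → (+ 2 ℤ.≤ k) × (k ℤ.≤ + (2 * (2 ℕ.+ m) ∸ 2))
  bounds p q q<p p≤m eq = subst (+ 2 ℤ.≤_) (sym k≡) (ℤ.+≤+ (subst (_≤ M ∸ s) (ℕP.m+n∸n≡m 2 s) (ℕP.∸-monoˡ-≤ s 2+s≤M))) ,
    subst (ℤ._≤ + (2 * (2 ℕ.+ m) ∸ 2)) (sym k≡) (ℤ.+≤+ (ℕP.≤-trans (ℕP.m∸n≤m M s) M≤))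
    where
    s = p ℕ.+ q
    M = suc (m ℕ.+ m)
    2+s≤M : 2 ℕ.+ s ≤ M
    2+s≤M = ℕ.s≤s (subst (_≤ m ℕ.+ m) (ℕP.+-suc p q) (ℕP.+-mono-≤ p≤m (ℕP.≤-trans q<p p≤m)))
    k≡ : k ≡ + (M ∸ s)
    k≡ = ℤG.∙-cancelˡ (+ s) _ _ (trans eq (cong +_ (sym (ℕP.m+[n∸m]≡n (ℕP.≤-trans (ℕP.m≤n+m s 2) 2+s≤M)))))
    M≤ : M ≤ 2 * (2 ℕ.+ m) ∸ 2
    M≤ = ℕP.≤-trans (ℕP.≤-reflexive (sym (ℕP.+-suc m m))) (ℕP.+-monoʳ-≤ m
      (ℕP.≤-trans (ℕP.n≤1+n (suc m)) (ℕP.≤-reflexive (sym (ℕP.+-identityʳ (2 ℕ.+ m))))))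

mainTheorem5 : (n : ℕ) → 2 ≤ n →
    ((k : ℕ) → 2 ≤ k → k ≤ 2 * n ∸ 2 → IsBasis (InA n (+ k) 2) (family n k))
    × ((k : ℤ) → ¬ ((+ 2 ℤ.≤ k) × (k ℤ.≤ + (2 * n ∸ 2))) →
    (P : Poly n) → InA n k 2 P → P ≈ zeroP)
mainTheorem5 (suc zero)    (ℕ.s≤s ())
mainTheorem5 (suc (suc m)) _ = (λ k _ _ → family-basis m k) , vanishing m
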